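{- Let $k\ge1$ and let $\mathbb{K}$ be a field. If there is a matrix $M\in\mathbb{R}^{n_1\times n_2}$ of tropical rank $\le k$ and of Kapranov rank (over $\mathbb{K}$) $>k$, then $\mathrm{Pf}_k(n)\ne\mathrm{trop}(\mathcal{P}f_k(n))$, where $n=n_1+n_2$. This happens (for $\mathbb{K}=\mathbb{Q}$, $\mathbb{R}$ or $\mathbb{C}$), for example, for $k=3$ and any $n\ge14$, and for any $k\ge4$ and any $n\ge2k+4$.
   Context: For a weight vector $v$ on the variables of a polynomial ring over $\mathbb{K}$, $\mathrm{in}_v(f)$ is the sum of the terms of $f$ of maximum $v$-weight and $\mathrm{in}_v(I)$ is the ideal generated by $\mathrm{in}_v(f)$, $f\in I$. The tropical variety of (the variety $V$ of) an ideal $I$, denoted $\mathrm{trop}(V)$, is the set of real weight vectors $v$ such that $\mathrm{in}_v(I)$ contains no monomial. Edges $\{i,j\},\{i',j'\}$ with $i<j$, $i'<j'$ cross if $i<i'<j<j'$ or $i'<i<j'<j$. For $U\subset[n]$ with $|U|=2k+2$, the Pfaffian of degree $k+1$ of $U$ is $\sum_E(-1)^{\mathrm{cr}(E)}\prod_{\{i,j\}\in E}x_{i,j}$ over perfect matchings $E$ of $U$, where $\mathrm{cr}(E)$ is the number of crossing pairs in $E$. $\mathcal{P}f_k(n)$ is the variety in $\mathbb{K}^{\binom{[n]}{2}}$ of the ideal $I_k(n)$ generated by all these Pfaffians. $\mathrm{Pf}_k(n)$ (the tropical Pfaffian prevariety) is the set of $v\in\mathbb{R}^{\binom{[n]}{2}}$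 such that, for every $U\in\binom{[n]}{2k+2}$, the maximum of $\sum_{\{i,j\}\in E}v_{i,j}$ over perfect matchings $E$ of $U$ is attained at least twice. A real square matrix $M=(m_{ij})$ of size $r$ is tropically singular if $\max_{\sigma\in S_r}\sum_i m_{i\sigma(i)}$ is attained by at least two permutations, and tropically regular otherwise. The tropical rank of a matrix is the largest size of a tropically regular square submatrix (minor). The Kapranov rank of $M\in\mathbb{R}^{n_1\times n_2}$ over $\mathbb{K}$ is the smallest $r$ such that $M$ lies in the tropical variety of the ideal of $\mathbb{K}[y_{ij}]$ generated by the $(r+1)\times(r+1)$ minors of a generic $n_1\times n_2$ matrix $(y_{ij})$; equivalently, it is the smallest rank of a lift of $M$ to a matrix over a valued field (extending $\mathbb{K}$) whose entries have degrees $m_{ij}$. -}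

module Defs where

open import Algebra.Apartness using (HeytingCommutativeRing; HeytingField)
open import Algebra.Bundles using (CommutativeRing)
open import Algebra.Core using (Op₁; Op₂)
import Algebra.Solver.Ring.NaturalCoefficients.Default as NatSolver
import Algebra.Properties.Ring as RingProperties
open import Algebra.Structures using (IsCommutativeRing)
open import Data.Bool.Base using (if_then_else_)
open import Data.Fin as Fin using (Fin; zero; suc)
import Data.Fin.Properties as Fin
open import Data.Fin.Permutation as Perm using (Permutation′; _⟨$⟩ʳ_)
open import Data.Fin.Subset using (Subset; ∣_∣)
  renaming (_∈_ to _∈ˢ_)
open import Data.Fin.Subset.Properties using (_∈?_)
open import Data.List.Base using (List; []; _∷_; _++_; map; foldr; filter; length;
  allFin; cartesianProduct; cartesianProductWith; mapMaybe)
open import Data.List.Membership.Propositional using (_∈_)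
open import Data.List.Membership.Propositional.Properties using (∈-∃++)
open import Data.List.Relation.Unary.All using (All; all?)
open import Data.List.Relation.Unary.Any using (here)
open import Data.List.Relation.Binary.Permutation.Propositional
  using (_↭_; ↭-refl; ↭-sym; ↭-trans; prep)
open import Data.List.Relation.Binary.Permutation.Propositional.Properties
  using (∈-resp-↭; shift; drop-∷; ¬x∷xs↭[])
import Data.List.Membership.DecPropositional as DecMembership
open import Data.Maybe.Base using (Maybe; just; nothing)
open import Data.Nat as ℕ using (ℕ; zero; suc)
import Data.Nat.Properties as ℕ
open import Data.Product.Base using (∃₂; ∃-syntax; _×_; _,_; proj₁; proj₂; uncurry)
open import Data.Product.Properties using (≡-dec)
open import Data.Rational as ℚ using (ℚ; 0ℚ; 1ℚ; ½)
import Data.Rational.Properties as ℚ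
open import Data.Sum.Base using (_⊎_)
open import Level using (0ℓ; _⊔_)
open import Relation.Binary.Core using (Rel; _Preserves_⟶_)
open import Relation.Binary.Definitions using (DecidableEquality)
open import Relation.Binary.PropositionalEquality
open import Relation.Binary.Structures using (IsEquivalence)
open import Relation.Nullary using (¬_; Dec; yes; no; does)
open import Relation.Nullary.Decidable using (_×-dec_; _⊎-dec_; _→-dec_; map′; dec⇒maybe)
open import Relation.Unary using (Pred)
open import Tactic.RingSolver.Core.AlmostCommutativeRing using (fromCommutativeRing)
import Tactic.RingSolver.NonReflective as Solver

-- Cauchy sequences of rationals; the equality of ℝ is _≈ℝ_, the difference
-- being a null sequence.

infix 4 _≈ℝ_ _≤ℝ_
infixl 6 _+ℝ_
infixl 7 _*ℝ_
infix 8 -ℝ_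

dist : ℚ → ℚ → ℚ
dist p q = ℚ.∣ p ℚ.- q ∣

record ℝ : Set where
  constructor mkℝ
  field
    seq    : ℕ → ℚ
    cauchy : ∀ ε → 0ℚ ℚ.< ε →
             ∃[ N ] (∀ m n → N ℕ.≤ m → N ℕ.≤ n → dist (seq m) (seq n) ℚ.< ε)

open ℝ

_≈ℝ_ : Rel ℝ 0ℓ
x ≈ℝ y = ∀ ε → 0ℚ ℚ.< ε → ∃[ N ] (∀ n → N ℕ.≤ n → dist (seq x n) (seq y n) ℚ.< ε)

_≤ℝ_ : Rel ℝ 0ℓ
x ≤ℝ y = ∀ ε → 0ℚ ℚ.< ε → ∃[ N ] (∀ n → N ℕ.≤ n → seq x n ℚ.< seq y n ℚ.+ ε)

private
  module ℚS = Solver (fromCommutativeRing ℚ.+-*-commutativeRing (λ p → dec⇒maybe (0ℚ ℚ.≟ p)))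

dist-self : ∀ p → dist p p ≡ 0ℚ
dist-self p = cong ℚ.∣_∣ (ℚ.+-inverseʳ p)

dist-comm : ∀ p q → dist p q ≡ dist q p
dist-comm p q = trans (sym (ℚ.∣-p∣≡∣p∣ (p ℚ.- q))) (cong ℚ.∣_∣ lem)
  where
  open ℚS
  lem : ℚ.- (p ℚ.- q) ≡ q ℚ.- p
  lem = solve 2 (λ a b → (⊝ (a ⊕ (⊝ b))) ⊜ (b ⊕ (⊝ a))) refl p q

dist-tri : ∀ p q r → dist p r ℚ.≤ dist p q ℚ.+ dist q r
dist-tri p q r = subst (ℚ._≤ dist p q ℚ.+ dist q r) (cong ℚ.∣_∣ lem)
                       (ℚ.∣p+q∣≤∣p∣+∣q∣ (p ℚ.- q) (q ℚ.- r))
  where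
  open ℚS
  lem : (p ℚ.- q) ℚ.+ (q ℚ.- r) ≡ p ℚ.- r
  lem = solve 3 (λ a b c → ((a ⊕ (⊝ b)) ⊕ (b ⊕ (⊝ c))) ⊜ (a ⊕ (⊝ c))) refl p q r

dist-+ : ∀ p q r s → dist (p ℚ.+ q) (r ℚ.+ s) ℚ.≤ dist p r ℚ.+ dist q s
dist-+ p q r s = subst (ℚ._≤ dist p r ℚ.+ dist q s) (cong ℚ.∣_∣ lem)
                       (ℚ.∣p+q∣≤∣p∣+∣q∣ (p ℚ.- r) (q ℚ.- s))
  where
  open ℚS
  lem : (p ℚ.- r) ℚ.+ (q ℚ.- s) ≡ (p ℚ.+ q) ℚ.- (r ℚ.+ s)
  lem = solve 4 (λ a b c d → ((a ⊕ (⊝ c)) ⊕ (b ⊕ (⊝ d))) ⊜ ((a ⊕ b) ⊕ (⊝ (c ⊕ d)))) refl p q r s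

dist-neg : ∀ p q → dist (ℚ.- p) (ℚ.- q) ≡ dist p q
dist-neg p q = trans (cong ℚ.∣_∣ (sym (ℚ.neg-distrib-+ p (ℚ.- q)))) (ℚ.∣-p∣≡∣p∣ (p ℚ.- q))

dist-* : ∀ p q r s →
         dist (p ℚ.* q) (r ℚ.* s) ℚ.≤ ℚ.∣ p ∣ ℚ.* dist q s ℚ.+ ℚ.∣ s ∣ ℚ.* dist p r
dist-* p q r s = subst₂ ℚ._≤_ (cong ℚ.∣_∣ lem)
                   (cong₂ ℚ._+_ (ℚ.∣p*q∣≡∣p∣*∣q∣ p (q ℚ.- s)) (ℚ.∣p*q∣≡∣p∣*∣q∣ s (p ℚ.- r)))
                   (ℚ.∣p+q∣≤∣p∣+∣q∣ (p ℚ.* (q ℚ.- s)) (s ℚ.* (p ℚ.- r)))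
  where
  open ℚS
  lem : p ℚ.* (q ℚ.- s) ℚ.+ s ℚ.* (p ℚ.- r) ≡ p ℚ.* q ℚ.- r ℚ.* s
  lem = solve 4 (λ a b c d → ((a ⊗ (b ⊕ (⊝ d))) ⊕ (d ⊗ (a ⊕ (⊝ c)))) ⊜ ((a ⊗ b) ⊕ (⊝ (c ⊗ d)))) refl p q r s

half+half : ∀ ε → ½ ℚ.* ε ℚ.+ ½ ℚ.* ε ≡ ε
half+half ε = trans (sym (ℚ.*-distribʳ-+ ε ½ ½)) (ℚ.*-identityˡ ε)

half-pos : ∀ {ε} → 0ℚ ℚ.< ε → 0ℚ ℚ.< ½ ℚ.* ε
half-pos {ε} 0<ε = subst (ℚ._< ½ ℚ.* ε) (ℚ.*-zeroʳ ½) (ℚ.*-monoʳ-<-pos ½ 0<ε)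

shrink : ∀ b ε → 0ℚ ℚ.< b → 0ℚ ℚ.< ε → ∃[ δ ] (0ℚ ℚ.< δ × b ℚ.* δ ≡ ½ ℚ.* ε)
shrink b ε 0<b 0<ε = δ , pos , eq
  where
  instance
    b⁺ : ℚ.Positive b
    b⁺ = ℚ.positive 0<b
    b≢0 : ℚ.NonZero b
    b≢0 = ℚ.pos⇒nonZero b
    b⁻¹⁺ : ℚ.Positive (ℚ.1/ b)
    b⁻¹⁺ = ℚ.1/pos⇒pos b
  δ = ℚ.1/ b ℚ.* (½ ℚ.* ε)
  pos : 0ℚ ℚ.< δ
  pos = subst (ℚ._< δ) (ℚ.*-zeroʳ (ℚ.1/ b)) (ℚ.*-monoʳ-<-pos (ℚ.1/ b) (half-pos 0<ε))
  eq : b ℚ.* δ ≡ ½ ℚ.* ε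
  eq = trans (sym (ℚ.*-assoc b (ℚ.1/ b) (½ ℚ.* ε)))
         (trans (cong (ℚ._* (½ ℚ.* ε)) (ℚ.*-inverseʳ b)) (ℚ.*-identityˡ (½ ℚ.* ε)))

bounded : (x : ℝ) → ∃₂ λ b N → 0ℚ ℚ.< b × (∀ n → N ℕ.≤ n → ℚ.∣ seq x n ∣ ℚ.< b)
bounded x = 1ℚ ℚ.+ ℚ.∣ x₀ ∣ , N , pos , bd
  where
  N = proj₁ (cauchy x 1ℚ (ℚ.positive⁻¹ 1ℚ))
  x₀ = seq x N
  pos : 0ℚ ℚ.< 1ℚ ℚ.+ ℚ.∣ x₀ ∣
  pos = ℚ.+-mono-<-≤ (ℚ.positive⁻¹ 1ℚ) (ℚ.0≤∣p∣ x₀)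
  split : ∀ p q → p ≡ (p ℚ.- q) ℚ.+ q
  split p q = solve 2 (λ a b → a ⊜ ((a ⊕ (⊝ b)) ⊕ b)) refl p q where open ℚS
  bd : ∀ n → N ℕ.≤ n → ℚ.∣ seq x n ∣ ℚ.< 1ℚ ℚ.+ ℚ.∣ x₀ ∣
  bd n N≤n = ℚ.≤-<-trans
    (subst (λ t → ℚ.∣ t ∣ ℚ.≤ dist (seq x n) x₀ ℚ.+ ℚ.∣ x₀ ∣) (sym (split (seq x n) x₀))
           (ℚ.∣p+q∣≤∣p∣+∣q∣ (seq x n ℚ.- x₀) x₀))
    (ℚ.+-monoˡ-< ℚ.∣ x₀ ∣ (proj₂ (cauchy x 1ℚ (ℚ.positive⁻¹ 1ℚ)) n N N≤n ℕ.≤-refl))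

dist-*-small : ∀ {b c p q r s δ δ′ ε} → b ℚ.* δ ≡ ½ ℚ.* ε → c ℚ.* δ′ ≡ ½ ℚ.* ε →
               0ℚ ℚ.< b → 0ℚ ℚ.< c →
               ℚ.∣ p ∣ ℚ.< b → ℚ.∣ s ∣ ℚ.< c → dist q s ℚ.< δ → dist p r ℚ.< δ′ →
               dist (p ℚ.* q) (r ℚ.* s) ℚ.< ε
dist-*-small {b} {c} {p} {q} {r} {s} {δ} {δ′} {ε} eq eq′ 0<b 0<c p<b s<c qs pr =
  ℚ.≤-<-trans (dist-* p q r s)
    (subst (ℚ.∣ p ∣ ℚ.* dist q s ℚ.+ ℚ.∣ s ∣ ℚ.* dist p r ℚ.<_) (half+half ε)
      (ℚ.+-mono-< (subst (ℚ.∣ p ∣ ℚ.* dist q s ℚ.<_) eq (step p q s 0<b p<b qs))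
                  (subst (ℚ.∣ s ∣ ℚ.* dist p r ℚ.<_) eq′ (step s p r 0<c s<c pr))))
  where
  step : ∀ {b δ} p q s → 0ℚ ℚ.< b → ℚ.∣ p ∣ ℚ.< b → dist q s ℚ.< δ →
         ℚ.∣ p ∣ ℚ.* dist q s ℚ.< b ℚ.* δ
  step {b} p q s 0<b p<b qs =
    ℚ.≤-<-trans
      (ℚ.*-monoʳ-≤-nonNeg (dist q s) {{ℚ.nonNegative (ℚ.0≤∣p∣ (q ℚ.- s))}} (ℚ.<⇒≤ p<b))
      (ℚ.*-monoʳ-<-pos b {{ℚ.positive 0<b}} qs)

≗⇒≈ℝ : ∀ {x y} → (∀ n → seq x n ≡ seq y n) → x ≈ℝ y
≗⇒≈ℝ {x} {y} eq ε 0<ε = 0 , λ n _ →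
  subst (ℚ._< ε) (sym (trans (cong (λ t → dist t (seq y n)) (eq n)) (dist-self (seq y n)))) 0<ε

≈ℝ-isEquivalence : IsEquivalence _≈ℝ_
≈ℝ-isEquivalence = record
  { refl  = λ {x} → ≗⇒≈ℝ {x} {x} λ _ → refl
  ; sym   = λ {x} {y} x≈y ε 0<ε → let N , h = x≈y ε 0<ε in
              N , λ n N≤n → subst (ℚ._< ε) (dist-comm (seq x n) (seq y n)) (h n N≤n)
  ; trans = λ {x} {y} {z} x≈y y≈z ε 0<ε →
      let N , h  = x≈y (½ ℚ.* ε) (half-pos 0<ε)
          M , h′ = y≈z (½ ℚ.* ε) (half-pos 0<ε)
      in N ℕ.⊔ M , λ n le → ℚ.≤-<-trans (dist-tri (seq x n) (seq y n) (seq z n))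
           (subst (_ ℚ.<_) (half+half ε)
             (ℚ.+-mono-< (h n (ℕ.m⊔n≤o⇒m≤o N M le)) (h′ n (ℕ.m⊔n≤o⇒n≤o N M le))))
  }

fromℚ : ℚ → ℝ
fromℚ q = mkℝ (λ _ → q) λ ε 0<ε → 0 , λ _ _ _ _ → subst (ℚ._< ε) (sym (dist-self q)) 0<ε

0ℝ 1ℝ : ℝ
0ℝ = fromℚ 0ℚ
1ℝ = fromℚ 1ℚ

_+ℝ_ : Op₂ ℝ
x +ℝ y = mkℝ (λ n → seq x n ℚ.+ seq y n) λ ε 0<ε →
  let N , h  = cauchy x (½ ℚ.* ε) (half-pos 0<ε)
      M , h′ = cauchy y (½ ℚ.* ε) (half-pos 0<ε)
  in N ℕ.⊔ M , λ m n lem len →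
       ℚ.≤-<-trans (dist-+ (seq x m) (seq y m) (seq x n) (seq y n))
         (subst (_ ℚ.<_) (half+half ε)
           (ℚ.+-mono-< (h m n (ℕ.m⊔n≤o⇒m≤o N M lem) (ℕ.m⊔n≤o⇒m≤o N M len))
                       (h′ m n (ℕ.m⊔n≤o⇒n≤o N M lem) (ℕ.m⊔n≤o⇒n≤o N M len))))

-ℝ_ : Op₁ ℝ
-ℝ x = mkℝ (λ n → ℚ.- seq x n) λ ε 0<ε →
  let N , h = cauchy x ε 0<ε
  in N , λ m n lem len → subst (ℚ._< ε) (sym (dist-neg (seq x m) (seq x n))) (h m n lem len)

_*ℝ_ : Op₂ ℝ
x *ℝ y = mkℝ (λ n → seq x n ℚ.* seq y n) λ ε 0<ε →
  let b , A , 0<b , bd  = bounded x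
      c , B , 0<c , bd′ = bounded y
      δ , 0<δ , eq      = shrink b ε 0<b 0<ε
      δ′ , 0<δ′ , eq′   = shrink c ε 0<c 0<ε
      N , h  = cauchy y δ 0<δ
      M , h′ = cauchy x δ′ 0<δ′
  in (A ℕ.⊔ B) ℕ.⊔ (N ℕ.⊔ M) , λ m n lem len →
       let AB≤m = ℕ.m⊔n≤o⇒m≤o (A ℕ.⊔ B) (N ℕ.⊔ M) lem
           AB≤n = ℕ.m⊔n≤o⇒m≤o (A ℕ.⊔ B) (N ℕ.⊔ M) len
           NM≤m = ℕ.m⊔n≤o⇒n≤o (A ℕ.⊔ B) (N ℕ.⊔ M) lem
           NM≤n = ℕ.m⊔n≤o⇒n≤o (A ℕ.⊔ B) (N ℕ.⊔ M) len
       in dist-*-small {p = seq x m} {q = seq y m} {r = seq x n} {s = seq y n} eq eq′ 0<b 0<c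
            (bd m (ℕ.m⊔n≤o⇒m≤o A B AB≤m))
            (bd′ n (ℕ.m⊔n≤o⇒n≤o A B AB≤n))
            (h m n (ℕ.m⊔n≤o⇒m≤o N M NM≤m) (ℕ.m⊔n≤o⇒m≤o N M NM≤n))
            (h′ m n (ℕ.m⊔n≤o⇒n≤o N M NM≤m) (ℕ.m⊔n≤o⇒n≤o N M NM≤n))

+ℝ-cong : ∀ {x y u v} → x ≈ℝ y → u ≈ℝ v → x +ℝ u ≈ℝ y +ℝ v
+ℝ-cong {x} {y} {u} {v} x≈y u≈v ε 0<ε =
  let N , h  = x≈y (½ ℚ.* ε) (half-pos 0<ε)
      M , h′ = u≈v (½ ℚ.* ε) (half-pos 0<ε)
  in N ℕ.⊔ M , λ n le → ℚ.≤-<-trans (dist-+ (seq x n) (seq u n) (seq y n) (seq v n))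
       (subst (_ ℚ.<_) (half+half ε)
         (ℚ.+-mono-< (h n (ℕ.m⊔n≤o⇒m≤o N M le)) (h′ n (ℕ.m⊔n≤o⇒n≤o N M le))))

-ℝ-cong : ∀ {x y} → x ≈ℝ y → -ℝ x ≈ℝ -ℝ y
-ℝ-cong {x} {y} x≈y ε 0<ε =
  let N , h = x≈y ε 0<ε
  in N , λ n le → subst (ℚ._< ε) (sym (dist-neg (seq x n) (seq y n))) (h n le)

*ℝ-cong : ∀ {x y u v} → x ≈ℝ y → u ≈ℝ v → x *ℝ u ≈ℝ y *ℝ v
*ℝ-cong {x} {y} {u} {v} x≈y u≈v ε 0<ε =
  let b , A , 0<b , bd  = bounded x
      c , B , 0<c , bd′ = bounded v
      δ , 0<δ , eq      = shrink b ε 0<b 0<ε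
      δ′ , 0<δ′ , eq′   = shrink c ε 0<c 0<ε
      N , h  = u≈v δ 0<δ
      M , h′ = x≈y δ′ 0<δ′
  in (A ℕ.⊔ B) ℕ.⊔ (N ℕ.⊔ M) , λ n le →
       let AB≤ = ℕ.m⊔n≤o⇒m≤o (A ℕ.⊔ B) (N ℕ.⊔ M) le
           NM≤ = ℕ.m⊔n≤o⇒n≤o (A ℕ.⊔ B) (N ℕ.⊔ M) le
       in dist-*-small {p = seq x n} {q = seq u n} {r = seq y n} {s = seq v n} eq eq′ 0<b 0<c
            (bd n (ℕ.m⊔n≤o⇒m≤o A B AB≤))
            (bd′ n (ℕ.m⊔n≤o⇒n≤o A B AB≤))
            (h n (ℕ.m⊔n≤o⇒m≤o N M NM≤))
            (h′ n (ℕ.m⊔n≤o⇒n≤o N M NM≤))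

ℝ-isCommutativeRing : IsCommutativeRing _≈ℝ_ _+ℝ_ _*ℝ_ -ℝ_ 0ℝ 1ℝ
ℝ-isCommutativeRing = record
  { isRing = record
    { +-isAbelianGroup = record
      { isGroup = record
        { isMonoid = record
          { isSemigroup = record
            { isMagma = record
              { isEquivalence = ≈ℝ-isEquivalence
              ; ∙-cong = λ {x} {y} {u} {v} → +ℝ-cong {x} {y} {u} {v}
              }
            ; assoc = λ x y z → ≗⇒≈ℝ {(x +ℝ y) +ℝ z} {x +ℝ (y +ℝ z)}
                        λ n → ℚ.+-assoc (seq x n) (seq y n) (seq z n)
            }
          ; identity = (λ x → ≗⇒≈ℝ {0ℝ +ℝ x} {x} λ n → ℚ.+-identityˡ (seq x n))
                     , (λ x → ≗⇒≈ℝ {x +ℝ 0ℝ} {x} λ n → ℚ.+-identityʳ (seq x n))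
          }
        ; inverse = (λ x → ≗⇒≈ℝ { -ℝ x +ℝ x} {0ℝ} λ n → ℚ.+-inverseˡ (seq x n))
                  , (λ x → ≗⇒≈ℝ {x +ℝ -ℝ x} {0ℝ} λ n → ℚ.+-inverseʳ (seq x n))
        ; ⁻¹-cong = λ {x} {y} → -ℝ-cong {x} {y}
        }
      ; comm = λ x y → ≗⇒≈ℝ {x +ℝ y} {y +ℝ x} λ n → ℚ.+-comm (seq x n) (seq y n)
      }
    ; *-cong = λ {x} {y} {u} {v} → *ℝ-cong {x} {y} {u} {v}
    ; *-assoc = λ x y z → ≗⇒≈ℝ {(x *ℝ y) *ℝ z} {x *ℝ (y *ℝ z)}
                  λ n → ℚ.*-assoc (seq x n) (seq y n) (seq z n)
    ; *-identity = (λ x → ≗⇒≈ℝ {1ℝ *ℝ x} {x} λ n → ℚ.*-identityˡ (seq x n))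
                 , (λ x → ≗⇒≈ℝ {x *ℝ 1ℝ} {x} λ n → ℚ.*-identityʳ (seq x n))
    ; distrib = (λ x y z → ≗⇒≈ℝ {x *ℝ (y +ℝ z)} {x *ℝ y +ℝ x *ℝ z}
                  λ n → ℚ.*-distribˡ-+ (seq x n) (seq y n) (seq z n))
              , (λ x y z → ≗⇒≈ℝ {(y +ℝ z) *ℝ x} {y *ℝ x +ℝ z *ℝ x}
                  λ n → ℚ.*-distribʳ-+ (seq x n) (seq y n) (seq z n))
    }
  ; *-comm = λ x y → ≗⇒≈ℝ {x *ℝ y} {y *ℝ x} λ n → ℚ.*-comm (seq x n) (seq y n)
  }

ℚ-ring ℝ-ring : CommutativeRing 0ℓ 0ℓ
ℚ-ring = ℚ.+-*-commutativeRing
ℝ-ring = record { isCommutativeRing = ℝ-isCommutativeRing }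

-- R[i]: the pair (a , b) is a + b i.

module AdjoinI {c ℓ} (R : CommutativeRing c ℓ) where
  open CommutativeRing R renaming (Carrier to A)
  private
    module S = NatSolver commutativeSemiring

  _≈ᵢ_ : Rel (A × A) ℓ
  (a , b) ≈ᵢ (c , d) = a ≈ c × b ≈ d

  _+ᵢ_ _*ᵢ_ : Op₂ (A × A)
  (a , b) +ᵢ (c , d) = a + c , b + d
  (a , b) *ᵢ (c , d) = a * c - b * d , a * d + b * c

  -ᵢ_ : Op₁ (A × A)
  -ᵢ (a , b) = - a , - b

  private
    isCommutativeRingᵢ : IsCommutativeRing _≈ᵢ_ _+ᵢ_ _*ᵢ_ -ᵢ_ (0# , 0#) (1# , 0#)
    isCommutativeRingᵢ = record
      { isRing = record
        { +-isAbelianGroup = record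
          { isGroup = record
            { isMonoid = record
              { isSemigroup = record
                { isMagma = record
                  { isEquivalence = record
                    { refl = refl′ , refl′
                    ; sym = λ (p , q) → sym′ p , sym′ q
                    ; trans = λ (p , q) (r , s) → trans′ p r , trans′ q s
                    }
                  ; ∙-cong = λ (p , q) (r , s) → +-cong p r , +-cong q s
                  }
                ; assoc = λ (a , b) (c , d) (e , f) → +-assoc a c e , +-assoc b d f
                }
              ; identity = (λ (a , b) → +-identityˡ a , +-identityˡ b)
                         , (λ (a , b) → +-identityʳ a , +-identityʳ b)
              }
            ; inverse = (λ (a , b) → -‿inverseˡ a , -‿inverseˡ b)
                      , (λ (a , b) → -‿inverseʳ a , -‿inverseʳ b)
            ; ⁻¹-cong = λ (p , q) → -‿cong p , -‿cong q
            }
          ; comm = λ (a , b) (c , d) → +-comm a c , +-comm b d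
          }
        ; *-cong = λ (p , q) (r , s) →
            +-cong (*-cong p r) (-‿cong (*-cong q s)) , +-cong (*-cong p s) (*-cong q r)
        ; *-assoc = assocᵢ
        ; *-identity = (λ x → identityˡᵢ x)
                     , (λ x → transᵢ (commᵢ x (1# , 0#)) (identityˡᵢ x))
        ; distrib = distribˡᵢ
                  , (λ x y z → transᵢ (commᵢ (y +ᵢ z) x)
                       (transᵢ (distribˡᵢ x y z)
                         (+-cong (proj₁ (commᵢ x y)) (proj₁ (commᵢ x z))
                         , +-cong (proj₂ (commᵢ x y)) (proj₂ (commᵢ x z)))))
        }
      ; *-comm = commᵢ
      }
      where
      open S
      open RingProperties ring using (-0#≈0#; -1*x≈-x)
      open CommutativeRing R using () renaming (refl to refl′; sym to sym′; trans to trans′)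
      transᵢ : ∀ {x y z} → x ≈ᵢ y → y ≈ᵢ z → x ≈ᵢ z
      transᵢ (p , q) (r , s) = trans′ p r , trans′ q s
      n = - 1#
      conv : ∀ {x x′ y y′} → x ≈ x′ → y ≈ y′ → x - y ≈ x′ + n * y′
      conv {y = y} p q = +-cong p (trans′ (sym′ (-1*x≈-x y)) (*-congˡ q))
      assocᵢ : ∀ x y z → ((x *ᵢ y) *ᵢ z) ≈ᵢ (x *ᵢ (y *ᵢ z))
      assocᵢ (a , b) (c , d) (e , f) =
          trans′ (conv (*-congʳ (conv refl′ refl′)) refl′)
            (trans′
              (solve 7 (λ n a b c d e f →
                ((((a :* c) :+ (n :* (b :* d))) :* e) :+ (n :* (((a :* d) :+ (b :* c)) :* f)))
                := ((a :* ((c :* e) :+ (n :* (d :* f)))) :+ (n :* (b :* ((c :* f) :+ (d :* e))))))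
                refl′ n a b c d e f)
              (sym′ (conv (*-congˡ (conv refl′ refl′)) refl′)))
        , trans′ (+-congʳ (*-congʳ (conv refl′ refl′)))
            (trans′
              (solve 7 (λ n a b c d e f →
                ((((a :* c) :+ (n :* (b :* d))) :* f) :+ (((a :* d) :+ (b :* c)) :* e))
                := ((a :* ((c :* f) :+ (d :* e))) :+ (b :* ((c :* e) :+ (n :* (d :* f))))))
                refl′ n a b c d e f)
              (sym′ (+-congˡ (*-congˡ (conv refl′ refl′)))))
      commᵢ : ∀ x y → (x *ᵢ y) ≈ᵢ (y *ᵢ x)
      commᵢ (a , b) (c , d) =
          +-cong (*-comm a c) (-‿cong (*-comm b d))
        , trans′ (+-comm (a * d) (b * c)) (+-cong (*-comm b c) (*-comm a d))
      identityˡᵢ : ∀ x → ((1# , 0#) *ᵢ x) ≈ᵢ x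
      identityˡᵢ (a , b) =
          trans′ (+-cong (*-identityˡ a) (trans′ (-‿cong (zeroˡ b)) -0#≈0#)) (+-identityʳ a)
        , trans′ (+-cong (*-identityˡ b) (zeroˡ a)) (+-identityʳ b)
      distribˡᵢ : ∀ x y z → (x *ᵢ (y +ᵢ z)) ≈ᵢ ((x *ᵢ y) +ᵢ (x *ᵢ z))
      distribˡᵢ (a , b) (c , d) (e , f) =
          trans′ (conv refl′ refl′)
            (trans′
              (solve 7 (λ n a b c d e f →
                ((a :* (c :+ e)) :+ (n :* (b :* (d :+ f))))
                := (((a :* c) :+ (n :* (b :* d))) :+ ((a :* e) :+ (n :* (b :* f)))))
                refl′ n a b c d e f)
              (sym′ (+-cong (conv refl′ refl′) (conv refl′ refl′))))
        , solve 6 (λ a b c d e f →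
            ((a :* (d :+ f)) :+ (b :* (c :+ e)))
            := (((a :* d) :+ (b :* c)) :+ ((a :* f) :+ (b :* e))))
            refl′ a b c d e f

  commutativeRing : CommutativeRing c ℓ
  commutativeRing = record { isCommutativeRing = isCommutativeRingᵢ }

ℂ-ring : CommutativeRing 0ℓ 0ℓ
ℂ-ring = AdjoinI.commutativeRing ℝ-ring

-- A monomial in the variables X is a finite multiset of variables: a list,
-- taken up to _↭_.
Monomial : Set → Set
Monomial X = List X

-- Also the weight of a matching, as the list of its edges, and of a
-- permutation, as the list of its positions in a matrix.
weight : {X : Set} → (X → ℝ) → List X → ℝ
weight v = foldr (λ x s → v x +ℝ s) 0ℝ

module _ {X : Set} (_≟_ : DecidableEquality X) where
  open DecMembership _≟_ using () renaming (_∈?_ to _∈ᴸ?_)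

  _↭?_ : (m m′ : Monomial X) → Dec (m ↭ m′)
  []       ↭? []       = yes ↭-refl
  []       ↭? (y ∷ ys) = no λ p → ¬x∷xs↭[] (↭-sym p)
  (x ∷ xs) ↭? ys with x ∈ᴸ? ys
  ... | no x∉ys = no λ p → x∉ys (∈-resp-↭ p (here refl))
  ... | yes x∈ys with ∈-∃++ x∈ys
  ...   | as , bs , refl =
    map′ (λ p → ↭-trans (prep x p) (↭-sym (shift x as bs)))
         (λ p → drop-∷ (↭-trans p (shift x as bs)))
         (xs ↭? (as ++ bs))

module Polynomials {c ℓ} (R : CommutativeRing c ℓ) {X : Set} (_≟_ : DecidableEquality X) where
  open CommutativeRing R using (_≈_; _+_; _*_; -_; 0#; 1#) renaming (Carrier to A)

  infix 4 _≈ₚ_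
  infixl 6 _+ₚ_
  infixl 7 _*ₚ_

  -- A polynomial is a formal sum of terms, in which a monomial may occur
  -- several times (or with coefficient 0#): polynomials are compared through
  -- their coefficients.
  Poly : Set c
  Poly = List (A × Monomial X)

  coeff : Poly → Monomial X → A
  coeff []            m = 0#
  coeff ((a , m′) ∷ f) m = if does (_↭?_ _≟_ m′ m) then a + coeff f m else coeff f m

  _≈ₚ_ : Rel Poly ℓ
  f ≈ₚ g = ∀ m → coeff f m ≈ coeff g m

  0ₚ : Poly
  0ₚ = []

  monomial : Monomial X → Poly
  monomial m = (1# , m) ∷ []

  _+ₚ_ _*ₚ_ : Op₂ Poly
  _+ₚ_ = _++_
  _*ₚ_ = cartesianProductWith λ (a , m) (b , m′) → a * b , m ++ m′

  sign : ℕ → A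
  sign zero    = 1#
  sign (suc n) = - sign n

  data ⟨_⟩ {p} (G : Pred Poly p) : Pred Poly (c ⊔ ℓ ⊔ p) where
    gen    : ∀ {f} → G f → ⟨ G ⟩ f
    nil    : ⟨ G ⟩ 0ₚ
    add    : ∀ {f g} → ⟨ G ⟩ f → ⟨ G ⟩ g → ⟨ G ⟩ (f +ₚ g)
    mul    : ∀ h {f} → ⟨ G ⟩ f → ⟨ G ⟩ (h *ₚ f)
    ≈-resp : ∀ {f g} → f ≈ₚ g → ⟨ G ⟩ f → ⟨ G ⟩ g

  Support : Poly → Pred (Monomial X) ℓ
  Support f m = ¬ (coeff f m ≈ 0#)

  module _ (v : X → ℝ) where

    Leading : Poly → Pred (Monomial X) ℓ
    Leading f m = Support f m × (∀ m′ → Support f m′ → weight v m′ ≤ℝ weight v m)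

    -- g = in_v(f).  A relation, not a function, because comparing weights in ℝ
    -- and testing coefficients for zero are not computable.
    IsInitialForm : Poly → Poly → Set ℓ
    IsInitialForm f g =
      ∀ m → (Leading f m → coeff g m ≈ coeff f m) × (¬ Leading f m → coeff g m ≈ 0#)

    initialIdeal : ∀ {p} → Pred Poly p → Pred Poly (c ⊔ ℓ ⊔ p)
    initialIdeal I = ⟨ (λ g → ∃[ f ] I f × IsInitialForm f g) ⟩

  trop : ∀ {p} → Pred Poly p → Pred (X → ℝ) (c ⊔ ℓ ⊔ p)
  trop I v = ∀ m → ¬ initialIdeal v I (monomial m)

record Edge (n : ℕ) : Set where
  constructor edge
  field
    lo hi  : Fin n
    .lo<hi : lo Fin.< hi

open Edge

_≟ᴱ_ : ∀ {n} → DecidableEquality (Edge n)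
edge i j _ ≟ᴱ edge i′ j′ _ =
  map′ (λ { (refl , refl) → refl }) (λ { refl → refl , refl }) (i Fin.≟ i′ ×-dec j Fin.≟ j′)

edge? : ∀ {n} → Fin n → Fin n → Maybe (Edge n)
edge? i j with i Fin.<? j
... | yes i<j = just (edge i j i<j)
... | no  _   = nothing

allEdges : ∀ n → List (Edge n)
allEdges n = mapMaybe (uncurry edge?) (cartesianProduct (allFin n) (allFin n))

sublists : ∀ {A : Set} → List A → List (List A)
sublists []       = [] ∷ []
sublists (x ∷ xs) = map (x ∷_) (sublists xs) ++ sublists xs

degree : ∀ {n} → Fin n → List (Edge n) → ℕ
degree i E = length (filter (λ e → i Fin.≟ lo e ⊎-dec i Fin.≟ hi e) E)

IsPerfectMatching : ∀ {n} → Subset n → List (Edge n) → Set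
IsPerfectMatching U E =
  All (λ e → lo e ∈ˢ U × hi e ∈ˢ U) E × (∀ i → i ∈ˢ U → degree i E ≡ 1)

isPerfectMatching? : ∀ {n} (U : Subset n) E → Dec (IsPerfectMatching U E)
isPerfectMatching? U E =
  all? (λ e → lo e ∈? U ×-dec hi e ∈? U) E
  ×-dec Fin.all? (λ i → i ∈? U →-dec degree i E ℕ.≟ 1)

-- A set of edges is listed in the order of allEdges, so each perfect matching
-- occurs exactly once, and distinct matchings are distinct lists.
perfectMatchings : ∀ {n} → Subset n → List (List (Edge n))
perfectMatchings {n} U = filter (isPerfectMatching? U) (sublists (allEdges n))

Cross : ∀ {n} → Edge n → Edge n → Set
Cross e e′ = (lo e  Fin.< lo e′ × lo e′ Fin.< hi e  × hi e  Fin.< hi e′)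
           ⊎ (lo e′ Fin.< lo e  × lo e  Fin.< hi e′ × hi e′ Fin.< hi e)

cross? : ∀ {n} (e e′ : Edge n) → Dec (Cross e e′)
cross? e e′ =
  (lo e  Fin.<? lo e′ ×-dec lo e′ Fin.<? hi e  ×-dec hi e  Fin.<? hi e′) ⊎-dec
  (lo e′ Fin.<? lo e  ×-dec lo e  Fin.<? hi e′ ×-dec hi e′ Fin.<? hi e)

crossings : ∀ {n} → List (Edge n) → ℕ
crossings []      = 0
crossings (e ∷ E) = length (filter (cross? e) E) ℕ.+ crossings E

Pf : (k n : ℕ) → Pred (Edge n → ℝ) 0ℓ
Pf k n v = ∀ (U : Subset n) → ∣ U ∣ ≡ 2 ℕ.* k ℕ.+ 2 →
  ∃₂ λ E E′ → E ∈ perfectMatchings U × E′ ∈ perfectMatchings U × E ≢ E′ ×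
    weight v E ≈ℝ weight v E′ ×
    (∀ F → F ∈ perfectMatchings U → weight v F ≤ℝ weight v E)

module PfaffianIdeal {c ℓ} (R : CommutativeRing c ℓ) (k n : ℕ) where
  open Polynomials R (_≟ᴱ_ {n}) public

  -- As a monomial, the list of edges E is the product of the x_e, e ∈ E.
  pfaffian : Subset n → Poly
  pfaffian U = map (λ E → sign (crossings E) , E) (perfectMatchings U)

  I : Pred Poly (c ⊔ ℓ)
  I = ⟨ (λ f → ∃[ U ] (∣ U ∣ ≡ 2 ℕ.* k ℕ.+ 2 × f ≡ pfaffian U)) ⟩

trop-𝓟f : ∀ {c ℓ} → CommutativeRing c ℓ → (k n : ℕ) → Pred (Edge n → ℝ) (c ⊔ ℓ)
trop-𝓟f R k n = trop I
  where open PfaffianIdeal R k n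

Matrix : ℕ → ℕ → Set
Matrix n₁ n₂ = Fin n₁ × Fin n₂ → ℝ

-- An r-element subset of Fin n, as its increasing enumeration.
record Selection (r n : ℕ) : Set where
  field
    pick       : Fin r → Fin n
    increasing : pick Preserves Fin._<_ ⟶ Fin._<_

open Selection

module _ {r n₁ n₂ : ℕ} (ρ : Selection r n₁) (γ : Selection r n₂) where

  positions : Permutation′ r → List (Fin n₁ × Fin n₂)
  positions σ = map (λ i → pick ρ i , pick γ (σ ⟨$⟩ʳ i)) (allFin r)

  -- The submatrix of M with rows ρ and columns γ is tropically singular.
  Singular : Matrix n₁ n₂ → Set
  Singular M = ∃₂ λ (σ τ : Permutation′ r) → ¬ (σ Perm.≈ τ) ×
    weight M (positions σ) ≈ℝ weight M (positions τ) ×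
    (∀ π → weight M (positions π) ≤ℝ weight M (positions σ))

-- Every tropically regular square submatrix has size at most k.
TropicalRank≤ : ∀ {n₁ n₂} → Matrix n₁ n₂ → ℕ → Set
TropicalRank≤ {n₁} {n₂} M k =
  ∀ r (ρ : Selection r n₁) (γ : Selection r n₂) → ¬ Singular ρ γ M → r ℕ.≤ k

-- Each permutation of Fin r, exactly once, by the image of zero.
permutations : ∀ r → List (Permutation′ r)
permutations zero    = Perm.id ∷ []
permutations (suc r) = cartesianProductWith (Perm.insert zero) (allFin (suc r)) (permutations r)

inversions : ∀ {r} → Permutation′ r → ℕ
inversions {r} σ = length (filter
  (λ (i , j) → i Fin.<? j ×-dec (σ ⟨$⟩ʳ j) Fin.<? (σ ⟨$⟩ʳ i))
  (cartesianProduct (allFin r) (allFin r)))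

module DeterminantalIdeal {c ℓ} (R : CommutativeRing c ℓ) (n₁ n₂ : ℕ) where
  open Polynomials R (≡-dec (Fin._≟_ {n₁}) (Fin._≟_ {n₂})) public

  minor : ∀ {r} → Selection r n₁ → Selection r n₂ → Poly
  minor {r} ρ γ = map (λ σ → sign (inversions σ) , positions ρ γ σ) (permutations r)

  Minors : ℕ → Pred Poly (c ⊔ ℓ)
  Minors r = ⟨ (λ f → ∃₂ λ (ρ : Selection r n₁) (γ : Selection r n₂) → f ≡ minor ρ γ) ⟩

-- The least r with M in the tropical variety of the (r+1)-minors exceeds k.
KapranovRank> : ∀ {c ℓ} → CommutativeRing c ℓ → ∀ {n₁ n₂} → Matrix n₁ n₂ → ℕ → Set (c ⊔ ℓ)
KapranovRank> R {n₁} {n₂} M k = ∀ r → trop (Minors (suc r)) M → k ℕ.< r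
  where open DeterminantalIdeal R n₁ n₂

-- The commutative ring underlying a field.  Given excluded middle, Heyting
-- fields are exactly the fields, with x # y being ¬ (x ≈ y).
fieldRing : ∀ {c ℓ₁ ℓ₂} → HeytingField c ℓ₁ ℓ₂ → CommutativeRing c ℓ₁
fieldRing K = HeytingCommutativeRing.commutativeRing (HeytingField.heytingCommutativeRing K)

-- Given M, let v be M on the edges joining a row to a column and very negative on the other
-- edges, whose smaller end is made to act as a copy of one fixed column (or row), the more
-- negative the larger that end.  By exchanging two edges, an optimal matching of 2k + 2
-- vertices either is seen not to be the only one, or amounts to k + 1 entries of M in distinct
-- rows and columns, and then it is tied because M has tropical rank at most k.  So v lies in
-- Pf.  Conversely, a minor is up to sign the part of a Pfaffian supported on the edges joining
-- rows to columns, so every f in the ideal of minors lifts to a member of the Pfaffian ideal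
-- with the same initial form, as soon as v is negative enough for f.  A monomial in the
-- initial ideal of the minors thus gives one in the initial ideal of the Pfaffians.  As the
-- order of ℝ is undecidable, the argument runs under a double negation.
--
-- The examples are integral matrices for which an explicit member of the ideal of minors has
-- a single cheapest term: the incidence matrix of the Fano plane for k = 3 and a 6 × 6 matrix
-- of Shitov's type for k = 4.  Duplicating a column raises n; adding a row and a column that
-- are dear except for their common entry raises k, by Laplace expansion.

module Submission where

open import Defs
open import Algebra.Apartness using (HeytingField)
open import Algebra.Bundles using (CommutativeRing)
import Algebra.Properties.Ring as RingProperties
open import Data.Bool.Base using (Bool; true; false; if_then_else_; not; _xor_)
import Data.Bool.Properties as Bool
open import Data.Empty using (⊥; ⊥-elim; ⊥-elim-irr)
open import Data.Fin as Fin using (Fin; zero; suc; toℕ; punchIn; _↑ˡ_; _↑ʳ_)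
open import Data.Fin.Permutation as Perm using (Permutation′; _⟨$⟩ʳ_; _⟨$⟩ˡ_)
open import Data.Fin.Patterns
import Data.Fin.Properties as Fin
open import Data.Fin.Subset using (Subset; ∣_∣) renaming (_∈_ to _∈ˢ_)
import Data.Integer as ℤ
import Data.Integer.Properties as ℤ
open import Data.List.Base using (List; []; _∷_; _++_; map; foldr; filter; length; allFin;
  tabulate; cartesianProduct; cartesianProductWith; mapMaybe)
import Data.List.Base as List
import Data.List.Properties as List
open import Data.List.Membership.Propositional using (_∈_; _∉_; find; lose)
import Data.List.Membership.Propositional.Properties as ∈
import Data.List.Membership.DecPropositional as DecMembership
open import Data.List.Relation.Binary.Permutation.Propositional
  using (_↭_; ↭-refl; ↭-sym; ↭-trans; ↭-reflexive; prep; swap)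
import Data.List.Relation.Binary.Permutation.Propositional as ↭
import Data.List.Relation.Binary.Permutation.Propositional.Properties as ↭
open import Data.List.Relation.Unary.All as All using (All; []; _∷_)
import Data.List.Relation.Unary.All.Properties as All
open import Data.List.Relation.Unary.AllPairs as AllPairs using (AllPairs; []; _∷_)
import Data.List.Relation.Unary.AllPairs.Properties as AllPairs
open import Data.List.Relation.Unary.Any as Any using (Any; here; there)
import Data.List.Relation.Unary.Any.Properties as Any
open import Data.List.Relation.Unary.Unique.Propositional using (Unique)
import Data.List.Relation.Unary.Unique.Propositional.Properties as Unique
open import Data.Maybe.Base using (Maybe; just; nothing)
open import Data.Nat as ℕ using (ℕ; zero; suc; _+_; _*_; _∸_; _≤_; _<_; z≤n; s≤s)
open import Data.Nat.Coprimality as Coprime using (1-coprimeTo)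
import Data.Nat.Properties as ℕ
open import Data.Product using (Σ; ∃; ∃₂; ∃-syntax; _×_; _,_; proj₁; proj₂; uncurry)
open import Data.Product.Properties using (≡-dec)
open import Data.Rational as ℚ using (ℚ; 0ℚ; 1ℚ; ½)
import Data.Rational.Properties as ℚ
import Data.Rational.Unnormalised as ℚᵘ
import Data.Rational.Unnormalised.Properties as ℚᵘ
open import Data.Sum using (_⊎_; inj₁; inj₂; [_,_]′)
open import Data.Vec.Base as Vec using (Vec; []; _∷_)
import Data.Vec.Properties as Vec
open import Function using (_∘_; id; case_of_)
open import Level using (0ℓ; _⊔_)
open import Relation.Binary.Definitions using (DecidableEquality; tri<; tri≈; tri>)
open import Relation.Binary.PropositionalEquality
open import Relation.Nullary using (¬_; Dec; yes; no; does; contradiction; recompute)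
open import Relation.Nullary.Decidable using (_×-dec_; _→-dec_; ¬?; True; map′; dec⇒maybe;
  toWitness; decidable-stable; dec-true; dec-false; ¬¬-excluded-middle)
open import Relation.Unary using (Pred; _≐_)
open import Tactic.RingSolver.Core.AlmostCommutativeRing using (fromCommutativeRing)
import Tactic.RingSolver.NonReflective as Solver
open Edge using (lo; hi)
open ℝ using (seq; cauchy)
open Selection using (pick; increasing)

-- Real numbers

-- The choice of `v` inside the two sides is the delicate point. If `U` has `k + 2` rows and `k`
-- columns, every matching has an edge between two rows. A constant penalty on such edges would
-- leave just `k` entries of the matrix, about whose ties the rank bound says nothing. The inner
-- edge must itself supply the missing entry: its lower end `i` imitates column zero, its upper end
-- `j` contributes the entry in row `j`. For a rearrangement of the `k + 1` entries to be read back
-- as a matching, whichever row lands in column zero must be joinable to `i` as lower end, so `i`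
-- should be the least of the rows. This is why the penalty grows with the lower end, by more than
-- the entries can compensate. The size of the penalty cannot be fixed in advance. A monomial in an
-- initial ideal comes with a finite derivation from several initial forms, each lifting only beyond
-- its own threshold; statements are therefore made for all large `C`, and `C` is chosen once the
-- derivation is known. The equality to be refuted concerns every weight, so this is permitted, and
-- as it is refuted by deriving `⊥`, the double negations can be discharged there.

module ℚS = Solver (fromCommutativeRing ℚ.+-*-commutativeRing (λ p → dec⇒maybe (0ℚ ℚ.≟ p)))

infixl 1 _>>=¬¬_

_>>=¬¬_ : ∀ {a b} {A : Set a} {B : Set b} → ¬ ¬ A → (A → ¬ ¬ B) → ¬ ¬ B
(¬¬a >>=¬¬ f) ¬b = ¬¬a λ a → f a ¬b

return¬¬ : ∀ {a} {A : Set a} → A → ¬ ¬ A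
return¬¬ a ¬a = ¬a a

¬¬-all : ∀ {a p} {A : Set a} {P : Pred A p} → (∀ x → ¬ ¬ P x) → (xs : List A) → ¬ ¬ All P xs
¬¬-all h []       = return¬¬ []
¬¬-all h (x ∷ xs) = h x >>=¬¬ λ px → ¬¬-all h xs >>=¬¬ λ pxs → return¬¬ (px ∷ pxs)



p≤∣p∣ : ∀ p → p ℚ.≤ ℚ.∣ p ∣
p≤∣p∣ p with ℚ.≤-total 0ℚ p
... | inj₁ 0≤p = ℚ.≤-reflexive (sym (ℚ.0≤p⇒∣p∣≡p 0≤p))
... | inj₂ p≤0 = ℚ.≤-trans p≤0 (ℚ.0≤∣p∣ p)

<-dist : ∀ {p q δ} → dist p q ℚ.< δ → p ℚ.< q ℚ.+ δ
<-dist {p} {q} {δ} d = subst₂ ℚ._<_ eq (ℚ.+-comm δ q) (ℚ.+-monoˡ-< q (ℚ.≤-<-trans (p≤∣p∣ (p ℚ.- q)) d))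
  where
  eq : p ℚ.- q ℚ.+ q ≡ p
  eq = solve 2 (λ a b → ((a ⊕ (⊝ b)) ⊕ b) ⊜ a) refl p q where open ℚS

dist-< : ∀ {p q δ} → p ℚ.< q ℚ.+ δ → q ℚ.< p ℚ.+ δ → dist p q ℚ.< δ
dist-< {p} {q} {δ} h k with ℚ.∣p∣≡p∨∣p∣≡-p (p ℚ.- q)
... | inj₁ e = subst₂ ℚ._<_ (sym e) (eq q δ) (ℚ.+-monoˡ-< (ℚ.- q) h)
  where
  eq : ∀ q δ → q ℚ.+ δ ℚ.- q ≡ δ
  eq = solve 2 (λ a b → ((a ⊕ b) ⊕ (⊝ a)) ⊜ b) refl where open ℚS
... | inj₂ e = subst₂ ℚ._<_ (trans (eq₁ p q) (sym e)) (eq p δ) (ℚ.+-monoˡ-< (ℚ.- p) k)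
  where
  eq : ∀ q δ → q ℚ.+ δ ℚ.- q ≡ δ
  eq = solve 2 (λ a b → ((a ⊕ b) ⊕ (⊝ a)) ⊜ b) refl where open ℚS
  eq₁ : ∀ p q → q ℚ.- p ≡ ℚ.- (p ℚ.- q)
  eq₁ = solve 2 (λ a b → (b ⊕ (⊝ a)) ⊜ (⊝ (a ⊕ (⊝ b)))) refl where open ℚS

<-+ : ∀ p q r a b → p ℚ.< q ℚ.+ a → q ℚ.< r ℚ.+ b → p ℚ.< r ℚ.+ (b ℚ.+ a)
<-+ p q r a b h k = ℚ.<-trans h
  (subst (q ℚ.+ a ℚ.<_) (ℚ.+-assoc r b a) (ℚ.+-monoˡ-< a k))

<-+½ : ∀ p q r ε → p ℚ.< q ℚ.+ ½ ℚ.* ε → q ℚ.< r ℚ.+ ½ ℚ.* ε → p ℚ.< r ℚ.+ ε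
<-+½ p q r ε h k = subst (λ e → p ℚ.< r ℚ.+ e) (half+half ε) (<-+ p q r (½ ℚ.* ε) (½ ℚ.* ε) h k)

p<p+ε : ∀ p {ε} → 0ℚ ℚ.< ε → p ℚ.< p ℚ.+ ε
p<p+ε p {ε} 0<ε = subst (ℚ._< p ℚ.+ ε) (ℚ.+-identityʳ p) (ℚ.+-monoʳ-< p 0<ε)

≈⇒≤ℝ : ∀ {x y} → x ≈ℝ y → x ≤ℝ y
≈⇒≤ℝ x≈y ε 0<ε = let N , h = x≈y ε 0<ε in N , λ n N≤n → <-dist (h n N≤n)

≤ℝ-refl : ∀ {x} → x ≤ℝ x
≤ℝ-refl {x} ε 0<ε = 0 , λ n _ → p<p+ε (seq x n) 0<ε

≤ℝ-trans : ∀ {x y z} → x ≤ℝ y → y ≤ℝ z → x ≤ℝ z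
≤ℝ-trans {x} {y} {z} x≤y y≤z ε 0<ε =
  let N , h = x≤y (½ ℚ.* ε) (half-pos 0<ε)
      M , k = y≤z (½ ℚ.* ε) (half-pos 0<ε)
  in N ℕ.⊔ M , λ n le → <-+½ (seq x n) (seq y n) (seq z n) ε (h n (ℕ.m⊔n≤o⇒m≤o N M le)) (k n (ℕ.m⊔n≤o⇒n≤o N M le))

≤ℝ-antisym : ∀ {x y} → x ≤ℝ y → y ≤ℝ x → x ≈ℝ y
≤ℝ-antisym x≤y y≤x ε 0<ε =
  let N , h = x≤y ε 0<ε
      M , k = y≤x ε 0<ε
  in N ℕ.⊔ M , λ n le → dist-< (h n (ℕ.m⊔n≤o⇒m≤o N M le)) (k n (ℕ.m⊔n≤o⇒n≤o N M le))

+ℝ-mono-≤ : ∀ {x y u v} → x ≤ℝ y → u ≤ℝ v → x +ℝ u ≤ℝ y +ℝ v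
+ℝ-mono-≤ {x} {y} {u} {v} x≤y u≤v ε 0<ε =
  let N , h = x≤y (½ ℚ.* ε) (half-pos 0<ε)
      M , k = u≤v (½ ℚ.* ε) (half-pos 0<ε)
  in N ℕ.⊔ M , λ n le → subst (seq x n ℚ.+ seq u n ℚ.<_) (eq (seq y n) (seq v n))
       (ℚ.+-mono-< (h n (ℕ.m⊔n≤o⇒m≤o N M le)) (k n (ℕ.m⊔n≤o⇒n≤o N M le)))
  where
  h = ½ ℚ.* ε
  eq : ∀ a b → a ℚ.+ h ℚ.+ (b ℚ.+ h) ≡ a ℚ.+ b ℚ.+ ε
  eq a b = trans (solve 3 (λ a b h → ((a ⊕ h) ⊕ (b ⊕ h)) ⊜ ((a ⊕ b) ⊕ (h ⊕ h))) refl a b h)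
                 (cong (a ℚ.+ b ℚ.+_) (half+half ε))
    where open ℚS

-- Past `K` both sequences stay within a quarter of `ε` of their `K`-th terms, so one rational
-- comparison at `K` decides: if `y` were ahead by `ε/2` there, `x` would remain below `y` from then
-- on, which proves `x ≤ℝ y`. Totality of the order enters through this lemma.
≰⇒≥ℝ : ∀ {x y} → ¬ (x ≤ℝ y) → y ≤ℝ x
≰⇒≥ℝ {x} {y} x≰y ε 0<ε = K , λ n K≤n →
    subst (λ e → seq y n ℚ.< seq x n ℚ.+ e) sum
      (<-+ (seq y n) (seq x K) (seq x n) (ε/2 ℚ.+ ε/4) ε/4
        (<-+ (seq y n) (seq y K) (seq x K) ε/4 ε/2 (<-dist (h′ n K (≤M K≤n) (≤M ℕ.≤-refl))) near)
        (<-dist (h K n (≤N ℕ.≤-refl) (≤N K≤n))))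
  where
  ε/2 = ½ ℚ.* ε
  ε/4 = ½ ℚ.* ε/2
  0<ε/4 = half-pos (half-pos 0<ε)
  N = proj₁ (cauchy x ε/4 0<ε/4)
  M = proj₁ (cauchy y ε/4 0<ε/4)
  h = proj₂ (cauchy x ε/4 0<ε/4)
  h′ = proj₂ (cauchy y ε/4 0<ε/4)
  K = N ℕ.⊔ M
  ≤N : ∀ {n} → K ≤ n → N ≤ n
  ≤N = ℕ.m⊔n≤o⇒m≤o N M
  ≤M : ∀ {n} → K ≤ n → M ≤ n
  ≤M = ℕ.m⊔n≤o⇒n≤o N M
  open ℚS
  sum : ε/4 ℚ.+ (ε/2 ℚ.+ ε/4) ≡ ε
  sum = trans (solve 2 (λ a b → (a ⊕ (b ⊕ a)) ⊜ (b ⊕ (a ⊕ a))) refl ε/4 ε/2)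
          (trans (cong (ε/2 ℚ.+_) (half+half ε/2)) (half+half ε))
  far : seq x K ℚ.+ ε/2 ℚ.≤ seq y K → ∀ n → K ≤ n → seq x n ℚ.< seq y n
  far le n K≤n = subst₂ ℚ._<_
    (solve 2 (λ a b → ((a ⊕ b) ⊕ (⊝ b)) ⊜ a) refl (seq x n) ε/2)
    (trans (cong (λ e → seq y n ℚ.+ e ℚ.- ε/2) (half+half ε/2))
      (solve 2 (λ a b → ((a ⊕ b) ⊕ (⊝ b)) ⊜ a) refl (seq y n) ε/2))
    (ℚ.+-monoˡ-< (ℚ.- ε/2) (subst (seq x n ℚ.+ ε/2 ℚ.<_) (ℚ.+-assoc (seq y n) ε/4 ε/4)
      (ℚ.<-trans (ℚ.+-monoˡ-< ε/2 (<-dist {seq x n} {seq x K} (h n K (≤N K≤n) (≤N ℕ.≤-refl))))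
        (subst (ℚ._< seq y n ℚ.+ ε/4 ℚ.+ ε/4)
          (solve 3 (λ a b c → ((a ⊕ b) ⊕ c) ⊜ ((a ⊕ c) ⊕ b)) refl (seq x K) ε/2 ε/4)
          (ℚ.+-monoˡ-< ε/4 (ℚ.≤-<-trans le (<-dist (h′ K n (≤M ℕ.≤-refl) (≤M K≤n)))))))))
  near : seq y K ℚ.< seq x K ℚ.+ ε/2
  near = decidable-stable (seq y K ℚ.<? seq x K ℚ.+ ε/2) λ ≮ → x≰y λ ε′ 0<ε′ → K , λ n K≤n →
           ℚ.<-trans (far (ℚ.≮⇒≥ ≮) n K≤n) (p<p+ε (seq y n) 0<ε′)

-ℝ-antimono : ∀ {x y} → x ≤ℝ y → -ℝ y ≤ℝ -ℝ x
-ℝ-antimono {x} {y} x≤y ε 0<ε = let N , h = x≤y ε 0<ε in N , λ n N≤n →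
  subst₂ ℚ._<_
    (solve 3 (λ a b c → (a ⊕ ((⊝ a) ⊕ (⊝ b))) ⊜ (⊝ b)) refl (seq x n) (seq y n) ε)
    (solve 3 (λ a b c → ((b ⊕ c) ⊕ ((⊝ a) ⊕ (⊝ b))) ⊜ ((⊝ a) ⊕ c)) refl (seq x n) (seq y n) ε)
    (ℚ.+-monoˡ-< (ℚ.- seq x n ℚ.+ ℚ.- seq y n) (h n N≤n))
  where open ℚS

fromℚ-mono : ∀ {p q} → p ℚ.≤ q → fromℚ p ≤ℝ fromℚ q
fromℚ-mono {p} {q} p≤q ε 0<ε = 0 , λ _ _ → ℚ.≤-<-trans p≤q (p<p+ε q 0<ε)

-- Testing the inequality with the gap `q - p` itself as `ε` yields `q < q`.
fromℚ-<⇒≰ : ∀ {p q} → p ℚ.< q → ¬ (fromℚ q ≤ℝ fromℚ p)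
fromℚ-<⇒≰ {p} {q} p<q h = ℚ.<-irrefl refl (subst (q ℚ.<_) (eq p q) (proj₂ (h (q ℚ.- p) 0<q-p) _ ℕ.≤-refl))
  where
  open ℚS
  eq : ∀ p q → p ℚ.+ (q ℚ.- p) ≡ q
  eq = solve 2 (λ p q → (p ⊕ (q ⊕ (⊝ p))) ⊜ q) refl
  0<q-p : 0ℚ ℚ.< q ℚ.- p
  0<q-p = subst (ℚ._< q ℚ.- p) (ℚ.+-inverseʳ p) (ℚ.+-monoˡ-< (ℚ.- p) p<q)

-- Given directly in lowest terms (the stored `0` is the denominator minus one), so that comparisons
-- reduce to those of integers.
ιℚ : ℕ → ℚ
ιℚ n = ℚ.mkℚ (ℤ.+ n) 0 (Coprime.sym (1-coprimeTo n))

ιℚ-+ : ∀ m n → ιℚ (m + n) ≡ ιℚ m ℚ.+ ιℚ n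
ιℚ-+ m n = ℚ.toℚᵘ-injective (ℚᵘ.≃-trans eq (ℚᵘ.≃-sym (ℚ.toℚᵘ-homo-+ (ιℚ m) (ιℚ n))))
  where
  eq : ℚ.toℚᵘ (ιℚ (m + n)) ℚᵘ.≃ (ℚ.toℚᵘ (ιℚ m) ℚᵘ.+ ℚ.toℚᵘ (ιℚ n))
  eq = ℚᵘ.*≡* (cong (ℤ._* ℤ.+ 1) (trans (ℤ.pos-+ m n)
         (cong₂ ℤ._+_ (sym (ℤ.*-identityʳ (ℤ.+ m))) (sym (ℤ.*-identityʳ (ℤ.+ n))))))

ιℚ-mono-≤ : ∀ {m n} → m ≤ n → ιℚ m ℚ.≤ ιℚ n
ιℚ-mono-≤ m≤n = ℚ.*≤* (ℤ.*-monoʳ-≤-nonNeg (ℤ.+ 1) (ℤ.+≤+ m≤n))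

ιℚ-mono-< : ∀ {m n} → m < n → ιℚ m ℚ.< ιℚ n
ιℚ-mono-< m<n = ℚ.*<* (ℤ.*-monoʳ-<-pos (ℤ.+ 1) (ℤ.+<+ m<n))

archimedean : ∀ p → ∃[ n ] p ℚ.≤ ιℚ n
archimedean (ℚ.mkℚ (ℤ.+ n) d _) = n , ℚ.*≤* (ℤ.*-monoˡ-≤-nonNeg (ℤ.+ n) (ℤ.+≤+ (s≤s z≤n)))
archimedean (ℚ.mkℚ (ℤ.-[1+ n ]) d _) = 0 , ℚ.*≤* ℤ.-≤+

ι : ℕ → ℝ
ι n = fromℚ (ιℚ n)

ι-mono : ∀ {m n} → m ≤ n → ι m ≤ℝ ι n
ι-mono m≤n = fromℚ-mono (ιℚ-mono-≤ m≤n)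

bound : (x : ℝ) → ∃[ N ] (x ≤ℝ ι N × -ℝ ι N ≤ℝ x)
bound x = N ,
  (λ ε 0<ε → K , λ n K≤n → ℚ.<-≤-trans (p<p+ε (seq x n) 0<ε) (ℚ.+-monoˡ-≤ ε (ℚ.≤-trans (p≤∣p∣ (seq x n)) (le n K≤n)))) ,
  (λ ε 0<ε → K , λ n K≤n → ℚ.<-≤-trans (p<p+ε _ 0<ε) (ℚ.+-monoˡ-≤ ε (ℚ.≤-trans (ℚ.neg-antimono-≤ (le n K≤n))
      (subst (ℚ.- ℚ.∣ seq x n ∣ ℚ.≤_) (RingProperties.-‿involutive ℚ.+-*-ring (seq x n))
        (ℚ.neg-antimono-≤ (subst (ℚ.- seq x n ℚ.≤_) (ℚ.∣-p∣≡∣p∣ (seq x n)) (p≤∣p∣ (ℚ.- seq x n))))))))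
  where
  b = proj₁ (bounded x)
  K = proj₁ (proj₂ (bounded x))
  N = proj₁ (archimedean b)
  le : ∀ n → K ≤ n → ℚ.∣ seq x n ∣ ℚ.≤ ιℚ N
  le n K≤n = ℚ.≤-trans (ℚ.<⇒≤ (proj₂ (proj₂ (proj₂ (bounded x))) n K≤n)) (proj₂ (archimedean b))

-- The relations on ℝ unfold to quantified statements about sequences, from which
-- unification cannot recover the numbers compared; the comparisons of weights are
-- therefore done in an abstract structure, of which ℝ is an instance.
record OrderedMonoid : Set₁ where
  infix 4 _≼_
  infixr 6 _∙_
  field
    Carrier   : Set
    _≼_       : Carrier → Carrier → Set
    _∙_       : Carrier → Carrier → Carrier
    ε         : Carrier
    ≼-refl    : ∀ {x} → x ≼ x
    ≼-trans   : ∀ {x y z} → x ≼ y → y ≼ z → x ≼ z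
    ≼-connex  : ∀ {x y} → ¬ (x ≼ y) → y ≼ x
    ∙-mono    : ∀ {x y u v} → x ≼ y → u ≼ v → x ∙ u ≼ y ∙ v
    ∙-assocˡ  : ∀ x y z → (x ∙ y) ∙ z ≼ x ∙ (y ∙ z)
    ∙-assocʳ  : ∀ x y z → x ∙ (y ∙ z) ≼ (x ∙ y) ∙ z
    ∙-comm    : ∀ x y → x ∙ y ≼ y ∙ x

≗⇒≤ℝ : ∀ {x y} → (∀ n → seq x n ≡ seq y n) → x ≤ℝ y
≗⇒≤ℝ {x} {y} h = ≈⇒≤ℝ {x} {y} (≗⇒≈ℝ {x} {y} h)

-- Opaque, because conversion checking would otherwise unfold the operations down to
-- the numerators and denominators of the rationals.
opaque

  infix 4 _⊑_
  infixr 6 _⊹_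

  _⊑_ : ℝ → ℝ → Set
  _⊑_ = _≤ℝ_

  _⊹_ : ℝ → ℝ → ℝ
  _⊹_ = _+ℝ_

  ⊑-intro : ∀ x y → x ≤ℝ y → x ⊑ y
  ⊑-intro x y h = h

  ⊑-elim : ∀ x y → x ⊑ y → x ≤ℝ y
  ⊑-elim x y h = h

  ⊹≡+ℝ : ∀ x y → x ⊹ y ≡ x +ℝ y
  ⊹≡+ℝ x y = refl

  ⊑-refl : ∀ {x} → x ⊑ x
  ⊑-refl {x} = ≤ℝ-refl {x}

  ⊑-trans : ∀ {x y z} → x ⊑ y → y ⊑ z → x ⊑ z
  ⊑-trans {x} {y} {z} = ≤ℝ-trans {x} {y} {z}

  ⊑-connex : ∀ {x y} → ¬ (x ⊑ y) → y ⊑ x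
  ⊑-connex {x} {y} = ≰⇒≥ℝ {x} {y}

  ⊹-mono : ∀ {x y u v} → x ⊑ y → u ⊑ v → x ⊹ u ⊑ y ⊹ v
  ⊹-mono {x} {y} {u} {v} = +ℝ-mono-≤ {x} {y} {u} {v}

  ⊹-assocˡ : ∀ x y z → (x ⊹ y) ⊹ z ⊑ x ⊹ (y ⊹ z)
  ⊹-assocˡ x y z = ≗⇒≤ℝ {(x +ℝ y) +ℝ z} {x +ℝ (y +ℝ z)} λ n → ℚ.+-assoc (seq x n) (seq y n) (seq z n)

  ⊹-assocʳ : ∀ x y z → x ⊹ (y ⊹ z) ⊑ (x ⊹ y) ⊹ z
  ⊹-assocʳ x y z = ≗⇒≤ℝ {x +ℝ (y +ℝ z)} {(x +ℝ y) +ℝ z} λ n → sym (ℚ.+-assoc (seq x n) (seq y n) (seq z n))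

  ⊹-comm : ∀ x y → x ⊹ y ⊑ y ⊹ x
  ⊹-comm x y = ≗⇒≤ℝ {x +ℝ y} {y +ℝ x} λ n → ℚ.+-comm (seq x n) (seq y n)

⊹-⊑-intro : ∀ x y z w → x +ℝ y ≤ℝ z +ℝ w → x ⊹ y ⊑ z ⊹ w
⊹-⊑-intro x y z w h = subst₂ _⊑_ (sym (⊹≡+ℝ x y)) (sym (⊹≡+ℝ z w)) (⊑-intro _ _ h)

ℝ-orderedMonoid : OrderedMonoid
ℝ-orderedMonoid = record
  { Carrier = ℝ
  ; _≼_ = _⊑_
  ; _∙_ = _⊹_
  ; ε = 0ℝ
  ; ≼-refl = ⊑-refl
  ; ≼-trans = ⊑-trans
  ; ≼-connex = ⊑-connex
  ; ∙-mono = ⊹-mono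
  ; ∙-assocˡ = ⊹-assocˡ
  ; ∙-assocʳ = ⊹-assocʳ
  ; ∙-comm = ⊹-comm
  }

module OrderedMonoidProperties (O : OrderedMonoid) where
  open OrderedMonoid O

  infix 4 _≃_
  _≃_ : Carrier → Carrier → Set
  x ≃ y = x ≼ y × y ≼ x

  ≃-trans : ∀ {x y z} → x ≃ y → y ≃ z → x ≃ z
  ≃-trans (p , p′) (q , q′) = ≼-trans p q , ≼-trans q′ p′

  ∙-cong : ∀ {x y u v} → x ≃ y → u ≃ v → x ∙ u ≃ y ∙ v
  ∙-cong (p , p′) (q , q′) = ∙-mono p q , ∙-mono p′ q′

  ≃-refl : ∀ {x} → x ≃ x
  ≃-refl = ≼-refl , ≼-refl

  x∙yz≼y∙xz : ∀ x y z → x ∙ (y ∙ z) ≼ y ∙ (x ∙ z)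
  x∙yz≼y∙xz x y z = ≼-trans (∙-assocʳ x y z) (≼-trans (∙-mono (∙-comm x y) ≼-refl) (∙-assocˡ y x z))

  xy∙zw≼xz∙yw : ∀ x y z w → (x ∙ y) ∙ (z ∙ w) ≼ (x ∙ z) ∙ (y ∙ w)
  xy∙zw≼xz∙yw x y z w = ≼-trans (∙-assocˡ x y (z ∙ w))
    (≼-trans (∙-mono ≼-refl (x∙yz≼y∙xz y z w)) (∙-assocʳ x z (y ∙ w)))

  module _ {X : Set} (v : X → Carrier) where

    total : List X → Carrier
    total = foldr (λ x s → v x ∙ s) ε

    total-↭ : ∀ {xs ys} → xs ↭ ys → total xs ≃ total ys
    total-↭ ↭.refl = ≃-refl
    total-↭ (prep x p) = ∙-cong ≃-refl (total-↭ p)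
    total-↭ (swap x y p) = ≃-trans (x∙yz≼y∙xz _ _ _ , x∙yz≼y∙xz _ _ _)
      (∙-cong ≃-refl (∙-cong ≃-refl (total-↭ p)))
    total-↭ (↭.trans p q) = ≃-trans (total-↭ p) (total-↭ q)

    total-mono₂ : ∀ {a b c d} xs → v a ∙ v b ≼ v c ∙ v d → total (a ∷ b ∷ xs) ≼ total (c ∷ d ∷ xs)
    total-mono₂ xs h = ≼-trans (∙-assocʳ _ _ _) (≼-trans (∙-mono h ≼-refl) (∙-assocˡ _ _ _))

  total-map : ∀ {X Y : Set} {v : Y → Carrier} {w : X → Carrier} {φ : X → Y} →
              (∀ x → v (φ x) ≃ w x) → ∀ xs → total v (map φ xs) ≃ total w xs
  total-map h []       = ≃-refl
  total-map h (x ∷ xs) = ∙-cong (h x) (total-map h xs)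

  ¬¬-max : ∀ {A : Set} (f : A → Carrier) x (xs : List A) →
           ¬ ¬ (∃[ m ] m ∈ x ∷ xs × (∀ y → y ∈ x ∷ xs → f y ≼ f m))
  ¬¬-max f x [] = return¬¬ (x , here refl , λ { y (here refl) → ≼-refl })
  ¬¬-max f x (x′ ∷ xs) = ¬¬-max f x′ xs >>=¬¬ λ { (m , m∈ , max) →
    ¬¬-excluded-middle >>=¬¬ λ where
      (yes fx≼fm) → return¬¬ (m , there m∈ , λ { y (here refl) → fx≼fm ; y (there y∈) → max y y∈ })
      (no fx⋠fm)  → return¬¬ (x , here refl , λ
        { y (here refl) → ≼-refl
        ; y (there y∈)  → ≼-trans (max y y∈) (≼-connex fx⋠fm) }) }

-- Perfect matchings as lists of edges

module _ {a} {A : Set a} where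

  ∈-↭ : ∀ {x : A} {xs} → x ∈ xs → ∃[ xs′ ] xs ↭ x ∷ xs′
  ∈-↭ {x} x∈xs with ∈.∈-∃++ x∈xs
  ... | as , bs , refl = as ++ bs , ↭.shift x as bs

  unique-↭ : ∀ {xs ys : List A} → xs ↭ ys → Unique xs → Unique ys
  unique-↭ ↭.refl u = u
  unique-↭ (prep x p) (x# ∷ u) = ↭.All-resp-↭ p x# ∷ unique-↭ p u
  unique-↭ (swap x y p) ((x≢y ∷ x#) ∷ y# ∷ u) =
    ((x≢y ∘ sym) ∷ ↭.All-resp-↭ p y#) ∷ ↭.All-resp-↭ p x# ∷ unique-↭ p u
  unique-↭ (↭.trans p q) u = unique-↭ q (unique-↭ p u)

  head∉ : ∀ {x : A} {xs} → Unique (x ∷ xs) → x ∉ xs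
  head∉ = Unique.Unique[x∷xs]⇒x∉xs

  ∉⇒All≢ : ∀ {x : A} {xs} → x ∉ xs → All (x ≢_) xs
  ∉⇒All≢ x∉ = All.tabulate λ { y∈ refl → x∉ y∈ }

  unique-same-elements : ∀ {xs ys : List A} → Unique xs → Unique ys →
    (∀ {x} → x ∈ xs → x ∈ ys) → (∀ {x} → x ∈ ys → x ∈ xs) → xs ↭ ys
  unique-same-elements {[]} {[]} _ _ _ _ = ↭-refl
  unique-same-elements {[]} {y ∷ ys} _ _ _ g = contradiction (g (here refl)) λ ()
  unique-same-elements {x ∷ xs} {ys} ux uy f g with ∈-↭ (f (here refl))
  ... | ys′ , p = ↭-trans (prep x (unique-same-elements (AllPairs.tail ux) (AllPairs.tail uy′)
      (λ z∈ → case ↭.∈-resp-↭ p (f (there z∈)) of λ { (here refl) → contradiction z∈ (head∉ ux) ; (there h) → h })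
      (λ z∈ → case g (↭.∈-resp-↭ (↭-sym p) (there z∈)) of λ { (here refl) → contradiction z∈ (head∉ uy′) ; (there h) → h })))
      (↭-sym p)
    where uy′ = unique-↭ p uy

  unique-++ˡ : ∀ (xs : List A) {ys} → Unique (xs ++ ys) → Unique xs
  unique-++ˡ [] u = []
  unique-++ˡ (x ∷ xs) (x# ∷ u) = All.++⁻ˡ xs x# ∷ unique-++ˡ xs u

  unique-++ʳ : ∀ (xs : List A) {ys} → Unique (xs ++ ys) → Unique ys
  unique-++ʳ [] u = u
  unique-++ʳ (x ∷ xs) (_ ∷ u) = unique-++ʳ xs u

  filter-split : ∀ {p} {P : Pred A p} (P? : ∀ x → Dec (P x)) xs → xs ↭ filter P? xs ++ filter (¬? ∘ P?) xs
  filter-split P? [] = ↭-refl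
  filter-split P? (x ∷ xs) with P? x
  ... | yes _ = prep x (filter-split P? xs)
  ... | no _  = ↭-trans (prep x (filter-split P? xs)) (↭-sym (↭.shift x (filter P? xs) _))

  pull : ∀ {p} {P : Pred A p} → (∀ x → Dec (P x)) → ∀ xs →
         All (¬_ ∘ P) xs ⊎ ∃₂ λ x xs′ → P x × xs ↭ x ∷ xs′
  pull P? xs with Any.any? P? xs
  ... | no ¬any = inj₁ (All.¬Any⇒All¬ xs ¬any)
  ... | yes any = let x , x∈ , px = find any ; xs′ , p = ∈-↭ x∈ in inj₂ (x , xs′ , px , p)

module _ {X : Set} (_≟_ : DecidableEquality X) where
  open DecMembership _≟_ using () renaming (_∈?_ to _∈ᴸ?_)

  sublist-↭ : ∀ xs L → Unique L → (∀ {x} → x ∈ L → x ∈ xs) → ∃[ E ] E ∈ sublists xs × E ↭ L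
  sublist-↭ [] [] u L⊆ = [] , here refl , ↭-refl
  sublist-↭ [] (x ∷ L) u L⊆ = contradiction (L⊆ (here refl)) λ ()
  sublist-↭ (x ∷ xs) L u L⊆ with x ∈ᴸ? L
  ... | yes x∈L with ∈-↭ x∈L
  ...   | L′ , p =
    let uL′ = unique-↭ p u
        E , E∈ , q = sublist-↭ xs L′ (AllPairs.tail uL′) λ z∈ →
          case L⊆ (↭.∈-resp-↭ (↭-sym p) (there z∈)) of λ { (here refl) → contradiction z∈ (head∉ uL′) ; (there h) → h }
    in x ∷ E , ∈.∈-++⁺ˡ (∈.∈-map⁺ (x ∷_) E∈) , ↭-trans (prep x q) (↭-sym p)
  sublist-↭ (x ∷ xs) L u L⊆ | no x∉L =
    let E , E∈ , q = sublist-↭ xs L u λ z∈ →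
          case L⊆ z∈ of λ { (here refl) → contradiction z∈ x∉L ; (there h) → h }
    in E , ∈.∈-++⁺ʳ (map (x ∷_) (sublists xs)) E∈ , q

sublist-⊆ : ∀ {X : Set} (xs : List X) {E} → E ∈ sublists xs → ∀ {x} → x ∈ E → x ∈ xs
sublist-⊆ [] (here refl) ()
sublist-⊆ (y ∷ xs) E∈ x∈ with ∈.∈-++⁻ (map (y ∷_) (sublists xs)) E∈
... | inj₂ E∈′ = there (sublist-⊆ xs E∈′ x∈)
... | inj₁ E∈′ with ∈.∈-map⁻ (y ∷_) E∈′ | x∈
...   | F , F∈ , refl | here refl = here refl
...   | F , F∈ , refl | there x∈F = there (sublist-⊆ xs F∈ x∈F)

-- Distinct up to reordering, not merely as lists: monomials are compared by `_↭_`, so this is what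
-- keeps the terms of a Pfaffian from merging.
sublists-distinct : ∀ {X : Set} (xs : List X) → Unique xs → AllPairs (λ E F → ¬ (E ↭ F)) (sublists xs)
sublists-distinct [] _ = [] ∷ []
sublists-distinct (x ∷ xs) u@(_ ∷ u′) = AllPairs.++⁺
  (AllPairs.map⁺ (AllPairs.map (λ ¬p p → ¬p (↭.drop-∷ p)) (sublists-distinct xs u′)))
  (sublists-distinct xs u′)
  (All.tabulate λ E∈ → All.tabulate λ F∈ p → case ∈.∈-map⁻ (x ∷_) E∈ of λ
    { (_ , _ , refl) → head∉ u (sublist-⊆ xs F∈ (↭.∈-resp-↭ p (here refl))) })

edge?-just : ∀ {n} (i j : Fin n) {e} → edge? i j ≡ just e → (i , j) ≡ (lo e , hi e)
edge?-just i j eq with i Fin.<? j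
edge?-just i j refl | yes _ = refl
edge?-just i j () | no _

edge?-< : ∀ {n} (e : Edge n) → edge? (lo e) (hi e) ≡ just e
edge?-< (edge i j i<j) with i Fin.<? j
... | yes _  = refl
... | no i≮j = ⊥-elim-irr (i≮j i<j)

∈-mapMaybe : ∀ {A B : Set} (f : A → Maybe B) {x y} xs → x ∈ xs → f x ≡ just y → y ∈ mapMaybe f xs
∈-mapMaybe f (x ∷ xs) (here refl) eq rewrite eq = here refl
∈-mapMaybe f (x ∷ xs) (there x∈) eq with f x
... | just _  = there (∈-mapMaybe f xs x∈ eq)
... | nothing = ∈-mapMaybe f xs x∈ eq

∈-mapMaybe⁻ : ∀ {A B : Set} (f : A → Maybe B) {y} xs → y ∈ mapMaybe f xs → ∃[ x ] x ∈ xs × f x ≡ just y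
∈-mapMaybe⁻ f (x ∷ xs) y∈ with f x in eq
∈-mapMaybe⁻ f (x ∷ xs) (here refl) | just _ = x , here refl , eq
∈-mapMaybe⁻ f (x ∷ xs) (there y∈) | just _ = let z , z∈ , e = ∈-mapMaybe⁻ f xs y∈ in z , there z∈ , e
∈-mapMaybe⁻ f (x ∷ xs) y∈ | nothing = let z , z∈ , e = ∈-mapMaybe⁻ f xs y∈ in z , there z∈ , e

mapMaybe-unique : ∀ {A B : Set} (f : A → Maybe B) → (∀ {x y z} → f x ≡ just z → f y ≡ just z → x ≡ y) →
                  ∀ {xs} → Unique xs → Unique (mapMaybe f xs)
mapMaybe-unique f inj [] = []
mapMaybe-unique f inj {x ∷ xs} (x# ∷ u) with f x in eq
... | nothing = mapMaybe-unique f inj u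
... | just y  = All.tabulate (λ { z∈ refl → let w , w∈ , e = ∈-mapMaybe⁻ f xs z∈ in
                  All.lookup x# w∈ (inj eq e) }) ∷ mapMaybe-unique f inj u

∈-allEdges : ∀ {n} (e : Edge n) → e ∈ allEdges n
∈-allEdges {n} e = ∈-mapMaybe (uncurry edge?) _
  (∈.∈-cartesianProduct⁺ (∈.∈-allFin (lo e)) (∈.∈-allFin (hi e))) (edge?-< e)

allEdges-unique : ∀ n → Unique (allEdges n)
allEdges-unique n = mapMaybe-unique (uncurry edge?)
  (λ {(i , j)} {(i′ , j′)} p q → trans (edge?-just i j p) (sym (edge?-just i′ j′ q)))
  (Unique.cartesianProduct⁺ (Unique.allFin⁺ n) (Unique.allFin⁺ n))

lo≢hi : ∀ {n} (e : Edge n) → lo e ≢ hi e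
lo≢hi (edge i j i<j) refl = ⊥-elim-irr (Fin.<-irrefl {x = i} refl i<j)

ends : ∀ {n} → List (Edge n) → List (Fin n)
ends []      = []
ends (e ∷ E) = lo e ∷ hi e ∷ ends E

ends-↭ : ∀ {n} {E F : List (Edge n)} → E ↭ F → ends E ↭ ends F
ends-↭ ↭.refl = ↭-refl
ends-↭ (prep e p) = prep _ (prep _ (ends-↭ p))
ends-↭ (swap {E} {F} e f p) = ↭-trans (↭.shifts (lo e ∷ hi e ∷ []) (lo f ∷ hi f ∷ []))
  (prep _ (prep _ (prep _ (prep _ (ends-↭ p)))))
ends-↭ (↭.trans p q) = ↭-trans (ends-↭ p) (ends-↭ q)

∈-endsˡ : ∀ {n} {e : Edge n} {E} → e ∈ E → lo e ∈ ends E
∈-endsˡ (here refl) = here refl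
∈-endsˡ (there p) = there (there (∈-endsˡ p))

∈-endsʳ : ∀ {n} {e : Edge n} {E} → e ∈ E → hi e ∈ ends E
∈-endsʳ (here refl) = there (here refl)
∈-endsʳ (there p) = there (there (∈-endsʳ p))

ends-unique : ∀ {n} {E : List (Edge n)} → Unique (ends E) → Unique E
ends-unique {E = []} _ = []
ends-unique {E = e ∷ E} u@(_ ∷ _ ∷ u′) =
  ∉⇒All≢ (λ e∈ → head∉ u (there (∈-endsˡ e∈))) ∷ ends-unique u′

length-ends : ∀ {n} (E : List (Edge n)) → length (ends E) ≡ 2 * length E
length-ends [] = refl
length-ends (e ∷ E) rewrite length-ends E = cong suc (sym (ℕ.+-suc (length E) (length E + 0)))

count : ∀ {n} → Fin n → List (Fin n) → ℕ
count i xs = length (filter (i Fin.≟_) xs)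

-- `degree` counts an edge once where `count` would count a loop twice; they agree because the ends
-- of an edge differ.
degree-count : ∀ {n} (i : Fin n) E → degree i E ≡ count i (ends E)
degree-count i [] = refl
degree-count i (e ∷ E) with i Fin.≟ lo e
... | no _ with i Fin.≟ hi e
...   | yes _ = cong suc (degree-count i E)
...   | no _  = degree-count i E
degree-count i (e ∷ E) | yes refl with i Fin.≟ hi e
...   | yes eq = contradiction eq (lo≢hi e)
...   | no _   = cong suc (degree-count i E)

count-∉ : ∀ {n} {i : Fin n} {xs} → i ∉ xs → count i xs ≡ 0
count-∉ {i = i} {[]} _ = refl
count-∉ {i = i} {x ∷ xs} i∉ with i Fin.≟ x
... | yes refl = contradiction (here refl) i∉
... | no _ = count-∉ (i∉ ∘ there)

count-∈ : ∀ {n} {i : Fin n} {xs} → i ∈ xs → count i xs ≢ 0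
count-∈ {i = i} {x ∷ xs} i∈ eq with i Fin.≟ x
count-∈ {i = i} {x ∷ xs} i∈ () | yes _
count-∈ {i = i} {x ∷ xs} (here refl) eq | no i≢ = i≢ refl
count-∈ {i = i} {x ∷ xs} (there i∈) eq | no _ = count-∈ i∈ eq

count-unique : ∀ {n} {i : Fin n} {xs} → Unique xs → i ∈ xs → count i xs ≡ 1
count-unique {i = i} {x ∷ xs} u i∈ with i Fin.≟ x
... | yes refl = cong suc (count-∉ (head∉ u))
count-unique {i = i} {x ∷ xs} u (here refl) | no i≢ = contradiction refl i≢
count-unique {i = i} {x ∷ xs} (_ ∷ u) (there i∈) | no _ = count-unique u i∈

unique-count : ∀ {n} {xs : List (Fin n)} → (∀ i → i ∈ xs → count i xs ≡ 1) → Unique xs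
unique-count {xs = []} h = []
unique-count {xs = x ∷ xs} h = ∉⇒All≢ x∉ ∷ unique-count tail
  where
  x∉ : x ∉ xs
  x∉ x∈ with x Fin.≟ x | h x (here refl)
  ... | yes _ | eq = count-∈ x∈ (ℕ.suc-injective eq)
  ... | no x≢ | _ = x≢ refl
  tail : ∀ i → i ∈ xs → count i xs ≡ 1
  tail i i∈ with i Fin.≟ x | h i (there i∈)
  ... | yes refl | _ = contradiction i∈ x∉
  ... | no _ | eq = eq

-- The degree condition of a perfect matching is traded for `Enumerates U (ends E)`, which is
-- invariant under `_↭_`: any operation on edges that permutes the list of ends preserves perfect
-- matchings.
record Enumerates {n} (U : Subset n) (xs : List (Fin n)) : Set where
  constructor enumerates
  field
    unique   : Unique xs
    sound    : ∀ {i} → i ∈ xs → i ∈ˢ U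
    complete : ∀ {i} → i ∈ˢ U → i ∈ xs

open Enumerates public

enumerates-↭ : ∀ {n} {U : Subset n} {xs ys} → xs ↭ ys → Enumerates U xs → Enumerates U ys
enumerates-↭ p (enumerates u s c) =
  enumerates (unique-↭ p u) (s ∘ ↭.∈-resp-↭ (↭-sym p)) (↭.∈-resp-↭ p ∘ c)

enumerations-↭ : ∀ {n} {U : Subset n} {xs ys} → Enumerates U xs → Enumerates U ys → xs ↭ ys
enumerations-↭ p q = unique-same-elements (unique p) (unique q) (complete q ∘ sound p) (complete p ∘ sound q)

elements : ∀ {n} → Subset n → List (Fin n)
elements []          = []
elements (true ∷ U)  = zero ∷ map suc (elements U)
elements (false ∷ U) = map suc (elements U)

elements-enumerates : ∀ {n} (U : Subset n) → Enumerates U (elements U)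
elements-enumerates [] = enumerates [] (λ ()) (λ {i} → case i of λ ())
elements-enumerates (b ∷ U) with elements-enumerates U
elements-enumerates (true ∷ U) | enumerates u s c = enumerates
  (∉⇒All≢ (λ z∈ → case ∈.∈-map⁻ suc z∈ of λ ()) ∷ Unique.map⁺ Fin.suc-injective u)
  (λ { (here refl) → Vec.here ; (there i∈) → case ∈.∈-map⁻ suc i∈ of λ { (_ , j∈ , refl) → Vec.there (s j∈) } })
  (λ { Vec.here → here refl ; (Vec.there i∈) → there (∈.∈-map⁺ suc (c i∈)) })
elements-enumerates (false ∷ U) | enumerates u s c = enumerates
  (Unique.map⁺ Fin.suc-injective u)
  (λ i∈ → case ∈.∈-map⁻ suc i∈ of λ { (_ , j∈ , refl) → Vec.there (s j∈) })
  (λ { (Vec.there i∈) → ∈.∈-map⁺ suc (c i∈) })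

elements-length : ∀ {n} (U : Subset n) → length (elements U) ≡ ∣ U ∣
elements-length [] = refl
elements-length (true ∷ U) = cong suc (trans (List.length-map suc (elements U)) (elements-length U))
elements-length (false ∷ U) = trans (List.length-map suc (elements U)) (elements-length U)

elements-increasing : ∀ {n} (U : Subset n) → AllPairs Fin._<_ (elements U)
elements-increasing [] = []
elements-increasing (true ∷ U) =
  All.map⁺ (All.tabulate λ _ → s≤s z≤n) ∷ AllPairs.map⁺ (AllPairs.map s≤s (elements-increasing U))
elements-increasing (false ∷ U) = AllPairs.map⁺ (AllPairs.map s≤s (elements-increasing U))

enumeration-length : ∀ {n} {U : Subset n} {xs} → Enumerates U xs → length xs ≡ ∣ U ∣
enumeration-length {U = U} h =
  trans (↭.↭-length (enumerations-↭ h (elements-enumerates U))) (elements-length U)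

perfectMatching⇒enumerates : ∀ {n} {U : Subset n} {E} → IsPerfectMatching U E → Enumerates U (ends E)
perfectMatching⇒enumerates {U = U} {E} (in-U , deg) = enumerates
  (unique-count λ i i∈ → trans (sym (degree-count i E)) (deg i (snd E in-U i∈)))
  (snd E in-U)
  (λ {i} i∈ → decidable-stable (i ∈ᴸ? ends E) λ i∉ →
     contradiction (trans (sym (deg i i∈)) (trans (degree-count i E) (count-∉ i∉))) λ ())
  where
  open DecMembership Fin._≟_ using () renaming (_∈?_ to _∈ᴸ?_)
  snd : ∀ E → All (λ e → lo e ∈ˢ U × hi e ∈ˢ U) E → ∀ {i} → i ∈ ends E → i ∈ˢ U
  snd (e ∷ E) (p ∷ ps) (here refl) = proj₁ p
  snd (e ∷ E) (p ∷ ps) (there (here refl)) = proj₂ p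
  snd (e ∷ E) (p ∷ ps) (there (there i∈)) = snd E ps i∈

enumerates⇒perfectMatching : ∀ {n} {U : Subset n} {E} → Enumerates U (ends E) → IsPerfectMatching U E
enumerates⇒perfectMatching {E = E} h =
  All.tabulate (λ e∈ → sound h (∈-endsˡ e∈) , sound h (∈-endsʳ e∈)) ,
  λ i i∈ → trans (degree-count i E) (count-unique (unique h) (complete h i∈))

∈-perfectMatchings⁻ : ∀ {n} {U : Subset n} {E} → E ∈ perfectMatchings U → Enumerates U (ends E)
∈-perfectMatchings⁻ {n} {U} E∈ =
  perfectMatching⇒enumerates (proj₂ (∈.∈-filter⁻ (isPerfectMatching? U) {xs = sublists (allEdges n)} E∈))

-- `L` may list its edges in any order, whereas `perfectMatchings` lists them in the order of
-- `allEdges`; hence a result up to `_↭_`.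
∈-perfectMatchings⁺ : ∀ {n} {U : Subset n} L → Enumerates U (ends L) → ∃[ E ] E ∈ perfectMatchings U × E ↭ L
∈-perfectMatchings⁺ {n} {U} L h =
  let E , E∈ , p = sublist-↭ _≟ᴱ_ (allEdges n) L (ends-unique (unique h)) (λ {e} _ → ∈-allEdges e)
  in E , ∈.∈-filter⁺ (isPerfectMatching? U) E∈
           (enumerates⇒perfectMatching (enumerates-↭ (ends-↭ (↭-sym p)) h)) , p

perfectMatchings-distinct : ∀ {n} (U : Subset n) → AllPairs (λ E F → ¬ (E ↭ F)) (perfectMatchings U)
perfectMatchings-distinct {n} U =
  AllPairs.filter⁺ (isPerfectMatching? U) (sublists-distinct (allEdges n) (allEdges-unique n))

-- Consecutive elements of `U` are paired. This provides the candidate without which a maximum over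
-- the matchings could not be taken.
perfectMatchings-nonempty : ∀ {n} (U : Subset n) k → ∣ U ∣ ≡ 2 * k → ∃[ E ] E ∈ perfectMatchings U
perfectMatchings-nonempty U k |U| =
  let L , eq = pairUp k (elements U) (trans (elements-length U) |U|) (elements-increasing U)
      E , E∈ , _ = ∈-perfectMatchings⁺ L (subst (Enumerates U) (sym eq) (elements-enumerates U))
  in E , E∈
  where
  pairUp : ∀ {n} k (xs : List (Fin n)) → length xs ≡ 2 * k → AllPairs Fin._<_ xs → ∃[ L ] ends L ≡ xs
  pairUp zero [] _ _ = [] , refl
  pairUp (suc k) (x ∷ []) eq _ =
    contradiction (trans (ℕ.suc-injective eq) (ℕ.+-suc k (k + 0))) λ ()
  pairUp (suc k) (x ∷ y ∷ xs) eq ((x<y ∷ _) ∷ _ ∷ inc) =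
    let L , eq′ = pairUp k xs (ℕ.suc-injective (trans (ℕ.suc-injective eq) (ℕ.+-suc k (k + 0)))) inc
    in edge x y x<y ∷ L , cong (λ l → x ∷ y ∷ l) eq′

-- Improving a matching by exchanging edges

module _ {n : ℕ} where

  -- The edge on an unordered pair: exchanges can be stated without distinguishing which of the new
  -- ends is the smaller.
  join : (i j : Fin n) → i ≢ j → Edge n
  join i j i≢j with Fin.<-cmp i j
  ... | tri< i<j _ _ = edge i j i<j
  ... | tri≈ _ i≡j _ = contradiction i≡j i≢j
  ... | tri> _ _ j<i = edge j i j<i

  join-< : ∀ {i j} i≢j .(i<j : i Fin.< j) → join i j i≢j ≡ edge i j i<j
  join-< {i} {j} i≢j i<j with Fin.<-cmp i j
  ... | tri< _ _ _   = refl
  ... | tri≈ _ i≡j _ = contradiction i≡j i≢j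
  ... | tri> i≮j _ _ = ⊥-elim-irr (i≮j i<j)

  join-> : ∀ {i j} i≢j .(j<i : j Fin.< i) → join i j i≢j ≡ edge j i j<i
  join-> {i} {j} i≢j j<i with Fin.<-cmp i j
  ... | tri< _ _ j≮i = ⊥-elim-irr (j≮i j<i)
  ... | tri≈ _ i≡j _ = contradiction i≡j i≢j
  ... | tri> _ _ _   = refl

  join-comm : ∀ {i j} (p : i ≢ j) (q : j ≢ i) → join i j p ≡ join j i q
  join-comm {i} {j} p q = by (Fin.<-cmp i j)
    where
    by : _ → join i j p ≡ join j i q
    by (tri< i<j _ _) = trans (join-< p i<j) (sym (join-> q i<j))
    by (tri≈ _ i≡j _) = contradiction i≡j p
    by (tri> _ _ j<i) = trans (join-> p j<i) (sym (join-< q j<i))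

  join-cong : ∀ {i j i′ j′} (p : i ≢ j) (q : i′ ≢ j′) → i ≡ i′ → j ≡ j′ → join i j p ≡ join i′ j′ q
  join-cong p q refl refl = trans (join-comm p (p ∘ sym)) (join-comm (p ∘ sym) q)

  edge-join : ∀ (e : Edge n) → e ≡ join (lo e) (hi e) (lo≢hi e)
  edge-join e@(edge i j i<j) = sym (join-< (lo≢hi e) i<j)

  lo<hi′ : ∀ (e : Edge n) → lo e Fin.< hi e
  lo<hi′ (edge i j i<j) = recompute (i Fin.<? j) i<j

  ends-join : ∀ {i j} (p : i ≢ j) E → ends (join i j p ∷ E) ↭ i ∷ j ∷ ends E
  ends-join {i} {j} p E with Fin.<-cmp i j
  ... | tri< _ _ _   = ↭-refl
  ... | tri≈ _ i≡j _ = contradiction i≡j p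
  ... | tri> _ _ _   = swap _ _ ↭-refl

  ends-map : ∀ {A : Set} (f g : A → Fin n) (h : ∀ x → f x ≢ g x) xs →
             ends (map (λ x → join (f x) (g x) (h x)) xs) ↭ map f xs ++ map g xs
  ends-map f g h [] = ↭-refl
  ends-map f g h (x ∷ xs) = ↭-trans (ends-join (h x) _)
    (prep _ (↭-trans (prep _ (ends-map f g h xs)) (↭-sym (↭.shift (g x) (map f xs) (map g xs)))))

module Exchange (O : OrderedMonoid) {n : ℕ} (v : Edge n → OrderedMonoid.Carrier O) where
  open OrderedMonoid O
  open OrderedMonoidProperties O

  -- One inequality between the two totals suffices, the other being an instance of maximality.
  MaximumTwice : Subset n → Set
  MaximumTwice U = ∃₂ λ E E′ → E ∈ perfectMatchings U × E′ ∈ perfectMatchings U × E ≢ E′ ×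
    total v E ≼ total v E′ × (∀ F → F ∈ perfectMatchings U → total v F ≼ total v E)

  -- When `E` is optimal, such an `L` is a second optimal matching of the same vertices.
  Improved : List (Edge n) → Set
  Improved E = ∃[ L ] ends L ↭ ends E × ¬ (L ↭ E) × total v E ≼ total v L

  improved-↭ : ∀ {E F} → E ↭ F → Improved F → Improved E
  improved-↭ p (L , q , ¬r , le) =
    L , ↭-trans q (ends-↭ (↭-sym p)) , (λ r → ¬r (↭-trans r p)) , ≼-trans (proj₁ (total-↭ v p)) le

  -- The result is not a reordering of the original, since `a` and `d` are ends of two different
  -- edges there, so `join a d ad` cannot have been one of its edges.
  exchange : ∀ {a b c d} R (ab : a ≢ b) (cd : c ≢ d) (ad : a ≢ d) (cb : c ≢ b) →
    Unique (ends (join a b ab ∷ join c d cd ∷ R)) →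
    v (join a b ab) ∙ v (join c d cd) ≼ v (join a d ad) ∙ v (join c b cb) →
    Improved (join a b ab ∷ join c d cd ∷ R)
  exchange {a} {b} {c} {d} R ab cd ad cb u le =
    join a d ad ∷ join c b cb ∷ R
    , ↭-trans (ends-join ad (join c b cb ∷ R)) (↭-trans (prep a (prep d (ends-join cb R)))
        (↭-trans (prep a (↭-trans (swap d c ↭-refl) (↭-trans (prep c (swap d b ↭-refl)) (swap c b ↭-refl))))
          (↭-sym endsE)))
    , (λ p → not-in (↭.∈-resp-↭ p (here refl)))
    , total-mono₂ v R le
    where
    endsE : ends (join a b ab ∷ join c d cd ∷ R) ↭ a ∷ b ∷ c ∷ d ∷ ends R
    endsE = ↭-trans (ends-join ab (join c d cd ∷ R)) (prep a (prep b (ends-join cd R)))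
    u′ : Unique (a ∷ b ∷ c ∷ d ∷ ends R)
    u′ = unique-↭ endsE u
    in-join : ∀ {x y z} (p : x ≢ y) → z ∈ ends (join x y p ∷ []) → z ≡ x ⊎ z ≡ y
    in-join p z∈ with ↭.∈-resp-↭ (ends-join p []) z∈
    ... | here refl = inj₁ refl
    ... | there (here refl) = inj₂ refl
    d∈ad : d ∈ ends (join a d ad ∷ [])
    d∈ad = ↭.∈-resp-↭ (↭-sym (ends-join ad [])) (there (here refl))
    a∈ad : a ∈ ends (join a d ad ∷ [])
    a∈ad = ↭.∈-resp-↭ (↭-sym (ends-join ad [])) (here refl)
    not-in : join a d ad ∉ join a b ab ∷ join c d cd ∷ R
    not-in (here eq) with in-join ab (subst (λ e → d ∈ ends (e ∷ [])) eq d∈ad)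
    ... | inj₁ refl = ad refl
    ... | inj₂ refl = head∉ (AllPairs.tail u′) (there (here refl))
    not-in (there (here eq)) with in-join cd (subst (λ e → a ∈ ends (e ∷ [])) eq a∈ad)
    ... | inj₁ refl = head∉ u′ (there (here refl))
    ... | inj₂ refl = ad refl
    not-in (there (there e∈)) = head∉ u′ (there (there (there (∈-ends-⊆ e∈ a∈ad))))
      where
      ∈-ends-⊆ : ∀ {e E i} → e ∈ E → i ∈ ends (e ∷ []) → i ∈ ends E
      ∈-ends-⊆ e∈ (here refl) = ∈-endsˡ e∈
      ∈-ends-⊆ e∈ (there (here refl)) = ∈-endsʳ e∈

  private
    move : ∀ {a x a′ y} b → a ∙ x ≼ a′ ∙ y → (a ∙ b) ∙ x ≼ y ∙ (a′ ∙ b)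
    move b le = ≼-trans (∙-mono (∙-comm _ _) ≼-refl) (≼-trans (∙-assocˡ _ _ _)
      (≼-trans (∙-mono ≼-refl le) (≼-trans (∙-comm _ _)
      (≼-trans (∙-mono (∙-comm _ _) ≼-refl) (∙-assocˡ _ _ _)))))

    pass : ∀ a b x → (a ∙ b) ∙ x ≼ b ∙ (a ∙ x)
    pass a b x = ≼-trans (∙-mono (∙-comm _ _) ≼-refl) (∙-assocˡ _ _ _)

    cross-over : ∀ a b a′ b′ → (a ∙ b) ∙ (a′ ∙ b′) ≼ (a ∙ b′) ∙ (a′ ∙ b)
    cross-over a b a′ b′ = ≼-trans (∙-mono ≼-refl (∙-comm _ _))
      (≼-trans (xy∙zw≼xz∙yw a b b′ a′) (∙-mono ≼-refl (∙-comm _ _)))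

    lift : ∀ {a b a′ a″ y} b′ → a′ ∙ b ≼ a″ ∙ y → (a ∙ b) ∙ (a′ ∙ b′) ≼ (a ∙ y) ∙ (a″ ∙ b′)
    lift b′ le = ≼-trans (∙-assocˡ _ _ _) (≼-trans (∙-mono ≼-refl
      (≼-trans (∙-assocʳ _ _ _) (≼-trans (∙-mono (≼-trans (∙-comm _ _) (≼-trans le (∙-comm _ _))) ≼-refl)
        (∙-assocˡ _ _ _)))) (∙-assocʳ _ _ _))

  -- What the exchange argument needs to know about one side `s`, so that it is carried out once and
  -- serves for rows (`byRows`) and, with `M` transposed, for columns (`byColumns`). Here `c` is the
  -- line of the other side that lower ends imitate, and `off-≼` says that from `i` to a larger `j`
  -- the offset falls by at least the spread of the entries.
  record Bipartite (s : Bool) (side : Fin n → Bool) (p q : ℕ) : Set where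
    field
      M       : Fin p × Fin q → Carrier
      off     : Fin n → Carrier
      row     : Fin n → Fin p
      col     : Fin n → Fin q
      ρ       : Fin p → Fin n
      κ       : Fin q → Fin n
      c       : Fin q
      side-ρ  : ∀ r → side (ρ r) ≡ s
      side-κ  : ∀ r → side (κ r) ≢ s
      row-ρ   : ∀ r → row (ρ r) ≡ r
      col-κ   : ∀ r → col (κ r) ≡ r
      ρ-row   : ∀ i → side i ≡ s → ρ (row i) ≡ i
      κ-col   : ∀ i → side i ≢ s → κ (col i) ≡ i
      col-c   : ∀ i → side i ≡ s → col i ≡ c
      v-cross : ∀ r c ne → v (join (ρ r) (κ c) ne) ≃ M (r , c)
      v-same  : ∀ i j ne → side i ≡ s → side j ≡ s → i Fin.< j → v (join i j ne) ≃ off i ∙ M (row j , c)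
      off-≼   : ∀ {i j} x y → side i ≡ s → i Fin.< j → off j ∙ M x ≼ off i ∙ M y

  -- Tropical singularity of the minors of size `k`, expressed by lists of entries so that neither
  -- an order of the rows nor a permutation has to be named. It is doubly negated because the rank
  -- hypothesis only excludes regular minors.
  Rearrangeable : ∀ {p q} → (Fin p × Fin q → Carrier) → ℕ → Set
  Rearrangeable M k = ∀ P → length P ≡ k → Unique (map proj₁ P) → Unique (map proj₂ P) →
    ¬ ¬ (∃[ P′ ] map proj₁ P′ ↭ map proj₁ P × map proj₂ P′ ↭ map proj₂ P × ¬ (P′ ↭ P) × total M P ≼ total M P′)

  module _ {s side p q} (B : Bipartite s side p q) where
    open Bipartite B

    Same Cross′ : Edge n → Set
    Same e = side (lo e) ≡ s × side (hi e) ≡ s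
    Cross′ e = (side (lo e) ≡ s × side (hi e) ≢ s) ⊎ (side (lo e) ≢ s × side (hi e) ≡ s)

    same? : ∀ e → Dec (Same e)
    same? e = side (lo e) Bool.≟ s ×-dec side (hi e) Bool.≟ s

    ρ≢κ : ∀ x → ρ (proj₁ x) ≢ κ (proj₂ x)
    ρ≢κ (r , c) eq = side-κ c (trans (cong side (sym eq)) (side-ρ r))

    toEdge : Fin p × Fin q → Edge n
    toEdge x = join (ρ (proj₁ x)) (κ (proj₂ x)) (ρ≢κ x)

    -- An edge inside the side s is charged to the row of its upper end, in column c.
    pos : Edge n → Fin p × Fin q
    pos e with side (hi e) Bool.≟ s
    ... | yes _ = row (hi e) , col (lo e)
    ... | no _  = row (lo e) , col (hi e)

    pos-cross : ∀ i j ne → side i ≡ s → side j ≢ s → pos (join i j ne) ≡ (row i , col j)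
    pos-cross i j ne i∈ j∉ with Fin.<-cmp i j
    ... | tri≈ _ i≡j _ = contradiction i≡j ne
    ... | tri< _ _ _ with side j Bool.≟ s
    ...   | yes j∈ = contradiction j∈ j∉
    ...   | no _   = refl
    pos-cross i j ne i∈ j∉ | tri> _ _ _ with side i Bool.≟ s
    ...   | yes _  = refl
    ...   | no i∉  = contradiction i∈ i∉

    pos-same : ∀ i j ne → side i ≡ s → side j ≡ s → i Fin.< j → pos (join i j ne) ≡ (row j , c)
    pos-same i j ne i∈ j∈ i<j rewrite join-< ne i<j with side j Bool.≟ s
    ... | yes _ = cong (row j ,_) (col-c i i∈)
    ... | no j∉ = contradiction j∈ j∉

    pos-toEdge : ∀ x → pos (toEdge x) ≡ x
    pos-toEdge (r , c) = trans (pos-cross (ρ r) (κ c) _ (side-ρ r) (side-κ c)) (cong₂ _,_ (row-ρ r) (col-κ c))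

    orient : ∀ e → Cross′ e → ∃₂ λ i j → side i ≡ s × side j ≢ s × Σ (i ≢ j) λ ne → e ≡ join i j ne
    orient e (inj₁ (i∈ , j∉)) = lo e , hi e , i∈ , j∉ , lo≢hi e , edge-join e
    orient e (inj₂ (i∉ , j∈)) = hi e , lo e , j∈ , i∉ , lo≢hi e ∘ sym , trans (edge-join e) (join-comm (lo≢hi e) _)

    toEdge-pos : ∀ e → Cross′ e → toEdge (pos e) ≡ e
    toEdge-pos e cr with orient e cr
    ... | i , j , i∈ , j∉ , ne , refl =
      trans (cong toEdge (pos-cross i j ne i∈ j∉)) (join-cong _ ne (ρ-row i i∈) (κ-col j j∉))

    cross⇒toEdge : ∀ {E} → All Cross′ E → E ≡ map toEdge (map pos E)
    cross⇒toEdge [] = refl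
    cross⇒toEdge (cr ∷ crs) = cong₂ _∷_ (sym (toEdge-pos _ cr)) (cross⇒toEdge crs)

    map-pos-toEdge : ∀ P → map pos (map toEdge P) ≡ P
    map-pos-toEdge [] = refl
    map-pos-toEdge (x ∷ P) = cong₂ _∷_ (pos-toEdge x) (map-pos-toEdge P)

    ends-toEdge : ∀ P → ends (map toEdge P) ↭ map ρ (map proj₁ P) ++ map κ (map proj₂ P)
    ends-toEdge P = ↭-trans (ends-map (ρ ∘ proj₁) (κ ∘ proj₂) ρ≢κ P)
      (↭-reflexive (cong₂ _++_ (List.map-∘ P) (List.map-∘ P)))

    total-toEdge : ∀ P → total v (map toEdge P) ≃ total M P
    total-toEdge = total-map λ (r , c) → v-cross r c _

    v-crossing : ∀ {i j} ne → side i ≡ s → side j ≢ s → v (join i j ne) ≃ M (row i , col j)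
    v-crossing {i} {j} ne i∈ j∉ =
      subst (λ e → v e ≃ M (row i , col j)) (join-cong _ ne (ρ-row i i∈) (κ-col j j∉))
        (v-cross (row i) (col j) (ρ≢κ _))

    ≢-sides : ∀ {i j} → side i ≡ s → side j ≢ s → i ≢ j
    ≢-sides i∈ j∉ refl = j∉ i∈

    module _ {k} (rearrange : Rearrangeable M k) where

      improve-crossing : ∀ P → length P ≡ k → Unique (ends (map toEdge P)) → ¬ ¬ Improved (map toEdge P)
      improve-crossing P len u =
        rearrange P len (Unique.map⁻ (unique-++ˡ _ u′)) (Unique.map⁻ (unique-++ʳ (map ρ (map proj₁ P)) u′))
        >>=¬¬ λ { (P′ , rows , cols , ¬p , le) → return¬¬
          ( map toEdge P′
          , ↭-trans (ends-toEdge P′) (↭-trans (↭.++⁺ (↭.map⁺ ρ rows) (↭.map⁺ κ cols)) (↭-sym (ends-toEdge P)))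
          , (λ p → ¬p (subst₂ _↭_ (map-pos-toEdge P′) (map-pos-toEdge P) (↭.map⁺ pos p)))
          , ≼-trans (proj₁ (total-toEdge P)) (≼-trans le (proj₂ (total-toEdge P′)))) }
        where u′ = unique-↭ (ends-toEdge P) u

      module _ {i j} (ne : i ≢ j) (i∈ : side i ≡ s) (j∈ : side j ≡ s) (i<j : i Fin.< j) where

        private e₀ = join i j ne

        -- Passing the role of lower end from `i` down to `i′` raises the offset by at least the
        -- spread of the entries, which pays for moving `b` from `i′` to `i`.
        overtaken : ∀ {i′ b} ne′ R → side i′ ≡ s → side b ≢ s → i′ Fin.< i →
                    Unique (ends (e₀ ∷ join i′ b ne′ ∷ R)) → Improved (e₀ ∷ join i′ b ne′ ∷ R)
        overtaken {i′} {b} ne′ R i′∈ b∉ i′<i u =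
          exchange R ne ne′ (≢-sides i∈ b∉) i′≢j u
            (≼-trans (∙-mono (proj₁ (v-same i j ne i∈ j∈ i<j)) (proj₁ (v-crossing ne′ i′∈ b∉)))
              (≼-trans (move _ (off-≼ (row i′ , col b) (row i , col b) i′∈ i′<i))
                (∙-mono (proj₂ (v-crossing (≢-sides i∈ b∉) i∈ b∉)) (proj₂ (v-same i′ j i′≢j i′∈ j∈ i′<j)))))
          where
          i′<j = Fin.<-trans i′<i i<j
          i′≢j = Fin.<⇒≢ i′<j

        -- Both `i`, as a lower end, and `b` offer the entry in column `c`, so `j` and `j′` can
        -- trade partners without changing the weight.
        rematched : ∀ {j′ b} ne′ R → side j′ ≡ s → side b ≢ s → col b ≡ c → i Fin.< j′ →
                    Unique (ends (e₀ ∷ join j′ b ne′ ∷ R)) → Improved (e₀ ∷ join j′ b ne′ ∷ R)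
        rematched {j′} {b} ne′ R j′∈ b∉ refl i<j′ u =
          subst (λ e → Improved (e ∷ join j′ b ne′ ∷ R)) (join-comm (ne ∘ sym) ne)
            (exchange R (ne ∘ sym) ne′ (≢-sides j∈ b∉) (Fin.<⇒≢ i<j′ ∘ sym)
              (subst (λ e → Unique (ends (e ∷ join j′ b ne′ ∷ R))) (join-comm ne (ne ∘ sym)) u)
              (subst₂ (λ e f → v e ∙ v (join j′ b ne′) ≼ v (join j b (≢-sides j∈ b∉)) ∙ v f)
                (join-comm ne (ne ∘ sym)) (join-comm (Fin.<⇒≢ i<j′) _)
                (≼-trans (∙-mono (proj₁ (v-same i j ne i∈ j∈ i<j)) (proj₁ (v-crossing ne′ j′∈ b∉)))
                  (≼-trans (pass _ _ _)
                    (∙-mono (proj₂ (v-crossing (≢-sides j∈ b∉) j∈ b∉)) (proj₂ (v-same i j′ _ i∈ j′∈ i<j′)))))))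

        -- Charging join i j to the entry (row j , c) turns the matching into a set of
        -- entries of M, to which the rearrangement applies.
        improve-charged : ∀ P → suc (length P) ≡ k → c ∉ map proj₂ P →
          (∀ {r} → r ∈ map proj₁ P → i Fin.< ρ r) →
          Unique (ends (e₀ ∷ map toEdge P)) → ¬ ¬ Improved (e₀ ∷ map toEdge P)
        improve-charged P len c∉ top u =
          rearrange ((row j , c) ∷ P) len
            (∉⇒All≢ (λ rj∈ → head∉ (AllPairs.tail u′) (∈.∈-++⁺ˡ (subst (_∈ map ρ (map proj₁ P)) (ρ-row j j∈) (∈.∈-map⁺ ρ rj∈))))
              ∷ Unique.map⁻ (unique-++ˡ _ u″))
            (∉⇒All≢ c∉ ∷ Unique.map⁻ (unique-++ʳ (map ρ (map proj₁ P)) u″))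
          >>=¬¬ λ { (P′ , rows , cols , ¬p , le) → return¬¬ (result P′ rows cols ¬p le) }
          where
          u′ : Unique (i ∷ j ∷ map ρ (map proj₁ P) ++ map κ (map proj₂ P))
          u′ = unique-↭ (↭-trans (ends-join ne _) (prep i (prep j (ends-toEdge P)))) u
          u″ = AllPairs.tail (AllPairs.tail u′)
          result : ∀ P′ → map proj₁ P′ ↭ row j ∷ map proj₁ P → map proj₂ P′ ↭ c ∷ map proj₂ P →
                   ¬ (P′ ↭ (row j , c) ∷ P) → total M ((row j , c) ∷ P) ≼ total M P′ → Improved (e₀ ∷ map toEdge P)
          result P′ rows cols ¬p le with ∈.∈-map⁻ proj₂ (↭.∈-resp-↭ (↭-sym cols) (here refl))
          ... | (r′ , _) , x∈ , refl with ∈-↭ x∈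
          ...   | P″ , q = join i (ρ r′) i≢ ∷ map toEdge P″
            , ↭-trans (ends-join i≢ _) (↭-trans (prep i (↭-trans (prep (ρ r′) (ends-toEdge P″))
                (↭-trans (↭.++⁺ (↭.map⁺ ρ rows′) (↭.map⁺ κ cols′))
                  (↭-trans (↭-reflexive (cong (_∷ _) (ρ-row j j∈))) (prep j (↭-sym (ends-toEdge P)))))))
                (↭-sym (ends-join ne _)))
            , (λ p → ¬p (↭-trans q (subst₂ _↭_
                 (cong₂ _∷_ (trans (pos-same i (ρ r′) i≢ i∈ (side-ρ r′) i<) (cong (_, c) (row-ρ r′))) (map-pos-toEdge P″))
                 (cong₂ _∷_ (pos-same i j ne i∈ j∈ i<j) (map-pos-toEdge P))
                 (↭.map⁺ pos p))))
            , ≼-trans (∙-mono (proj₁ (v-same i j ne i∈ j∈ i<j)) (proj₁ (total-toEdge P)))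
                (≼-trans (∙-assocˡ _ _ _) (≼-trans (∙-mono ≼-refl (≼-trans le (proj₁ (total-↭ M q))))
                (≼-trans (∙-assocʳ _ _ _) (∙-mono
                  (subst (λ r → off i ∙ M (r , c) ≼ v (join i (ρ r′) i≢)) (row-ρ r′) (proj₂ (v-same i (ρ r′) i≢ i∈ (side-ρ r′) i<)))
                  (proj₂ (total-toEdge P″))))))
            where
            i< : i Fin.< ρ r′
            i< with ↭.∈-resp-↭ rows (∈.∈-map⁺ proj₁ x∈)
            ... | here refl = subst (i Fin.<_) (sym (ρ-row j j∈)) i<j
            ... | there r∈ = top r∈
            i≢ = Fin.<⇒≢ i<
            rows′ : r′ ∷ map proj₁ P″ ↭ row j ∷ map proj₁ P
            rows′ = ↭-trans (↭-sym (↭.map⁺ proj₁ q)) rows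
            cols′ : map proj₂ P″ ↭ map proj₂ P
            cols′ = ↭.drop-∷ (↭-trans (↭-sym (↭.map⁺ proj₂ q)) cols)

      -- If `i′ < j`, exchanging the upper ends keeps both lower ends, and the total is unchanged.
      -- If `j < i′`, the edges are regrouped so that `j` replaces `i′` as a lower end, which loses
      -- nothing by `off-≼`.
      both-same : ∀ {i j i′ j′} (ne : i ≢ j) (ne′ : i′ ≢ j′) R →
        side i ≡ s → side j ≡ s → side i′ ≡ s → side j′ ≡ s → i Fin.< j → i′ Fin.< j′ → i Fin.< i′ →
        Unique (ends (join i j ne ∷ join i′ j′ ne′ ∷ R)) → Improved (join i j ne ∷ join i′ j′ ne′ ∷ R)
      both-same {i} {j} {i′} {j′} ne ne′ R i∈ j∈ i′∈ j′∈ i<j i′<j′ i<i′ u with Fin.<-cmp i′ j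
      ... | tri< i′<j _ _ = exchange R ne ne′ (Fin.<⇒≢ i<j′) (Fin.<⇒≢ i′<j) u
              (≼-trans (∙-mono (proj₁ (v-same i j ne i∈ j∈ i<j)) (proj₁ (v-same i′ j′ ne′ i′∈ j′∈ i′<j′)))
                (≼-trans (cross-over _ _ _ _)
                  (∙-mono (proj₂ (v-same i j′ _ i∈ j′∈ i<j′)) (proj₂ (v-same i′ j _ i′∈ j∈ i′<j)))))
        where i<j′ = Fin.<-trans i<i′ i′<j′
      ... | tri≈ _ refl _ = contradiction (here refl) (head∉ (AllPairs.tail
              (unique-↭ (↭-trans (ends-join ne (join i′ j′ ne′ ∷ R)) (prep _ (prep _ (ends-join ne′ R)))) u)))
      ... | tri> _ _ j<i′ = subst (λ e → Improved (join i j ne ∷ e ∷ R)) (join-comm (ne′ ∘ sym) ne′)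
              (exchange R ne (ne′ ∘ sym) (Fin.<⇒≢ i<i′) (Fin.<⇒≢ j<j′ ∘ sym)
                (subst (λ e → Unique (ends (join i j ne ∷ e ∷ R))) (join-comm ne′ (ne′ ∘ sym)) u)
                (subst₂ (λ e f → v (join i j ne) ∙ v e ≼ v (join i i′ (Fin.<⇒≢ i<i′)) ∙ v f)
                  (join-comm ne′ (ne′ ∘ sym)) (join-comm (Fin.<⇒≢ j<j′) _)
                  (≼-trans (∙-mono (proj₁ (v-same i j ne i∈ j∈ i<j)) (proj₁ (v-same i′ j′ ne′ i′∈ j′∈ i′<j′)))
                    (≼-trans (lift _ (off-≼ (row j , c) (row i′ , c) j∈ j<i′))
                      (∙-mono (proj₂ (v-same i i′ _ i∈ i′∈ i<i′)) (proj₂ (v-same j j′ _ j∈ j′∈ j<j′)))))))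
        where j<j′ = Fin.<-trans j<i′ i′<j′

      -- Without an edge inside `s` the rearrangement applies directly, and two such edges can
      -- always be exchanged. With exactly one, either `overtaken` or `rematched` applies, or its
      -- lower end is below all the other rows and column `c` is free, which is what charging it to
      -- an entry of `M` requires.
      improve : ∀ E → length E ≡ k → Unique (ends E) → All (λ e → Same e ⊎ Cross′ e) E → ¬ ¬ Improved E
      improve E len u ok with pull same? E
      ... | inj₁ none = subst (λ F → ¬ ¬ Improved F) (sym E≡)
              (improve-crossing (map pos E) (trans (List.length-map pos E) len) (subst (Unique ∘ ends) E≡ u))
        where
        E≡ : E ≡ map toEdge (map pos E)
        E≡ = cross⇒toEdge (All.zipWith (λ { (inj₁ sm , ¬sm) → contradiction sm ¬sm ; (inj₂ cr , _) → cr }) (ok , none))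
      ... | inj₂ (e , R , (i∈ , j∈) , p) with pull same? R
      ...   | inj₂ (e′ , R′ , (i′∈ , j′∈) , p′) = return¬¬ (improved-↭ E↭ (subst₂ (λ e e′ → Improved (e ∷ e′ ∷ R′))
                (sym (edge-join e)) (sym (edge-join e′)) (by (Fin.<-cmp (lo e) (lo e′)))))
        where
        E↭ = ↭-trans p (prep e p′)
        uq : Unique (ends (e ∷ e′ ∷ R′))
        uq = unique-↭ (ends-↭ E↭) u
        uj : Unique (ends (join (lo e) (hi e) (lo≢hi e) ∷ join (lo e′) (hi e′) (lo≢hi e′) ∷ R′))
        uj = subst₂ (λ e e′ → Unique (ends (e ∷ e′ ∷ R′))) (edge-join e) (edge-join e′) uq
        by : _ → Improved (join (lo e) (hi e) (lo≢hi e) ∷ join (lo e′) (hi e′) (lo≢hi e′) ∷ R′)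
        by (tri< l _ _) = both-same (lo≢hi e) (lo≢hi e′) R′ i∈ j∈ i′∈ j′∈ (lo<hi′ e) (lo<hi′ e′) l uj
        by (tri≈ _ eq _) = contradiction (there (here eq)) (head∉ uq)
        by (tri> _ _ l) = improved-↭ (swap _ _ ↭-refl)
          (both-same (lo≢hi e′) (lo≢hi e) R′ i′∈ j′∈ i∈ j∈ (lo<hi′ e′) (lo<hi′ e) l (unique-↭ (ends-↭ (swap (join (lo e) (hi e) (lo≢hi e)) (join (lo e′) (hi e′) (lo≢hi e′)) (↭-refl {x = R′}))) uj))
      ...   | inj₁ none = λ ¬imp → one-same λ imp → ¬imp (improved-↭ E↭ (subst (λ e → Improved (e ∷ map toEdge P)) (sym (edge-join e)) imp))
        where
        P = map pos R
        i = lo e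
        j = hi e
        i<j = lo<hi′ e
        R≡ : R ≡ map toEdge P
        R≡ = cross⇒toEdge (All.zipWith (λ { (inj₁ sm , ¬sm) → contradiction sm ¬sm ; (inj₂ cr , _) → cr })
               (All.tail (↭.All-resp-↭ p ok) , none))
        E↭ : E ↭ e ∷ map toEdge P
        E↭ = ↭-trans p (↭-reflexive (cong (e ∷_) R≡))
        uj : Unique (ends (join i j (lo≢hi e) ∷ map toEdge P))
        uj = subst (λ e → Unique (ends (e ∷ map toEdge P))) (edge-join e) (unique-↭ (ends-↭ E↭) u)
        u′ : Unique (i ∷ j ∷ map ρ (map proj₁ P) ++ map κ (map proj₂ P))
        u′ = unique-↭ (↭-trans (ends-join (lo≢hi e) _) (prep i (prep j (ends-toEdge P)))) uj
        above : ∀ {r} → r ∈ map proj₁ P → ¬ (ρ r Fin.< i) → i Fin.< ρ r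
        above {r} r∈ r≮i with Fin.<-cmp i (ρ r)
        ... | tri< i<r _ _ = i<r
        ... | tri≈ _ eq _ = contradiction (there (∈.∈-++⁺ˡ (subst (_∈ map ρ (map proj₁ P)) (sym eq) (∈.∈-map⁺ ρ r∈)))) (head∉ u′)
        ... | tri> _ _ r<i = contradiction r<i r≮i
        one-same : ¬ ¬ Improved (join i j (lo≢hi e) ∷ map toEdge P)
        one-same with pull (λ x → ρ (proj₁ x) Fin.<? i) P
        ... | inj₂ ((r , b) , P′ , r<i , P↭) = return¬¬ (improved-↭ (prep _ (↭.map⁺ toEdge P↭))
                (overtaken (lo≢hi e) i∈ j∈ i<j _ (map toEdge P′) (side-ρ r) (side-κ b) r<i
                  (unique-↭ (ends-↭ (prep (join i j (lo≢hi e)) (↭.map⁺ toEdge P↭))) uj)))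
        ... | inj₁ ≮i with pull (λ x → proj₂ x Fin.≟ c) P
        ...   | inj₂ ((r , b) , P′ , refl , P↭) = return¬¬ (improved-↭ (prep _ (↭.map⁺ toEdge P↭))
                (rematched (lo≢hi e) i∈ j∈ i<j _ (map toEdge P′) (side-ρ r) (side-κ b) (col-κ b)
                  (above (∈.∈-map⁺ proj₁ rb∈) (All.lookup ≮i rb∈))
                  (unique-↭ (ends-↭ (prep (join i j (lo≢hi e)) (↭.map⁺ toEdge P↭))) uj)))
                where rb∈ = ↭.∈-resp-↭ (↭-sym P↭) (here refl)
        ...   | inj₁ ≢c = improve-charged (lo≢hi e) i∈ j∈ i<j P
                (trans (cong suc (List.length-map pos R)) (trans (sym (↭.↭-length p)) len))
                (λ c∈ → case ∈.∈-map⁻ proj₂ c∈ of λ { (x , x∈ , eq) → All.lookup ≢c x∈ (sym eq) })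
                (λ r∈ → case ∈.∈-map⁻ proj₁ r∈ of λ { (x , x∈ , refl) → above r∈ (All.lookup ≮i x∈) })
                uj

-- Permutations and selections as lists

lookup-injective : ∀ {A : Set} {xs : List A} → Unique xs → ∀ i j →
                   List.lookup xs i ≡ List.lookup xs j → i ≡ j
lookup-injective (x# ∷ u) zero zero eq = refl
lookup-injective (x# ∷ u) zero (suc j) eq = contradiction eq (All.lookup x# (∈.∈-lookup j))
lookup-injective (x# ∷ u) (suc i) zero eq = contradiction (sym eq) (All.lookup x# (∈.∈-lookup i))
lookup-injective (x# ∷ u) (suc i) (suc j) eq = cong suc (lookup-injective u i j eq)

lookup-increasing : ∀ {n} {xs : List (Fin n)} → AllPairs Fin._<_ xs → ∀ {i j} → i Fin.< j →
                    List.lookup xs i Fin.< List.lookup xs j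
lookup-increasing (x< ∷ inc) {zero} {suc j} _ = All.lookup x< (∈.∈-lookup j)
lookup-increasing (x< ∷ inc) {suc i} {suc j} (s≤s i<j) = lookup-increasing inc i<j

tabulate-lookup-cast : ∀ {A : Set} (xs : List A) {n} (eq : n ≡ length xs) →
                       tabulate (λ i → List.lookup xs (Fin.cast eq i)) ≡ xs
tabulate-lookup-cast xs refl =
  trans (List.tabulate-cong (λ i → cong (List.lookup xs) (Fin.cast-is-id refl i))) (List.tabulate-lookup xs)

map-allFin : ∀ {A : Set} {n} (f : Fin n → A) → map f (allFin n) ≡ tabulate f
map-allFin {n = n} f = List.map-tabulate (λ i → i) f

-- Searching `js` inverts the lookup on one side; on the other side the inverse law follows because
-- `js` has no repetitions, so that `to` is injective.
listing⇒permutation : ∀ {r} (js : List (Fin r)) → js ↭ allFin r →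
                      Σ (Permutation′ r) λ σ → js ≡ map (σ ⟨$⟩ʳ_) (allFin r)
listing⇒permutation {r} js p = Perm.permutation to from to-from
  (λ i → to-injective (to-from (to i))) , sym (trans (map-allFin to) (tabulate-lookup-cast js len))
  where
  len : r ≡ length js
  len = trans (sym (List.length-tabulate {n = r} (λ i → i))) (sym (↭.↭-length p))
  to : Fin r → Fin r
  to i = List.lookup js (Fin.cast len i)
  mem : ∀ i → i ∈ js
  mem i = ↭.∈-resp-↭ (↭-sym p) (∈.∈-allFin i)
  from : Fin r → Fin r
  from i = Fin.cast (sym len) (Any.index (mem i))
  to-from : ∀ i → to (from i) ≡ i
  to-from i = trans (cong (List.lookup js) (Fin.cast-involutive len (sym len) (Any.index (mem i))))
                    (sym (Any.lookup-index (mem i)))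
  to-injective : ∀ {i j} → to i ≡ to j → i ≡ j
  to-injective {i} {j} eq = Fin.toℕ-injective (trans (sym (Fin.toℕ-cast len i))
    (trans (cong toℕ (lookup-injective (unique-↭ (↭-sym p) (Unique.allFin⁺ r)) _ _ eq)) (Fin.toℕ-cast len j)))

map-permutation-↭ : ∀ {r} (σ : Permutation′ r) → map (σ ⟨$⟩ʳ_) (allFin r) ↭ allFin r
map-permutation-↭ {r} σ = unique-same-elements
  (Unique.map⁺ (λ {x} {y} eq → trans (sym (Perm.inverseˡ σ)) (trans (cong (σ ⟨$⟩ˡ_) eq) (Perm.inverseˡ σ))) (Unique.allFin⁺ r))
  (Unique.allFin⁺ r) (λ _ → ∈.∈-allFin _)
  (λ {i} _ → subst (_∈ map (σ ⟨$⟩ʳ_) (allFin r)) (Perm.inverseʳ σ) (∈.∈-map⁺ (σ ⟨$⟩ʳ_) (∈.∈-allFin (σ ⟨$⟩ˡ i))))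

module _ {X Y : Set} where

  ×-list-ext : ∀ {P Q : List (X × Y)} → map proj₁ P ≡ map proj₁ Q → map proj₂ P ≡ map proj₂ Q → P ≡ Q
  ×-list-ext {[]} {[]} _ _ = refl
  ×-list-ext {(x , y) ∷ P} {(x′ , y′) ∷ Q} p q with List.∷-injective p | List.∷-injective q
  ... | refl , p′ | refl , q′ = cong ((x , y) ∷_) (×-list-ext p′ q′)

  module _ {r} (f : Fin r → X) (g : Fin r → Y) where

    entries : Permutation′ r → List (X × Y)
    entries σ = map (λ i → f i , g (σ ⟨$⟩ʳ i)) (allFin r)

    entries-rows : ∀ σ → map proj₁ (entries σ) ≡ map f (allFin r)
    entries-rows σ = sym (List.map-∘ (allFin r))

    entries-columns : ∀ σ → map proj₂ (entries σ) ↭ map g (allFin r)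
    entries-columns σ = ↭-trans (↭-reflexive (trans (sym (List.map-∘ (allFin r))) (List.map-∘ (allFin r))))
      (↭.map⁺ g (map-permutation-↭ σ))

    -- Once `P` is put into the order of the rows, its columns are a reordering of the given ones,
    -- and that reordering is the permutation.
    entries-complete : ∀ P → map proj₁ P ↭ map f (allFin r) → map proj₂ P ↭ map g (allFin r) →
                       Σ (Permutation′ r) λ σ → P ↭ entries σ
    entries-complete P rows cols with ↭.↭-map-inv proj₁ rows
    ... | Q , Q-rows , P↭Q with ↭.↭-map-inv g (↭-trans (↭-sym cols) (↭.map⁺ proj₂ P↭Q))
    ...   | js , Q-cols , js↭ with listing⇒permutation js (↭-sym js↭)
    ...     | σ , refl = σ , ↭-trans P↭Q (↭-reflexive (×-list-ext
                (trans (sym Q-rows) (sym (entries-rows σ)))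
                (trans Q-cols (trans (sym (List.map-∘ (allFin r))) (List.map-∘ (allFin r))))))

    entries-distinct : (∀ {i j} → f i ≡ f j → i ≡ j) → (∀ {i j} → g i ≡ g j → i ≡ j) →
                       ∀ σ τ → entries σ ↭ entries τ → σ Perm.≈ τ
    entries-distinct f-inj g-inj σ τ p i
      with ∈.∈-map⁻ _ (↭.∈-resp-↭ p (∈.∈-map⁺ (λ i → f i , g (σ ⟨$⟩ʳ i)) (∈.∈-allFin i)))
    ... | j , _ , eq with f-inj (cong proj₁ eq)
    ...   | refl = g-inj (cong proj₂ eq)


pick-injective : ∀ {r n} (ρ : Selection r n) {i j} → pick ρ i ≡ pick ρ j → i ≡ j
pick-injective ρ {i} {j} eq with Fin.<-cmp i j
... | tri< i<j _ _ = contradiction eq (Fin.<⇒≢ (increasing ρ i<j))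
... | tri≈ _ i≡j _ = i≡j
... | tri> _ _ j<i = contradiction (sym eq) (Fin.<⇒≢ (increasing ρ j<i))

range : ∀ {n} → List (Fin n) → Subset n
range xs = Vec.tabulate λ i → does (DecMembership._∈?_ Fin._≟_ i xs)

range-enumerates : ∀ {n} {xs : List (Fin n)} → Unique xs → Enumerates (range xs) xs
range-enumerates {xs = xs} u = enumerates u
  (λ {i} i∈ → Vec.lookup⇒[]= i (range xs) (trans (Vec.lookup∘tabulate _ i) (dec-true (i ∈ᴸ? xs) i∈)))
  (λ {i} i∈ → does-true (i ∈ᴸ? xs) (trans (sym (Vec.lookup∘tabulate _ i)) (Vec.[]=⇒lookup i∈)))
  where
  open DecMembership Fin._≟_ using () renaming (_∈?_ to _∈ᴸ?_)
  does-true : ∀ {A : Set} (a? : Dec A) → does a? ≡ true → A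
  does-true (yes a) _ = a

-- The list is sorted by passing to its set of elements, which `elements` enumerates increasingly.
selection : ∀ {n r} (xs : List (Fin n)) → Unique xs → length xs ≡ r →
            Σ (Selection r n) λ ρ → map (pick ρ) (allFin r) ↭ xs
selection {n} xs u refl = record
  { pick = λ i → List.lookup ys (Fin.cast len i)
  ; increasing = λ {i} {j} i<j → lookup-increasing (elements-increasing (range xs))
      (subst₂ _<_ (sym (Fin.toℕ-cast len i)) (sym (Fin.toℕ-cast len j)) i<j)
  } , ↭-trans (↭-reflexive (trans (map-allFin _) (tabulate-lookup-cast ys len))) ys↭xs
  where
  ys = elements (range xs)
  ys↭xs : ys ↭ xs
  ys↭xs = enumerations-↭ (elements-enumerates (range xs)) (range-enumerates u)
  len = sym (↭.↭-length ys↭xs)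

module _ (O : OrderedMonoid) where
  open OrderedMonoid O
  open OrderedMonoidProperties O

  TiedMaximum : ∀ {k n₁ n₂} → (Fin n₁ × Fin n₂ → Carrier) → Selection k n₁ → Selection k n₂ → Set
  TiedMaximum {k} M ρ γ = ∃₂ λ (σ τ : Permutation′ k) → ¬ (σ Perm.≈ τ) ×
    total M (positions ρ γ σ) ≼ total M (positions ρ γ τ) ×
    (∀ π → total M (positions ρ γ π) ≼ total M (positions ρ γ σ))

  -- `P` is the entry list of some permutation `π` of a minor. Of two tied optimal permutations at
  -- least one differs from `π`, and it weighs no less.
  singular⇒rearrangeable : ∀ {n₁ n₂ k} (M : Fin n₁ × Fin n₂ → Carrier) →
    (∀ (ρ : Selection k n₁) (γ : Selection k n₂) → ¬ ¬ TiedMaximum M ρ γ) →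
    ∀ {n} (v : Edge n → Carrier) → Exchange.Rearrangeable O v M k
  singular⇒rearrangeable {k = k} M singular v P len u₁ u₂
    with selection (map proj₁ P) u₁ (trans (List.length-map proj₁ P) len)
       | selection (map proj₂ P) u₂ (trans (List.length-map proj₂ P) len)
  ... | ρ , rows | γ , cols with entries-complete (pick ρ) (pick γ) P (↭-sym rows) (↭-sym cols)
  ... | π , P↭π = singular ρ γ >>=¬¬ λ { (σ , τ , σ≉τ , σ≼τ , σ-max) → return¬¬ (choose σ τ σ≉τ σ≼τ σ-max) }
    where
    pos = positions ρ γ
    Result = ∃[ P′ ] map proj₁ P′ ↭ map proj₁ P × map proj₂ P′ ↭ map proj₂ P × ¬ (P′ ↭ P) × total M P ≼ total M P′
    result : ∀ σ → ¬ (σ Perm.≈ π) → total M (pos π) ≼ total M (pos σ) → Result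
    result σ σ≉π le = pos σ
      , ↭-trans (↭-reflexive (entries-rows (pick ρ) (pick γ) σ)) rows
      , ↭-trans (entries-columns (pick ρ) (pick γ) σ) cols
      , (λ p → σ≉π (entries-distinct (pick ρ) (pick γ) (pick-injective ρ) (pick-injective γ) σ π (↭-trans p P↭π)))
      , ≼-trans (proj₁ (total-↭ M P↭π)) le
    choose : ∀ σ τ → ¬ (σ Perm.≈ τ) → total M (pos σ) ≼ total M (pos τ) →
             (∀ π → total M (pos π) ≼ total M (pos σ)) → Result
    choose σ τ σ≉τ σ≼τ σ-max with Fin.all? (λ i → (σ ⟨$⟩ʳ i) Fin.≟ (π ⟨$⟩ʳ i))
    ... | no σ≉π  = result σ σ≉π (σ-max π)
    ... | yes σ≈π = result τ (λ τ≈π → σ≉τ λ i → trans (σ≈π i) (sym (τ≈π i))) (≼-trans (σ-max π) σ≼τ)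

-- The weight on the edges of the complete graph

module _ {n₁ n₂ : ℕ} where

  isRow : Fin (n₁ + n₂) → Bool
  isRow i with Fin.splitAt n₁ i
  ... | inj₁ _ = true
  ... | inj₂ _ = false

  isRow-↑ˡ : ∀ (r : Fin n₁) → isRow (r ↑ˡ n₂) ≡ true
  isRow-↑ˡ r rewrite Fin.splitAt-↑ˡ n₁ r n₂ = refl

  isRow-↑ʳ : ∀ (c : Fin n₂) → isRow (n₁ ↑ʳ c) ≡ false
  isRow-↑ʳ c rewrite Fin.splitAt-↑ʳ n₁ n₂ c = refl

  ↑ˡ<↑ʳ : ∀ (r : Fin n₁) (c : Fin n₂) → r ↑ˡ n₂ Fin.< n₁ ↑ʳ c
  ↑ˡ<↑ʳ r c = subst₂ _<_ (sym (Fin.toℕ-↑ˡ r n₂)) (sym (Fin.toℕ-↑ʳ n₁ c))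
                (ℕ.<-≤-trans (Fin.toℕ<n r) (ℕ.m≤m+n n₁ (toℕ c)))

-- Both sizes are successors because the weight refers to row zero and column zero.
module LiftedWeight (O : OrderedMonoid) {a b : ℕ}
  (M : Fin (suc a) × Fin (suc b) → OrderedMonoid.Carrier O)
  (off : ℕ → OrderedMonoid.Carrier O) where
  open OrderedMonoid O
  open OrderedMonoidProperties O

  n₁ n₂ : ℕ
  n₁ = suc a
  n₂ = suc b

  side : Fin (n₁ + n₂) → Bool
  side = isRow {n₁} {n₂}

  rowOf : Fin (n₁ + n₂) → Fin n₁
  rowOf i with Fin.splitAt n₁ i
  ... | inj₁ r = r
  ... | inj₂ _ = zero

  colOf : Fin (n₁ + n₂) → Fin n₂
  colOf i with Fin.splitAt n₁ i
  ... | inj₁ _ = zero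
  ... | inj₂ c = c

  -- The lower end of an edge inside the rows acts as a copy of column zero, that of an edge
  -- inside the columns as a copy of row zero.  The value ε is never taken.
  v : Edge (n₁ + n₂) → Carrier
  v e with side (lo e) | side (hi e)
  ... | true  | true  = off (toℕ (lo e)) ∙ M (rowOf (hi e) , zero)
  ... | true  | false = M (rowOf (lo e) , colOf (hi e))
  ... | false | true  = ε
  ... | false | false = off (toℕ (lo e)) ∙ M (zero , colOf (hi e))

  rowOf-↑ˡ : ∀ r → rowOf (r ↑ˡ n₂) ≡ r
  rowOf-↑ˡ r rewrite Fin.splitAt-↑ˡ n₁ r n₂ = refl

  colOf-↑ʳ : ∀ c → colOf (n₁ ↑ʳ c) ≡ c
  colOf-↑ʳ c rewrite Fin.splitAt-↑ʳ n₁ n₂ c = refl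

  ↑ˡ-rowOf : ∀ i → side i ≡ true → rowOf i ↑ˡ n₂ ≡ i
  ↑ˡ-rowOf i eq with Fin.splitAt n₁ i in h
  ... | inj₁ r = Fin.splitAt⁻¹-↑ˡ h
  ↑ˡ-rowOf i () | inj₂ _

  ↑ʳ-colOf : ∀ i → side i ≡ false → n₁ ↑ʳ colOf i ≡ i
  ↑ʳ-colOf i eq with Fin.splitAt n₁ i in h
  ... | inj₂ c = Fin.splitAt⁻¹-↑ʳ {m = n₁} h
  ↑ʳ-colOf i () | inj₁ _

  colOf-row : ∀ i → side i ≡ true → colOf i ≡ zero
  colOf-row i eq with Fin.splitAt n₁ i
  ... | inj₁ _ = refl
  colOf-row i () | inj₂ _

  rowOf-col : ∀ i → side i ≡ false → rowOf i ≡ zero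
  rowOf-col i eq with Fin.splitAt n₁ i
  ... | inj₂ _ = refl
  rowOf-col i () | inj₁ _

  row<col : ∀ {i j} → side i ≡ true → side j ≡ false → i Fin.< j
  row<col {i} {j} i∈ j∈ = subst₂ Fin._<_ (↑ˡ-rowOf i i∈) (↑ʳ-colOf j j∈) (↑ˡ<↑ʳ (rowOf i) (colOf j))

  v-rows : ∀ i j .(i<j : i Fin.< j) → side i ≡ true → side j ≡ true →
           v (edge i j i<j) ≡ off (toℕ i) ∙ M (rowOf j , zero)
  v-rows i j _ i∈ j∈ rewrite i∈ | j∈ = refl

  v-columns : ∀ i j .(i<j : i Fin.< j) → side i ≡ false → side j ≡ false →
              v (edge i j i<j) ≡ off (toℕ i) ∙ M (zero , colOf j)
  v-columns i j _ i∈ j∈ rewrite i∈ | j∈ = refl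

  v-row-column : ∀ i j .(i<j : i Fin.< j) → side i ≡ true → side j ≡ false →
               v (edge i j i<j) ≡ M (rowOf i , colOf j)
  v-row-column i j _ i∈ j∈ rewrite i∈ | j∈ = refl

  v-entry : ∀ r c → v (edge (r ↑ˡ n₂) (n₁ ↑ʳ c) (↑ˡ<↑ʳ r c)) ≡ M (r , c)
  v-entry r c = trans (v-row-column _ _ (↑ˡ<↑ʳ r c) (isRow-↑ˡ r) (isRow-↑ʳ c))
                      (cong M (cong₂ _,_ (rowOf-↑ˡ r) (colOf-↑ʳ c)))

  Cases : Edge (n₁ + n₂) → Set
  Cases e = (∃ λ (x : Fin n₁ × Fin n₂) → e ≡ edge (proj₁ x ↑ˡ n₂) (n₁ ↑ʳ proj₂ x) (↑ˡ<↑ʳ (proj₁ x) (proj₂ x)) × v e ≡ M x) ⊎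
            (∃ λ (i : ℕ) → ∃ λ (x : Fin n₁ × Fin n₂) → v e ≡ off i ∙ M x)

  v-cases : ∀ e → Cases e
  v-cases e@(edge i j i<j) = by (side i) (side j) refl refl
    where
    crossing : ∀ {i j r c} .(i<j : i Fin.< j) → r ↑ˡ n₂ ≡ i → n₁ ↑ʳ c ≡ j → edge i j i<j ≡ edge (r ↑ˡ n₂) (n₁ ↑ʳ c) (↑ˡ<↑ʳ r c)
    crossing _ refl refl = refl
    by : ∀ x y → side i ≡ x → side j ≡ y → Cases e
    by true  true  p q = inj₂ (toℕ i , (rowOf j , zero) , v-rows i j i<j p q)
    by true  false p q = inj₁ ((rowOf i , colOf j) , crossing i<j (↑ˡ-rowOf i p) (↑ʳ-colOf j q) , v-row-column i j i<j p q)
    by false true  p q = ⊥-elim-irr (ℕ.<-asym i<j (row<col q p))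
    by false false p q = inj₂ (toℕ i , (zero , colOf j) , v-columns i j i<j p q)

  open Exchange O v

  module _ (off-≼ : ∀ i j x y → i < j → off j ∙ M x ≼ off i ∙ M y)
           (low : ∀ i x y → off i ∙ M x ≼ M y) where

    private
      ≡⇒≃ : ∀ {x y} → x ≡ y → x ≃ y
      ≡⇒≃ refl = ≃-refl

      ≢true⇒false : ∀ {x} → x ≢ true → x ≡ false
      ≢true⇒false {true} h = contradiction refl h
      ≢true⇒false {false} h = refl

      ≢false⇒true : ∀ {x} → x ≢ false → x ≡ true
      ≢false⇒true {false} h = contradiction refl h
      ≢false⇒true {true} h = refl

      false≢true : ∀ {x} → x ≡ false → x ≢ true
      false≢true refl ()

      true≢false : ∀ {x} → x ≡ true → x ≢ false
      true≢false refl ()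

    byRows : Bipartite true side n₁ n₂
    byRows = record
      { M = M ; off = off ∘ toℕ ; row = rowOf ; col = colOf ; ρ = _↑ˡ n₂ ; κ = n₁ ↑ʳ_ ; c = zero
      ; side-ρ = isRow-↑ˡ
      ; side-κ = λ c → false≢true (isRow-↑ʳ c)
      ; row-ρ = rowOf-↑ˡ
      ; col-κ = colOf-↑ʳ
      ; ρ-row = ↑ˡ-rowOf
      ; κ-col = λ i i∉ → ↑ʳ-colOf i (≢true⇒false i∉)
      ; col-c = colOf-row
      ; v-cross = λ r c ne → ≡⇒≃ (trans (cong v (join-< ne (↑ˡ<↑ʳ r c))) (v-entry r c))
      ; v-same = λ i j ne i∈ j∈ i<j → ≡⇒≃ (trans (cong v (join-< ne i<j)) (v-rows i j i<j i∈ j∈))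
      ; off-≼ = λ x y _ i<j → off-≼ _ _ x y i<j
      }

    byColumns : Bipartite false side n₂ n₁
    byColumns = record
      { M = λ (c , r) → M (r , c)
      ; off = off ∘ toℕ ; row = colOf ; col = rowOf ; ρ = n₁ ↑ʳ_ ; κ = _↑ˡ n₂ ; c = zero
      ; side-ρ = isRow-↑ʳ
      ; side-κ = λ r → true≢false (isRow-↑ˡ r)
      ; row-ρ = colOf-↑ʳ
      ; col-κ = rowOf-↑ˡ
      ; ρ-row = ↑ʳ-colOf
      ; κ-col = λ i i∉ → ↑ˡ-rowOf i (≢false⇒true i∉)
      ; col-c = rowOf-col
      ; v-cross = λ c r ne → ≡⇒≃ (trans (cong v (join-> ne (↑ˡ<↑ʳ r c))) (v-entry r c))
      ; v-same = λ i j ne i∈ j∈ i<j → ≡⇒≃ (trans (cong v (join-< ne i<j)) (v-columns i j i<j i∈ j∈))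
      ; off-≼ = λ x y _ i<j → off-≼ _ _ (proj₂ x , proj₁ x) (proj₂ y , proj₁ y) i<j
      }

    same≼crossing : ∀ {e i j} ne → Same byRows e ⊎ Same byColumns e → side i ≡ true → side j ≡ false →
                    v e ≼ v (join i j ne)
    same≼crossing {e = e@(edge k l k<l)} {i} {j} ne sm i∈ j∈ =
      subst (v e ≼_) (sym (trans (cong v (join-< ne (row<col i∈ j∈))) (v-row-column i j (row<col i∈ j∈) i∈ j∈))) (by sm)
      where
      by : _ → v e ≼ M (rowOf i , colOf j)
      by (inj₁ (k∈ , l∈)) = subst (_≼ M (rowOf i , colOf j)) (sym (v-rows k l k<l k∈ l∈)) (low _ _ _)
      by (inj₂ (k∈ , l∈)) = subst (_≼ M (rowOf i , colOf j)) (sym (v-columns k l k<l k∈ l∈)) (low _ _ _)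

    rearrangeable-transpose : ∀ {k} → Rearrangeable M k → Rearrangeable (λ (c , r) → M (r , c)) k
    rearrangeable-transpose h P len u₁ u₂ =
      h (map flip P) (trans (List.length-map flip P) len)
        (subst Unique (List.map-∘ P) u₂) (subst Unique (List.map-∘ P) u₁)
      >>=¬¬ λ { (P′ , rows , cols , ¬p , le) → return¬¬ (map flip P′
        , subst₂ _↭_ (List.map-∘ P′) (sym (List.map-∘ P)) cols
        , subst₂ _↭_ (List.map-∘ P′) (sym (List.map-∘ P)) rows
        , (λ p → ¬p (subst (_↭ map flip P) (trans (sym (List.map-∘ P′)) (List.map-id P′)) (↭.map⁺ flip p)))
        , ≼-trans (proj₂ (total-map (λ _ → ≃-refl) P)) (≼-trans le (proj₂ (total-map (λ _ → ≃-refl) P′)))) }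
      where
      flip : ∀ {A B : Set} → A × B → B × A
      flip (x , y) = y , x

    -- An edge between rows and an edge between columns together exchange for two edges across,
    -- neither of which weighs less by `low`. Otherwise only one side contains edges, and the
    -- one-sided argument applies to it.
    improve-any : ∀ {k} → Rearrangeable M k → ∀ E → length E ≡ k → Unique (ends E) → ¬ ¬ Improved E
    improve-any h E len u with pull (same? byColumns) E
    ... | inj₁ none = improve byRows h E len u (All.map (λ {e} → classify e) none)
      where
      classify : ∀ e → ¬ Same byColumns e → Same byRows e ⊎ Cross′ byRows e
      classify e h with side (lo e) in p | side (hi e) in q
      ... | true  | true  = inj₁ (refl , refl)
      ... | true  | false = inj₂ (inj₁ (refl , λ ()))
      ... | false | true  = inj₂ (inj₂ ((λ ()) , refl))
      ... | false | false = contradiction (refl , refl) h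
    ... | inj₂ (e , R , (e∈ , e∈′) , p) with pull (same? byRows) R
    ...   | inj₂ (f , R′ , (f∈ , f∈′) , q) = return¬¬ (improved-↭ E↭
            (subst₂ (λ f e → Improved (f ∷ e ∷ R′)) (sym (edge-join f)) (sym (edge-join e))
              (exchange R′ (lo≢hi f) (lo≢hi e) ne₁ (ne₂ ∘ sym)
                (subst₂ (λ f e → Unique (ends (f ∷ e ∷ R′))) (edge-join f) (edge-join e) (unique-↭ (ends-↭ E↭) u))
                (∙-mono
                  (subst (λ f′ → v f′ ≼ v (join (lo f) (hi e) ne₁)) (edge-join f) (same≼crossing {e = f} ne₁ (inj₁ (f∈ , f∈′)) f∈ e∈′))
                  (subst₂ (λ e f → v e ≼ v f) (edge-join e) (join-comm ne₂ (ne₂ ∘ sym))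
                    (same≼crossing {e = e} ne₂ (inj₂ (e∈ , e∈′)) f∈′ e∈))))))
      where
      E↭ : E ↭ f ∷ e ∷ R′
      E↭ = ↭-trans p (↭-trans (prep e q) (swap e f ↭-refl))
      ne₁ : lo f ≢ hi e
      ne₁ = Fin.<⇒≢ (row<col f∈ e∈′)
      ne₂ : hi f ≢ lo e
      ne₂ = Fin.<⇒≢ (row<col f∈′ e∈)
    ...   | inj₁ none = improve byColumns (rearrangeable-transpose h) E len u
              (↭.All-resp-↭ (↭-sym p) (inj₁ (e∈ , e∈′) ∷ All.map (λ {e} → classify e) none))
      where
      classify : ∀ e → ¬ Same byRows e → Same byColumns e ⊎ Cross′ byColumns e
      classify e h with side (lo e) in p | side (hi e) in q
      ... | false | false = inj₁ (refl , refl)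
      ... | true  | false = inj₂ (inj₂ ((λ ()) , refl))
      ... | false | true  = inj₂ (inj₁ (refl , λ ()))
      ... | true  | true  = contradiction (refl , refl) h

    -- Matchings of `2 * k + 2` vertices have `suc k` edges, the size in which tropical rank at most
    -- `k` provides ties.
    maximum-twice : ∀ {k} → Rearrangeable M (suc k) → (U : Subset (n₁ + n₂)) → ∣ U ∣ ≡ 2 * k + 2 →
      ¬ ¬ MaximumTwice U
    maximum-twice {k} h U |U| = best (perfectMatchings U) (proj₂ (perfectMatchings-nonempty U (suc k) |U|′))
      >>=¬¬ λ { (E , E∈ , max) →
        improve-any h E (size E E∈) (unique (∈-perfectMatchings⁻ {U = U} E∈))
        >>=¬¬ λ { (L , q , ¬p , le) → return¬¬ (
          let E′ , E′∈ , r = ∈-perfectMatchings⁺ L (enumerates-↭ (↭-sym q) (∈-perfectMatchings⁻ {U = U} E∈))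
          in E , E′ , E∈ , E′∈ , (λ eq → ¬p (↭-sym (subst (_↭ L) (sym eq) r))) , ≼-trans le (proj₂ (total-↭ v r)) , max) } }
      where
      |U|′ : ∣ U ∣ ≡ 2 * suc k
      |U|′ = trans |U| (trans (ℕ.+-comm (2 * k) 2) (sym (ℕ.*-suc 2 k)))
      size : ∀ E → E ∈ perfectMatchings U → length E ≡ suc k
      size E E∈ = ℕ.*-cancelˡ-≡ _ _ 2 (trans (sym (length-ends E)) (trans (enumeration-length (∈-perfectMatchings⁻ {U = U} E∈)) |U|′))
      best : ∀ Es {E} → E ∈ Es → ¬ ¬ (∃[ E ] E ∈ Es × (∀ F → F ∈ Es → total v F ≼ total v E))
      best (E ∷ Es) _ = ¬¬-max (total v) E Es

-- The lifted weight lies in the tropical Pfaffian prevariety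

total≡weight : ∀ {X : Set} (v : X → ℝ) xs → OrderedMonoidProperties.total ℝ-orderedMonoid v xs ≡ weight v xs
total≡weight v []       = refl
total≡weight v (x ∷ xs) = trans (⊹≡+ℝ _ _) (cong (v x +ℝ_) (total≡weight v xs))

module _ {X : Set} (v : X → ℝ) (xs ys : List X) where
  open OrderedMonoidProperties ℝ-orderedMonoid using (total)

  total⇒weight : total v xs ⊑ total v ys → weight v xs ≤ℝ weight v ys
  total⇒weight h = subst₂ _≤ℝ_ (total≡weight v xs) (total≡weight v ys) (⊑-elim _ _ h)

  weight⇒total : weight v xs ≤ℝ weight v ys → total v xs ⊑ total v ys
  weight⇒total h = subst₂ _⊑_ (sym (total≡weight v xs)) (sym (total≡weight v ys)) (⊑-intro _ _ h)

maximumTwice⇒Pf : ∀ {n} k (v : Edge n → ℝ) →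
  (∀ U → ∣ U ∣ ≡ 2 * k + 2 → Exchange.MaximumTwice ℝ-orderedMonoid v U) → Pf k n v
maximumTwice⇒Pf k v h U |U| = convert (h U |U|)
  where
  convert : Exchange.MaximumTwice ℝ-orderedMonoid v U →
    ∃₂ λ E E′ → E ∈ perfectMatchings U × E′ ∈ perfectMatchings U × E ≢ E′ ×
      weight v E ≈ℝ weight v E′ × (∀ F → F ∈ perfectMatchings U → weight v F ≤ℝ weight v E)
  convert (E , E′ , E∈ , E′∈ , E≢E′ , le , max) =
    E , E′ , E∈ , E′∈ , E≢E′
    , ≤ℝ-antisym {weight v E} {weight v E′} (total⇒weight v E E′ le) (total⇒weight v E′ E (max E′ E′∈))
    , λ F F∈ → total⇒weight v F E (max F F∈)

singular⇒tied : ∀ {k n₁ n₂} (M : Matrix n₁ n₂) (ρ : Selection k n₁) (γ : Selection k n₂) →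
                Singular ρ γ M → TiedMaximum ℝ-orderedMonoid M ρ γ
singular⇒tied M ρ γ (σ , τ , σ≉τ , eq , max) =
  σ , τ , σ≉τ
  , weight⇒total M (positions ρ γ σ) (positions ρ γ τ)
      (≈⇒≤ℝ {weight M (positions ρ γ σ)} {weight M (positions ρ γ τ)} eq)
  , λ π → weight⇒total M (positions ρ γ π) (positions ρ γ σ) (max π)

tied : ∀ {k n₁ n₂} (M : Matrix n₁ n₂) → TropicalRank≤ M k →
       ∀ (ρ : Selection (suc k) n₁) (γ : Selection (suc k) n₂) → ¬ ¬ TiedMaximum ℝ-orderedMonoid M ρ γ
tied {k} M rank ρ γ ¬tied =
  ℕ.<-irrefl refl (rank (suc k) ρ γ λ sing → ¬tied (singular⇒tied M ρ γ sing))

-- Double negation commutes with a quantifier over the finitely many subsets, so the ties found for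
-- each `U` can be assembled into one element of `Pf`.
¬¬-subsets : ∀ {p} n {P : Pred (Subset n) p} → (∀ U → ¬ ¬ P U) → ¬ ¬ (∀ U → P U)
¬¬-subsets zero h = h [] >>=¬¬ λ p → return¬¬ λ { [] → p }
¬¬-subsets (suc n) h =
  ¬¬-subsets n (λ U → h (true ∷ U)) >>=¬¬ λ t →
  ¬¬-subsets n (λ U → h (false ∷ U)) >>=¬¬ λ f →
  return¬¬ λ { (true ∷ U) → t U ; (false ∷ U) → f U }

liftedWeight : ∀ {a b} → Matrix (suc a) (suc b) → (ℕ → ℝ) → Edge (suc a + suc b) → ℝ
liftedWeight = LiftedWeight.v ℝ-orderedMonoid

module _ {a b : ℕ} (M : Matrix (suc a) (suc b)) (off : ℕ → ℝ)
  (off-mono : ∀ i j x y → i < j → off j ⊹ M x ⊑ off i ⊹ M y)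
  (off-low : ∀ i x y → off i ⊹ M x ⊑ M y) where

  liftedWeight∈Pf : ∀ {k} → TropicalRank≤ M k → ¬ ¬ Pf k (suc a + suc b) (liftedWeight M off)
  liftedWeight∈Pf {k} rank = ¬¬-subsets (suc a + suc b) (λ U → twice U (∣ U ∣ ℕ.≟ 2 * k + 2))
    >>=¬¬ λ h → return¬¬ (maximumTwice⇒Pf k (liftedWeight M off) h)
    where
    twice : ∀ U → Dec (∣ U ∣ ≡ 2 * k + 2) →
            ¬ ¬ (∣ U ∣ ≡ 2 * k + 2 → Exchange.MaximumTwice ℝ-orderedMonoid (liftedWeight M off) U)
    twice U (no |U|≢) = return¬¬ λ |U| → contradiction |U| |U|≢
    twice U (yes |U|) = LiftedWeight.maximum-twice ℝ-orderedMonoid M off off-mono off-low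
      (singular⇒rearrangeable ℝ-orderedMonoid M (tied M rank) (liftedWeight M off)) U |U| >>=¬¬ λ t → return¬¬ λ _ → t

-- A drop of `N + N` absorbs the difference of two numbers lying between `-N` and `N`.
offset-≤ : ∀ {N p q x y} → p + (N + N) ≤ q → x ≤ℝ ι N → -ℝ ι N ≤ℝ y → -ℝ ι q +ℝ x ≤ℝ -ℝ ι p +ℝ y
offset-≤ {N} {p} {q} {x} {y} p≤q x≤ ≤y =
  ≤ℝ-trans { -ℝ ι q +ℝ x} { -ℝ ι (p + (N + N)) +ℝ ι N} { -ℝ ι p +ℝ y}
    (+ℝ-mono-≤ { -ℝ ι q} { -ℝ ι (p + (N + N))} {x} {ι N} (-ℝ-antimono {ι (p + (N + N))} {ι q} (ι-mono p≤q)) x≤)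
    (≤ℝ-trans { -ℝ ι (p + (N + N)) +ℝ ι N} { -ℝ ι p +ℝ -ℝ ι N} { -ℝ ι p +ℝ y}
      (≗⇒≤ℝ { -ℝ ι (p + (N + N)) +ℝ ι N} { -ℝ ι p +ℝ -ℝ ι N} λ _ → eq)
      (+ℝ-mono-≤ { -ℝ ι p} { -ℝ ι p} { -ℝ ι N} {y} (≤ℝ-refl { -ℝ ι p}) ≤y))
  where
  open ℚS
  eq : ℚ.- ιℚ (p + (N + N)) ℚ.+ ιℚ N ≡ ℚ.- ιℚ p ℚ.+ ℚ.- ιℚ N
  eq = trans (cong (λ t → ℚ.- t ℚ.+ ιℚ N) (trans (ιℚ-+ p (N + N)) (cong (ιℚ p ℚ.+_) (ιℚ-+ N N))))
         (solve 2 (λ p n → ((⊝ (p ⊕ (n ⊕ n))) ⊕ n) ⊜ ((⊝ p) ⊕ (⊝ n))) refl (ιℚ p) (ιℚ N))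

-- Consecutive values differ by `N + N`, the spread of entries bounded by `N`, and the first lies
-- `N + N` below `-C`. The free parameter `C` is what later pushes the edges inside a side below any
-- given monomial.
offset : ℕ → ℕ → ℕ → ℝ
offset N C i = -ℝ ι (C + (N + N) + i * (N + N))

module _ {a b : ℕ} (M : Matrix (suc a) (suc b)) (N : ℕ)
  (M≤ : ∀ x → M x ≤ℝ ι N) (≤M : ∀ x → -ℝ ι N ≤ℝ M x) (C : ℕ) where

  offset-mono : ∀ i j x y → i < j → offset N C j +ℝ M x ≤ℝ offset N C i +ℝ M y
  offset-mono i j x y i<j = offset-≤ {N} {C + (N + N) + i * (N + N)} {C + (N + N) + j * (N + N)} {M x} {M y}
    (subst (_≤ C + (N + N) + j * (N + N)) (lem (C + (N + N)) (i * (N + N)) (N + N))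
      (ℕ.+-monoʳ-≤ (C + (N + N)) (ℕ.*-monoˡ-≤ (N + N) i<j))) (M≤ x) (≤M y)
    where
    lem : ∀ a b c → a + (c + b) ≡ a + b + c
    lem a b c = trans (cong (a +_) (ℕ.+-comm c b)) (sym (ℕ.+-assoc a b c))

  offset-low : ∀ i x y → offset N C i +ℝ M x ≤ℝ -ℝ ι C +ℝ M y
  offset-low i x y = offset-≤ {N} {C} {C + (N + N) + i * (N + N)} {M x} {M y} (ℕ.m≤m+n (C + (N + N)) (i * (N + N))) (M≤ x) (≤M y)

  offset-low′ : ∀ i x y → offset N C i +ℝ M x ≤ℝ M y
  offset-low′ i x y = ≤ℝ-trans {offset N C i +ℝ M x} { -ℝ ι C +ℝ M y} {M y} (offset-low i x y)
    (≤ℝ-trans { -ℝ ι C +ℝ M y} {0ℝ +ℝ M y} {M y}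
      (+ℝ-mono-≤ { -ℝ ι C} {0ℝ} {M y} {M y}
        (≤ℝ-trans { -ℝ ι C} { -ℝ ι 0} {0ℝ} (-ℝ-antimono {ι 0} {ι C} (ι-mono {0} {C} z≤n))
          (≗⇒≤ℝ { -ℝ ι 0} {0ℝ} λ _ → refl)) (≤ℝ-refl {M y}))
      (≗⇒≤ℝ {0ℝ +ℝ M y} {M y} λ n → ℚ.+-identityˡ (seq (M y) n)))

  offsetWeight∈Pf : ∀ {k} → TropicalRank≤ M k → ¬ ¬ Pf k (suc a + suc b) (liftedWeight M (offset N C))
  offsetWeight∈Pf = liftedWeight∈Pf M (offset N C)
    (λ i j x y i<j → ⊹-⊑-intro (offset N C j) (M x) (offset N C i) (M y) (offset-mono i j x y i<j))
    (λ i x y → subst (_⊑ M y) (sym (⊹≡+ℝ (offset N C i) (M x))) (⊑-intro (offset N C i +ℝ M x) (M y) (offset-low′ i x y)))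

-- Polynomials and ideals

module PolynomialProperties {c ℓ} (R : CommutativeRing c ℓ) {X : Set} (_≟_ : DecidableEquality X) where
  open Polynomials R _≟_
  private module R = CommutativeRing R
  open R using () renaming (Carrier to A; _≈_ to _≈ᴿ_)
  open RingProperties R.ring using (-‿distribˡ-*; -‿distribʳ-*; -‿involutive)
  open import Algebra.Properties.CommutativeSemigroup R.+-commutativeSemigroup using (interchange)
  open import Algebra.Properties.CommutativeSemigroup R.*-commutativeSemigroup
    using () renaming (x∙yz≈y∙xz to *-leftComm)

  infix 4 _≋_

  -- `f ≈ₚ g` unfolds to a statement on coefficients from which `f` and `g` cannot be inferred; the
  -- record keeps them visible to unification.
  record _≋_ (f g : Poly) : Set ℓ where
    constructor mk≋
    field un≋ : f ≈ₚ g
  open _≋_ public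

  ≋-refl : ∀ {f} → f ≋ f
  ≋-refl = mk≋ λ _ → R.refl

  ≋-reflexive : ∀ {f g} → f ≡ g → f ≋ g
  ≋-reflexive refl = ≋-refl

  ≋-sym : ∀ {f g} → f ≋ g → g ≋ f
  ≋-sym (mk≋ p) = mk≋ λ m → R.sym (p m)

  ≋-trans : ∀ {f g h} → f ≋ g → g ≋ h → f ≋ h
  ≋-trans (mk≋ p) (mk≋ q) = mk≋ λ m → R.trans (p m) (q m)

  Term : Set c
  Term = A × Monomial X

  infixl 7 _·_
  _·_ : Term → Term → Term
  (a , m) · (b , m′) = a R.* b , m ++ m′

  -- Coefficients become sums of a function over the terms; those of a product are then double sums,
  -- and laws of products reduce to interchanging summations.
  sumOver : (Term → A) → Poly → A
  sumOver τ = foldr (λ t s → τ t R.+ s) R.0#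

  at : Monomial X → Term → A
  at m (a , m′) = if does (_↭?_ _≟_ m′ m) then a else R.0#

  coeff≈sumOver : ∀ f m → coeff f m ≈ᴿ sumOver (at m) f
  coeff≈sumOver [] m = R.refl
  coeff≈sumOver ((a , m′) ∷ f) m with does (_↭?_ _≟_ m′ m)
  ... | true  = R.+-congˡ (coeff≈sumOver f m)
  ... | false = R.trans (coeff≈sumOver f m) (R.sym (R.+-identityˡ _))

  sumOver-cong : ∀ {τ τ′} f → (∀ t → τ t ≈ᴿ τ′ t) → sumOver τ f ≈ᴿ sumOver τ′ f
  sumOver-cong [] h = R.refl
  sumOver-cong (t ∷ f) h = R.+-cong (h t) (sumOver-cong f h)

  sumOver-++ : ∀ τ f g → sumOver τ (f ++ g) ≈ᴿ sumOver τ f R.+ sumOver τ g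
  sumOver-++ τ [] g = R.sym (R.+-identityˡ _)
  sumOver-++ τ (t ∷ f) g = R.trans (R.+-congˡ (sumOver-++ τ f g)) (R.sym (R.+-assoc _ _ _))

  sumOver-map : ∀ τ (h : Term → Term) f → sumOver τ (map h f) ≡ sumOver (τ ∘ h) f
  sumOver-map τ h [] = refl
  sumOver-map τ h (t ∷ f) = cong (τ (h t) R.+_) (sumOver-map τ h f)

  sumOver-+ : ∀ τ τ′ f → sumOver (λ t → τ t R.+ τ′ t) f ≈ᴿ sumOver τ f R.+ sumOver τ′ f
  sumOver-+ τ τ′ [] = R.sym (R.+-identityˡ _)
  sumOver-+ τ τ′ (t ∷ f) = R.trans (R.+-congˡ (sumOver-+ τ τ′ f)) (interchange _ _ _ _)

  sumOver-0 : ∀ f → sumOver (λ _ → R.0#) f ≈ᴿ R.0#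
  sumOver-0 [] = R.refl
  sumOver-0 (t ∷ f) = R.trans (R.+-identityˡ _) (sumOver-0 f)

  sumOver-* : ∀ τ f g → sumOver τ (f *ₚ g) ≈ᴿ sumOver (λ s → sumOver (λ t → τ (s · t)) g) f
  sumOver-* τ [] g = R.refl
  sumOver-* τ (s ∷ f) g = R.trans (sumOver-++ τ (map (s ·_) g) (f *ₚ g))
    (R.+-cong (R.reflexive (sumOver-map τ (s ·_) g)) (sumOver-* τ f g))

  sumOver-swap : ∀ (θ : Term → Term → A) f g →
    sumOver (λ s → sumOver (θ s) g) f ≈ᴿ sumOver (λ t → sumOver (λ s → θ s t) f) g
  sumOver-swap θ [] g = R.sym (sumOver-0 g)
  sumOver-swap θ (s ∷ f) g = R.trans (R.+-congˡ (sumOver-swap θ f g)) (R.sym (sumOver-+ _ _ g))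

  private
    does-cong : ∀ {P Q : Set} (p? : Dec P) (q? : Dec Q) → (P → Q) → (Q → P) → does p? ≡ does q?
    does-cong (yes p) q? to from = sym (dec-true q? (to p))
    does-cong (no ¬p) q? to from = sym (dec-false q? (¬p ∘ from))

  does-↭ : ∀ {m₁ m₂ n₁ n₂ : Monomial X} → (m₁ ↭ m₂ → n₁ ↭ n₂) → (n₁ ↭ n₂ → m₁ ↭ m₂) →
           does (_↭?_ _≟_ m₁ m₂) ≡ does (_↭?_ _≟_ n₁ n₂)
  does-↭ {m₁} {m₂} {n₁} {n₂} = does-cong (_↭?_ _≟_ m₁ m₂) (_↭?_ _≟_ n₁ n₂)

  at-cong : ∀ {m a b x y} → a ≈ᴿ b → x ↭ y → at m (a , x) ≈ᴿ at m (b , y)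
  at-cong {m} {x = x} {y} a≈b p
    rewrite does-↭ {x} {m} {y} {m} (↭-trans (↭-sym p)) (↭-trans p)
    with does (_↭?_ _≟_ y m)
  ... | true  = a≈b
  ... | false = R.refl

  coeff-resp : ∀ f {m m′} → m ↭ m′ → coeff f m ≡ coeff f m′
  coeff-resp [] p = refl
  coeff-resp ((a , x) ∷ f) {m} {m′} p
    rewrite does-↭ {x} {m} {x} {m′} (λ q → ↭-trans q p) (λ q → ↭-trans q (↭-sym p)) | coeff-resp f p = refl

  coeff-absent : ∀ f {m} → All (λ t → ¬ (proj₂ t ↭ m)) f → coeff f m ≡ R.0#
  coeff-absent [] [] = refl
  coeff-absent ((a , x) ∷ f) {m} (¬p ∷ ¬ps) rewrite dec-false (_↭?_ _≟_ x m) ¬p = coeff-absent f ¬ps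

  coeff-unique : ∀ {f m a m′} → AllPairs (λ s t → ¬ (proj₂ s ↭ proj₂ t)) f → (a , m′) ∈ f → m′ ↭ m →
                 coeff f m ≈ᴿ a
  coeff-unique {(a , x) ∷ f} {m} (¬ps ∷ _) (here refl) p rewrite dec-true (_↭?_ _≟_ x m) p =
    R.trans (R.+-congˡ (R.reflexive (coeff-absent f (All.map (λ ¬q q → ¬q (↭-trans p (↭-sym q))) ¬ps)))) (R.+-identityʳ _)
  coeff-unique {(b , x) ∷ f} {m} (¬ps ∷ distinct) (there t∈) p
    rewrite dec-false (_↭?_ _≟_ x m) (λ q → All.lookup ¬ps t∈ (↭-trans q (↭-sym p))) =
    coeff-unique distinct t∈ p

  coeff-++ : ∀ f g m → coeff (f ++ g) m ≈ᴿ coeff f m R.+ coeff g m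
  coeff-++ f g m = R.trans (coeff≈sumOver (f ++ g) m) (R.trans (sumOver-++ (at m) f g)
    (R.sym (R.+-cong (coeff≈sumOver f m) (coeff≈sumOver g m))))

  ++-cong : ∀ {f f′ g g′} → f ≋ f′ → g ≋ g′ → f ++ g ≋ f′ ++ g′
  ++-cong {f} {f′} {g} {g′} (mk≋ p) (mk≋ q) = mk≋ λ m →
    R.trans (coeff-++ f g m) (R.trans (R.+-cong (p m) (q m)) (R.sym (coeff-++ f′ g′ m)))

  sumOver-↭ : ∀ τ {f g : Poly} → f ↭ g → sumOver τ f ≈ᴿ sumOver τ g
  sumOver-↭ τ ↭.refl = R.refl
  sumOver-↭ τ (prep t p) = R.+-congˡ (sumOver-↭ τ p)
  sumOver-↭ τ (swap s t p) = R.trans (R.+-congˡ (R.+-congˡ (sumOver-↭ τ p)))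
    (R.trans (R.sym (R.+-assoc _ _ _)) (R.trans (R.+-congʳ (R.+-comm _ _)) (R.+-assoc _ _ _)))
  sumOver-↭ τ (↭.trans p q) = R.trans (sumOver-↭ τ p) (sumOver-↭ τ q)

  ↭⇒≋ : ∀ {f g : Poly} → f ↭ g → f ≋ g
  ↭⇒≋ {f} {g} p = mk≋ λ m → R.trans (coeff≈sumOver f m)
    (R.trans (sumOver-↭ (at m) p) (R.sym (coeff≈sumOver g m)))

  ∷-cong : ∀ {a b x y f g} → a ≈ᴿ b → x ↭ y → f ≋ g → (a , x) ∷ f ≋ (b , y) ∷ g
  ∷-cong {a} {b} {x} {y} {f} {g} a≈b p (mk≋ q) = mk≋ λ m → R.trans (coeff≈sumOver ((a , x) ∷ f) m)
    (R.trans (R.+-cong (at-cong a≈b p) (R.trans (R.sym (coeff≈sumOver f m)) (R.trans (q m) (coeff≈sumOver g m))))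
      (R.sym (coeff≈sumOver ((b , y) ∷ g) m)))

  cancel : ∀ {a b x y f} → a R.+ b ≈ᴿ R.0# → x ↭ y → (a , x) ∷ (b , y) ∷ f ≋ f
  cancel {a} {b} {x} {y} {f} a+b≈0 p = ≋-trans (∷-cong R.refl p ≋-refl) (mk≋ h)
    where
    h : ∀ m → coeff ((a , y) ∷ (b , y) ∷ f) m ≈ᴿ coeff f m
    h m with does (_↭?_ _≟_ y m)
    ... | false = R.refl
    ... | true  = R.trans (R.sym (R.+-assoc a b (coeff f m))) (R.trans (R.+-congʳ a+b≈0) (R.+-identityˡ _))

  merge : ∀ {a b x y f} → x ↭ y → (a , x) ∷ (b , y) ∷ f ≋ (a R.+ b , y) ∷ f
  merge {a} {b} {x} {y} {f} p = ≋-trans (∷-cong R.refl p ≋-refl) (mk≋ h)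
    where
    h : ∀ m → coeff ((a , y) ∷ (b , y) ∷ f) m ≈ᴿ coeff ((a R.+ b , y) ∷ f) m
    h m with does (_↭?_ _≟_ y m)
    ... | false = R.refl
    ... | true  = R.sym (R.+-assoc a b (coeff f m))

  divide : ∀ (x m : Monomial X) → Dec (∃[ z ] x ++ z ↭ m)
  divide [] m = yes (m , ↭-refl)
  divide (y ∷ x) m with DecMembership._∈?_ _≟_ y m
  ... | no y∉ = no λ (z , p) → y∉ (↭.∈-resp-↭ p (here refl))
  ... | yes y∈ with ∈-↭ y∈
  ...   | m′ , p = map′ (λ (z , q) → z , ↭-trans (prep y q) (↭-sym p))
                        (λ (z , q) → z , ↭.drop-∷ (↭-trans q p)) (divide x m′)

  ++-cancelˡ : ∀ (x : Monomial X) {y z} → x ++ y ↭ x ++ z → y ↭ z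
  ++-cancelˡ [] p = p
  ++-cancelˡ (_ ∷ x) p = ++-cancelˡ x (↭.drop-∷ p)

  private
    quotient : ∀ {x m : Monomial X} → A → Poly → Dec (∃[ z ] x ++ z ↭ m) → A
    quotient a f (yes (z , _)) = a R.* coeff f z
    quotient a f (no _)        = R.0#

    shifted : ∀ a x f m → sumOver (λ t → at m ((a , x) · t)) f ≈ᴿ quotient a f (divide x m)
    shifted a x f m with divide x m
    ... | no ¬div = R.trans (sumOver-cong f λ (b , y) → R.reflexive
            (cong (if_then a R.* b else R.0#) (dec-false (_↭?_ _≟_ (x ++ y) m) (λ p → ¬div (y , p))))) (sumOver-0 f)
    ... | yes (z , p) = R.trans (go f) (R.*-congˡ (R.sym (coeff≈sumOver f z)))
      where
      go : ∀ f → sumOver (λ t → at m ((a , x) · t)) f ≈ᴿ a R.* sumOver (at z) f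
      go [] = R.sym (R.zeroʳ a)
      go ((b , y) ∷ f) = R.trans (R.+-cong head (go f)) (R.sym (R.distribˡ a _ _))
        where
        head : at m (a R.* b , x ++ y) ≈ᴿ a R.* at z (b , y)
        head rewrite does-↭ {x ++ y} {m} {y} {z} (λ q → ++-cancelˡ x (↭-trans q (↭-sym p)))
                                                   (λ q → ↭-trans (↭.++⁺ˡ x q) p)
          with does (_↭?_ _≟_ y z)
        ... | true  = R.refl
        ... | false = R.sym (R.zeroʳ a)

  -- Products are formed term by term, while equality sees only coefficients. The bridge is
  -- `shifted`: the coefficient at `m` of a term with monomial `x` times `f` is a multiple of the
  -- coefficient of `f` at the quotient of `m` by `x`, or zero if `x` does not divide `m`.
  *-congˡ : ∀ h {f g} → f ≋ g → h *ₚ f ≋ h *ₚ g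
  *-congˡ h {f} {g} (mk≋ p) = mk≋ λ m →
    R.trans (coeff≈sumOver (h *ₚ f) m) (R.trans (sumOver-* (at m) h f)
      (R.trans (sumOver-cong h λ (a , x) → step a x m)
        (R.sym (R.trans (coeff≈sumOver (h *ₚ g) m) (sumOver-* (at m) h g)))))
    where
    step : ∀ a x m → sumOver (λ t → at m ((a , x) · t)) f ≈ᴿ sumOver (λ t → at m ((a , x) · t)) g
    step a x m = R.trans (shifted a x f m) (R.trans mid (R.sym (shifted a x g m)))
      where
      mid : quotient a f (divide x m) ≈ᴿ quotient a g (divide x m)
      mid with divide x m
      ... | yes (z , _) = R.*-congˡ (p z)
      ... | no _        = R.refl

  *-distribˡ : ∀ h f g → h *ₚ (f ++ g) ≋ h *ₚ f ++ h *ₚ g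
  *-distribˡ h f g = mk≋ λ m → R.trans (coeff≈sumOver (h *ₚ (f ++ g)) m)
    (R.trans (sumOver-* (at m) h (f ++ g)) (R.trans (sumOver-cong h λ s → sumOver-++ (λ t → at m (s · t)) f g)
      (R.trans (sumOver-+ _ _ h) (R.sym (R.trans (coeff≈sumOver (h *ₚ f ++ h *ₚ g) m)
        (R.trans (sumOver-++ (at m) (h *ₚ f) (h *ₚ g)) (R.+-cong (sumOver-* (at m) h f) (sumOver-* (at m) h g))))))))

  *-leftCommₚ : ∀ u h f → u *ₚ (h *ₚ f) ≋ h *ₚ (u *ₚ f)
  *-leftCommₚ u h f = mk≋ λ m → R.trans (expand u h m)
    (R.trans (sumOver-swap (λ s t → sumOver (λ r → at m (s · (t · r))) f) u h)
      (R.trans (sumOver-cong h λ t → sumOver-cong u λ s → sumOver-cong f λ r →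
          at-cong (*-leftComm _ _ _) (↭.shifts (proj₂ s) (proj₂ t)))
        (R.sym (expand h u m))))
    where
    expand : ∀ u h m → coeff (u *ₚ (h *ₚ f)) m ≈ᴿ sumOver (λ s → sumOver (λ t → sumOver (λ r → at m (s · (t · r))) f) h) u
    expand u h m = R.trans (coeff≈sumOver (u *ₚ (h *ₚ f)) m) (R.trans (sumOver-* (at m) u (h *ₚ f))
      (sumOver-cong u λ s → sumOver-* (λ t → at m (s · t)) h f))

  *-zeroʳ : ∀ h → h *ₚ 0ₚ ≋ 0ₚ
  *-zeroʳ h = ≋-reflexive (List.cartesianProductWith-zeroʳ _·_ h)

  map-≋ : ∀ {b} {B : Set b} (s t : B → Term) xs → (∀ x → proj₁ (s x) ≈ᴿ proj₁ (t x)) → (∀ x → proj₂ (s x) ↭ proj₂ (t x)) →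
          map s xs ≋ map t xs
  map-≋ s t [] h k = ≋-refl
  map-≋ s t (x ∷ xs) h k = ∷-cong (h x) (k x) (map-≋ s t xs h k)

  scale : ∀ a x f → ((a , x) ∷ []) *ₚ f ≡ map ((a , x) ·_) f
  scale a x f = List.++-identityʳ _

  ⟨⟩-resp : ∀ {p} {G : Pred Poly p} {f g} → f ≋ g → ⟨ G ⟩ f → ⟨ G ⟩ g
  ⟨⟩-resp (mk≋ p) = ≈-resp p

  ⟨⟩-mono : ∀ {p q} {G : Pred Poly p} {H : Pred Poly q} → (∀ {f} → G f → ⟨ H ⟩ f) → ∀ {f} → ⟨ G ⟩ f → ⟨ H ⟩ f
  ⟨⟩-mono h (gen g) = h g
  ⟨⟩-mono h nil = nil
  ⟨⟩-mono h (add d e) = add (⟨⟩-mono h d) (⟨⟩-mono h e)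
  ⟨⟩-mono h (mul k d) = mul k (⟨⟩-mono h d)
  ⟨⟩-mono h (≈-resp p d) = ≈-resp p (⟨⟩-mono h d)

  occurs : ∀ f m → ¬ (coeff f m ≈ᴿ R.0#) → ∃[ t ] t ∈ f × proj₂ t ↭ m
  occurs f m supp = by (Any.any? (λ t → _↭?_ _≟_ (proj₂ t) m) f)
    where
    by : Dec (Any (λ t → proj₂ t ↭ m) f) → ∃[ t ] t ∈ f × proj₂ t ↭ m
    by (yes any) = find any
    by (no ¬any) = contradiction (R.reflexive (coeff-absent f (All.¬Any⇒All¬ f ¬any))) supp

  -- Only the monomials of the finitely many terms of `f` can have a nonzero coefficient, so the
  -- doubly negated vanishing at each of them can be collected.
  zero-or-supported : ∀ f → ¬ ¬ ((∃[ m ] ¬ (coeff f m ≈ᴿ R.0#)) ⊎ (∀ m → coeff f m ≈ᴿ R.0#))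
  zero-or-supported f = ¬¬-excluded-middle {A = ∃[ m ] ¬ (coeff f m ≈ᴿ R.0#)} >>=¬¬ split
    where
    split : Dec (∃[ m ] ¬ (coeff f m ≈ᴿ R.0#)) → ¬ ¬ ((∃[ m ] ¬ (coeff f m ≈ᴿ R.0#)) ⊎ (∀ m → coeff f m ≈ᴿ R.0#))
    split (yes supp) = return¬¬ (inj₁ supp)
    split (no ¬supp) =
      ¬¬-all {P = λ t → coeff f (proj₂ t) ≈ᴿ R.0#} (λ t ¬z → ¬supp (proj₂ t , ¬z)) f >>=¬¬ λ zeros →
      return¬¬ (inj₂ λ m → by m zeros (Any.any? (λ t → _↭?_ _≟_ (proj₂ t) m) f))
      where
      by : ∀ m → All (λ t → coeff f (proj₂ t) ≈ᴿ R.0#) f → Dec (Any (λ t → proj₂ t ↭ m) f) → coeff f m ≈ᴿ R.0#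
      by m zeros (no ¬any) = R.reflexive (coeff-absent f (All.¬Any⇒All¬ f ¬any))
      by m zeros (yes any) = let t , t∈ , p = find any in
        R.trans (R.reflexive (coeff-resp f (↭-sym p))) (All.lookup zeros t∈)

  one-* : ∀ f → ((R.1# , []) ∷ []) *ₚ f ≋ f
  one-* f = ≋-trans (≋-reflexive (scale R.1# [] f))
    (≋-trans (map-≋ ((R.1# , []) ·_) id f (λ t → R.*-identityˡ (proj₁ t)) (λ _ → ↭-refl)) (≋-reflexive (List.map-id f)))

  sign-+ : ∀ a b → sign (a + b) ≈ᴿ sign a R.* sign b
  sign-+ zero b = R.sym (R.*-identityˡ (sign b))
  sign-+ (suc a) b = R.trans (R.-‿cong (sign-+ a b)) (-‿distribˡ-* (sign a) (sign b))

  sign-square : ∀ a → sign a R.* sign a ≈ᴿ R.1#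
  sign-square zero = R.*-identityˡ R.1#
  sign-square (suc a) = R.trans (R.sym (-‿distribˡ-* (sign a) (sign (suc a))))
    (R.trans (R.-‿cong (R.sym (-‿distribʳ-* (sign a) (sign a)))) (R.trans (-‿involutive _) (sign-square a)))

  -- Meant for `a` the crossings of a matching and `b` the inversions of the corresponding
  -- permutation, whose sum is constant.
  sign-complement : ∀ {a b t} → a + b ≡ t → sign t R.* sign a ≈ᴿ sign b
  sign-complement {a} {b} refl = R.trans (R.*-congʳ (R.trans (sign-+ a b) (R.*-comm (sign a) (sign b))))
    (R.trans (R.*-assoc (sign b) (sign a) (sign a)) (R.trans (R.*-congˡ (sign-square a)) (R.*-identityʳ (sign b))))

-- Three embeddings of variables are treated at once: the entries of a matrix as edges from rows to
-- columns, and a matrix inside one with an additional column or with an additional row and column.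
module Renaming {c ℓ} (R : CommutativeRing c ℓ) {X Y : Set}
  (_≟ˣ_ : DecidableEquality X) (_≟ʸ_ : DecidableEquality Y)
  (φ : X → Y) (φ-injective : ∀ {x x′} → φ x ≡ φ x′ → x ≡ x′)
  (φ-image? : ∀ y → Dec (∃[ x ] y ≡ φ x)) where

  module PX = Polynomials R _≟ˣ_
  module PY = Polynomials R _≟ʸ_
  module X = PolynomialProperties R _≟ˣ_
  module Y = PolynomialProperties R _≟ʸ_
  private module R = CommutativeRing R
  open R using () renaming (_≈_ to _≈ᴿ_)

  sign-agree : ∀ n → PX.sign n ≡ PY.sign n
  sign-agree zero    = refl
  sign-agree (suc n) = cong R.-_ (sign-agree n)

  rename : PX.Poly → PY.Poly
  rename = map λ (a , m) → a , map φ m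

  map-φ-cancel : ∀ {m m′} → map φ m ↭ map φ m′ → m ↭ m′
  map-φ-cancel p with ↭.↭-map-inv φ p
  ... | m″ , eq , q with List.map-injective φ-injective eq
  ...   | refl = q

  image? : ∀ (m : Monomial Y) → Any (λ y → ¬ (∃[ x ] y ≡ φ x)) m ⊎ ∃[ m′ ] m ≡ map φ m′
  image? [] = inj₂ ([] , refl)
  image? (y ∷ m) with φ-image? y | image? m
  ... | no ¬im | _ = inj₁ (here ¬im)
  ... | yes _ | inj₁ any = inj₁ (there any)
  ... | yes (x , refl) | inj₂ (m′ , refl) = inj₂ (x ∷ m′ , refl)

  image-avoids : ∀ {m m′} → Any (λ y → ¬ (∃[ x ] y ≡ φ x)) m → ¬ (map φ m′ ↭ m)
  image-avoids {m} any p with ↭.↭-map-inv φ p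
  ... | m″ , refl , _ with find any
  ...   | y , y∈ , ¬im with ∈.∈-map⁻ φ y∈
  ...     | x , _ , eq = ¬im (x , eq)

  does-map : ∀ x m → does (_↭?_ _≟ʸ_ (map φ x) (map φ m)) ≡ does (_↭?_ _≟ˣ_ x m)
  does-map x m with _↭?_ _≟ˣ_ x m
  ... | yes p = dec-true (_↭?_ _≟ʸ_ (map φ x) (map φ m)) (↭.map⁺ φ p)
  ... | no ¬p = dec-false (_↭?_ _≟ʸ_ (map φ x) (map φ m)) (¬p ∘ map-φ-cancel)

  coeff-rename : ∀ f m → PY.coeff (rename f) (map φ m) ≡ PX.coeff f m
  coeff-rename [] m = refl
  coeff-rename ((a , x) ∷ f) m rewrite does-map x m | coeff-rename f m = refl

  coeff-rename-outside : ∀ f {m} → Any (λ y → ¬ (∃[ x ] y ≡ φ x)) m → PY.coeff (rename f) m ≡ R.0#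
  coeff-rename-outside f any = Y.coeff-absent (rename f) (All.map⁺ (All.tabulate λ _ → image-avoids any))

  rename-cong : ∀ {f g} → f X.≋ g → rename f Y.≋ rename g
  rename-cong {f} {g} (X.mk≋ p) = Y.mk≋ h
    where
    h : ∀ m → PY.coeff (rename f) m ≈ᴿ PY.coeff (rename g) m
    h m with image? m
    ... | inj₁ any = R.reflexive (trans (coeff-rename-outside f any) (sym (coeff-rename-outside g any)))
    ... | inj₂ (m′ , refl) = R.trans (R.reflexive (coeff-rename f m′)) (R.trans (p m′) (R.reflexive (sym (coeff-rename g m′))))

  rename-++ : ∀ f g → rename (f ++ g) ≡ rename f ++ rename g
  rename-++ f g = List.map-++ _ f g

  rename-* : ∀ h f → rename (h PX.*ₚ f) ≡ rename h PY.*ₚ rename f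
  rename-* [] f = refl
  rename-* ((a , x) ∷ h) f = trans (rename-++ (map ((a , x) X.·_) f) (h PX.*ₚ f))
    (cong₂ _++_ (trans (sym (List.map-∘ f)) (trans (List.map-cong (λ (b , y) → cong (a R.* b ,_) (List.map-++ φ x y)) f) (List.map-∘ f)))
      (rename-* h f))

  -- The target ideal varies with `C`, and each generator is known to lie in it only from some
  -- threshold on; a derivation uses finitely many generators, so the largest threshold serves.
  ⟨⟩-rename : ∀ {p q} {G : Pred PX.Poly p} {K : ℕ → Pred PY.Poly q} →
    (∀ {g} → G g → ∃[ C₀ ] (∀ C → C₀ ≤ C → ¬ ¬ PY.⟨ K C ⟩ (rename g))) →
    ∀ {g} → PX.⟨ G ⟩ g → ∃[ C₀ ] (∀ C → C₀ ≤ C → ¬ ¬ PY.⟨ K C ⟩ (rename g))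
  ⟨⟩-rename base (PX.gen g) = base g
  ⟨⟩-rename base PX.nil = 0 , λ _ _ → return¬¬ PY.nil
  ⟨⟩-rename {K = K} base (PX.add {f} {g} d e) =
    let C₁ , h₁ = ⟨⟩-rename {K = K} base d
        C₂ , h₂ = ⟨⟩-rename {K = K} base e
    in C₁ ℕ.⊔ C₂ , λ C le →
      h₁ C (ℕ.m⊔n≤o⇒m≤o C₁ C₂ le) >>=¬¬ λ d′ → h₂ C (ℕ.m⊔n≤o⇒n≤o C₁ C₂ le) >>=¬¬ λ e′ →
      return¬¬ (subst PY.⟨ K C ⟩ (sym (rename-++ f g)) (PY.add d′ e′))
  ⟨⟩-rename {K = K} base (PX.mul h {f} d) =
    let C₁ , h₁ = ⟨⟩-rename {K = K} base d
    in C₁ , λ C le → h₁ C le >>=¬¬ λ d′ →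
      return¬¬ (subst PY.⟨ K C ⟩ (sym (rename-* h f)) (PY.mul (rename h) d′))
  ⟨⟩-rename {K = K} base (PX.≈-resp p d) =
    let C₁ , h₁ = ⟨⟩-rename {K = K} base d
    in C₁ , λ C le → h₁ C le >>=¬¬ λ d′ → return¬¬ (Y.⟨⟩-resp (rename-cong (X.mk≋ p)) d′)

  -- Lifts of generators extend to the ideal because the class `Small` of the error terms absorbs
  -- multiplication. For Pfaffians `u` is one and `Small` means having an edge inside a side; for a
  -- duplicated column `u` is one and nothing is small; for an added row and column `u` is the
  -- corner variable and `Small` means dear.
  module Lift {p q s} {G : Pred PX.Poly p} {H : Pred PY.Poly q} (u : PY.Poly)
    (Small : Pred (Monomial Y) s) (small-++ : ∀ x {y} → Small y → Small (x ++ y)) where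

    record HasLift (f : PX.Poly) : Set (c ⊔ ℓ ⊔ q ⊔ s) where
      constructor hasLift
      field
        lifted  : PY.Poly
        tail    : PY.Poly
        member  : PY.⟨ H ⟩ lifted
        agree   : lifted Y.≋ u PY.*ₚ rename f ++ tail
        small   : All (Small ∘ proj₂) tail

    lift : (∀ {f} → G f → HasLift f) → ∀ {f} → PX.⟨ G ⟩ f → HasLift f
    lift base (PX.gen g) = base g
    lift base PX.nil = hasLift [] [] PY.nil
      (Y.≋-sym (Y.≋-trans (Y.≋-reflexive (List.++-identityʳ _)) (Y.*-zeroʳ u))) []
    lift base (PX.add {f} {g} d e) with lift base d | lift base e
    ... | hasLift F t F∈ F≋ t-small | hasLift F′ t′ F′∈ F′≋ t′-small =
      hasLift (F ++ F′) (t ++ t′) (PY.add F∈ F′∈)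
        (Y.≋-trans (Y.++-cong F≋ F′≋) (Y.≋-trans (Y.↭⇒≋ shuffle)
          (Y.++-cong (Y.≋-sym (Y.≋-trans (Y.≋-reflexive (cong (u PY.*ₚ_) (rename-++ f g))) (Y.*-distribˡ u (rename f) (rename g))))
            Y.≋-refl)))
        (All.++⁺ t-small t′-small)
      where
      a = u PY.*ₚ rename f
      b = u PY.*ₚ rename g
      shuffle : (a ++ t) ++ (b ++ t′) ↭ (a ++ b) ++ (t ++ t′)
      shuffle = ↭-trans (↭-reflexive (List.++-assoc a t (b ++ t′)))
        (↭-trans (↭.++⁺ˡ a (↭.shifts t b)) (↭-reflexive (sym (List.++-assoc a b (t ++ t′)))))
    lift base (PX.mul h {f} d) with lift base d
    ... | hasLift F t F∈ F≋ t-small =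
      hasLift (rename h PY.*ₚ F) (rename h PY.*ₚ t) (PY.mul (rename h) F∈)
        (Y.≋-trans (Y.*-congˡ (rename h) F≋) (Y.≋-trans (Y.*-distribˡ (rename h) (u PY.*ₚ rename f) t)
          (Y.++-cong (Y.≋-trans (Y.*-leftCommₚ (rename h) u (rename f)) (Y.≋-reflexive (cong (u PY.*ₚ_) (sym (rename-* h f)))))
            Y.≋-refl)))
        (All.tabulate λ t∈ → case ∈.∈-cartesianProductWith⁻ Y._·_ (rename h) t t∈ of λ
          { (s , r , _ , r∈ , refl) → small-++ (proj₂ s) (All.lookup t-small r∈) })
    lift base (PX.≈-resp {f} {g} f≈g d) with lift base d
    ... | hasLift F t F∈ F≋ t-small =
      hasLift F t F∈ (Y.≋-trans F≋ (Y.++-cong (Y.*-congˡ u (rename-cong (X.mk≋ f≈g))) Y.≋-refl)) t-small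

-- Initial forms

weight-↭ : ∀ {X : Set} (v : X → ℝ) {xs ys} → xs ↭ ys → weight v xs ≤ℝ weight v ys
weight-↭ v {xs} {ys} p = total⇒weight v xs ys (proj₁ (OrderedMonoidProperties.total-↭ ℝ-orderedMonoid v p))

weight-map : ∀ {X Y : Set} (φ : X → Y) (v : Y → ℝ) (w : X → ℝ) → (∀ x → v (φ x) ≡ w x) →
             ∀ xs → weight v (map φ xs) ≡ weight w xs
weight-map φ v w h []       = refl
weight-map φ v w h (x ∷ xs) = cong₂ _+ℝ_ (h x) (weight-map φ v w h xs)

≤ℝ-subst : ∀ x x′ y y′ → x ≡ x′ → y ≡ y′ → x ≤ℝ y → x′ ≤ℝ y′
≤ℝ-subst x .x y .y refl refl h = h

module InitialForms {c ℓ} (R : CommutativeRing c ℓ) {X Y : Set}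
  (_≟ˣ_ : DecidableEquality X) (_≟ʸ_ : DecidableEquality Y)
  (φ : X → Y) (φ-injective : ∀ {x x′} → φ x ≡ φ x′ → x ≡ x′)
  (φ-image? : ∀ y → Dec (∃[ x ] y ≡ φ x))
  (w : X → ℝ) (v : ℕ → Y → ℝ) (v-φ : ∀ C x → v C (φ x) ≡ w x) where

  open Renaming R _≟ˣ_ _≟ʸ_ φ φ-injective φ-image? public
  private module R = CommutativeRing R
  open R using () renaming (_≈_ to _≈ᴿ_)

  NonImage : Monomial Y → Set
  NonImage = Any λ y → ¬ (∃[ x ] y ≡ φ x)

  -- Both halves are used: the first keeps `t` from beating a leading monomial, the second keeps `t`
  -- from being leading itself.
  Below : ℕ → Monomial Y → Monomial X → Set
  Below C t m = weight (v C) t ≤ℝ weight w m × ¬ (weight w m ≤ℝ weight (v C) t)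

  module _ (separate : ∀ t m → NonImage t → ∃[ C₀ ] (∀ C → C₀ ≤ C → Below C t m)) where

    separate-all : ∀ ts ms → All NonImage ts → ∃[ C₀ ] (∀ C → C₀ ≤ C → All (λ t → All (Below C t) ms) ts)
    separate-all [] ms [] = 0 , λ _ _ → []
    separate-all (t ∷ ts) ms (nt ∷ nts) =
      let C₁ , h₁ = one ms
          C₂ , h₂ = separate-all ts ms nts
      in C₁ ℕ.⊔ C₂ , λ C le → h₁ C (ℕ.m⊔n≤o⇒m≤o C₁ C₂ le) ∷ h₂ C (ℕ.m⊔n≤o⇒n≤o C₁ C₂ le)
      where
      one : ∀ ms → ∃[ C₀ ] (∀ C → C₀ ≤ C → All (Below C t) ms)
      one [] = 0 , λ _ _ → []
      one (m ∷ ms) =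
        let C₁ , h₁ = separate t m nt
            C₂ , h₂ = one ms
        in C₁ ℕ.⊔ C₂ , λ C le → h₁ C (ℕ.m⊔n≤o⇒m≤o C₁ C₂ le) ∷ h₂ C (ℕ.m⊔n≤o⇒n≤o C₁ C₂ le)

    module _ {f g : PX.Poly} {F tail : PY.Poly} {C : ℕ} (agree : F Y.≋ rename f ++ tail) (nonImage : All (NonImage ∘ proj₂) tail)
      (below : All (λ t → All (Below C t) (map proj₂ f)) (map proj₂ tail))
      (initial : PX.IsInitialForm w f g) (m₀ : Monomial X) (supp₀ : ¬ (PX.coeff f m₀ ≈ᴿ R.0#)) where

      private
        tail-absent : ∀ m → PY.coeff tail (map φ m) ≡ R.0#
        tail-absent m = Y.coeff-absent tail (All.map (λ ni p → image-avoids ni (↭-sym p)) nonImage)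

        coeff-F : ∀ m → PY.coeff F (map φ m) ≈ᴿ PX.coeff f m
        coeff-F m = R.trans (Y._≋_.un≋ agree (map φ m)) (R.trans (Y.coeff-++ (rename f) tail (map φ m))
          (R.trans (R.+-cong (R.reflexive (coeff-rename f m)) (R.reflexive (tail-absent m))) (R.+-identityʳ _)))

        coeff-F-outside : ∀ m → NonImage m → PY.coeff F m ≈ᴿ PY.coeff tail m
        coeff-F-outside m ni = R.trans (Y._≋_.un≋ agree m) (R.trans (Y.coeff-++ (rename f) tail m)
          (R.trans (R.+-congʳ (R.reflexive (coeff-rename-outside f ni))) (R.+-identityˡ _)))

        weight-φ : ∀ m → weight (v C) (map φ m) ≡ weight w m
        weight-φ = weight-map φ (v C) w (v-φ C)

        below-supported : ∀ n m → NonImage n → ¬ (PY.coeff F n ≈ᴿ R.0#) → ¬ (PX.coeff f m ≈ᴿ R.0#) → Below C n m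
        below-supported n m ni suppF suppf =
          by (Y.occurs tail n (λ z → suppF (R.trans (coeff-F-outside n ni) z))) (X.occurs f m suppf)
          where
          by : ∃[ t ] t ∈ tail × proj₂ t ↭ n → ∃[ s ] s ∈ f × proj₂ s ↭ m → Below C n m
          by (t , t∈ , p) (s , s∈ , q) =
            (≤ℝ-trans {weight (v C) n} {weight (v C) (proj₂ t)} {weight w m} (weight-↭ (v C) (↭-sym p))
              (≤ℝ-trans {weight (v C) (proj₂ t)} {weight w (proj₂ s)} {weight w m} (proj₁ b) (weight-↭ w q)))
            , (λ ge → proj₂ b (≤ℝ-trans {weight w (proj₂ s)} {weight w m} {weight (v C) (proj₂ t)} (weight-↭ w q)
              (≤ℝ-trans {weight w m} {weight (v C) n} {weight (v C) (proj₂ t)} ge (weight-↭ (v C) (↭-sym p)))))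
            where
            b : Below C (proj₂ t) (proj₂ s)
            b = All.lookup (All.lookup below (∈.∈-map⁺ proj₂ t∈)) (∈.∈-map⁺ proj₂ s∈)

        down : ∀ m → PY.Leading (v C) F (map φ m) → PX.Leading w f m
        down m (supp , max) = (λ z → supp (R.trans (coeff-F m) z)) , λ n supp-n →
          ≤ℝ-subst (weight (v C) (map φ n)) (weight w n) (weight (v C) (map φ m)) (weight w m) (weight-φ n) (weight-φ m)
            (max (map φ n) (λ z → supp-n (R.trans (R.sym (coeff-F n)) z)))

        up : ∀ m → PX.Leading w f m → PY.Leading (v C) F (map φ m)
        up m (supp , max) = (λ z → supp (R.trans (R.sym (coeff-F m)) z)) , λ n supp-n → by n supp-n (image? n)
          where
          by : ∀ n → PY.Support F n → NonImage n ⊎ (∃[ n′ ] n ≡ map φ n′) → weight (v C) n ≤ℝ weight (v C) (map φ m)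
          by n supp-n (inj₁ ni) = ≤ℝ-subst (weight (v C) n) (weight (v C) n) (weight w m) (weight (v C) (map φ m))
            refl (sym (weight-φ m)) (proj₁ (below-supported n m ni supp-n supp))
          by .(map φ n) supp-n (inj₂ (n , refl)) =
            ≤ℝ-subst (weight w n) (weight (v C) (map φ n)) (weight w m) (weight (v C) (map φ m))
              (sym (weight-φ n)) (sym (weight-φ m)) (max n (λ z → supp-n (R.trans (coeff-F n) z)))

      -- Every monomial of the tail lies strictly below `m₀`, hence none is leading, and the leading
      -- monomials of `F` are those of `f`. The witness `m₀` is essential: if `f` vanished, the tail
      -- would supply the initial form.
      rename-initial : PY.IsInitialForm (v C) F (rename g)
      rename-initial m = by m (image? m)
        where
        by : ∀ m → NonImage m ⊎ (∃[ m′ ] m ≡ map φ m′) →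
             (PY.Leading (v C) F m → PY.coeff (rename g) m ≈ᴿ PY.coeff F m) ×
             (¬ PY.Leading (v C) F m → PY.coeff (rename g) m ≈ᴿ R.0#)
        by m (inj₁ ni) =
          (λ (supp , max) → contradiction
            (≤ℝ-subst (weight (v C) (map φ m₀)) (weight w m₀) (weight (v C) m) (weight (v C) m) (weight-φ m₀) refl
              (max (map φ m₀) (λ z → supp₀ (R.trans (R.sym (coeff-F m₀)) z))))
            (proj₂ (below-supported m m₀ ni supp supp₀)))
          , λ _ → R.reflexive (coeff-rename-outside g ni)
        by .(map φ m) (inj₂ (m , refl)) =
          (λ lead → R.trans (R.reflexive (coeff-rename g m)) (R.trans (proj₁ (initial m) (down m lead)) (R.sym (coeff-F m))))
          , λ ¬lead → R.trans (R.reflexive (coeff-rename g m)) (proj₂ (initial m) λ lead → ¬lead (up m lead))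

    module _ {p q} (I : Pred PX.Poly p) (J : Pred PY.Poly q)
      (lift : ∀ {f} → I f → ∃₂ λ F tail → J F × F Y.≋ rename f ++ tail × All (NonImage ∘ proj₂) tail) where

      private
        InX : Pred PX.Poly _
        InX g = ∃[ f ] I f × PX.IsInitialForm w f g

        InY : ℕ → Pred PY.Poly _
        InY C g = ∃[ f ] J f × PY.IsInitialForm (v C) f g

        zero-initial : ∀ f g → PX.IsInitialForm w f g → (∀ m → PX.coeff f m ≈ᴿ R.0#) → ∀ m → R.0# ≈ᴿ PX.coeff g m
        zero-initial f g initial f≈0 m = R.sym (proj₂ (initial m) λ (supp , _) → supp (f≈0 m))

        base : ∀ g f F tail → J F → F Y.≋ rename f ++ tail → All (NonImage ∘ proj₂) tail → PX.IsInitialForm w f g →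
               ∃[ C₀ ] (∀ C → C₀ ≤ C → ¬ ¬ PY.⟨ InY C ⟩ (rename g))
        base g f F tail F∈ agree ni initial = C₀ , λ C le → X.zero-or-supported f >>=¬¬ by C le
          where
          C₀ = proj₁ (separate-all (map proj₂ tail) (map proj₂ f) (All.map⁺ ni))
          by : ∀ C → C₀ ≤ C → (∃[ m ] ¬ (PX.coeff f m ≈ᴿ R.0#)) ⊎ (∀ m → PX.coeff f m ≈ᴿ R.0#) →
               ¬ ¬ PY.⟨ InY C ⟩ (rename g)
          by C le (inj₁ (m₀ , supp₀)) = return¬¬ (PY.gen (F , F∈ , rename-initial {f} {g} {F} {tail} {C} agree ni
            (proj₂ (separate-all (map proj₂ tail) (map proj₂ f) (All.map⁺ ni)) C le) initial m₀ supp₀))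
          -- Here the initial form of `F` may come from the tail alone, but `g` vanishes and lies in
          -- every ideal.
          by C le (inj₂ f≈0) = return¬¬ (Y.⟨⟩-resp (rename-cong {[]} {g} (X.mk≋ (zero-initial f g initial f≈0))) PY.nil)

      initialIdeal-rename : ∀ {g} → PX.initialIdeal w I g →
        ∃[ C₀ ] (∀ C → C₀ ≤ C → ¬ ¬ PY.initialIdeal (v C) J (rename g))
      initialIdeal-rename = ⟨⟩-rename {G = InX} {K = InY} λ {g} (f , f∈ , initial) →
        let F , tail , F∈ , agree , ni = lift f∈ in base g f F tail F∈ agree ni initial

-- Inversions and crossings

module _ {a p} {A : Set a} {P : Pred A p} (P? : ∀ x → Dec (P x)) where

  countBy : List A → ℕ
  countBy xs = length (filter P? xs)

  countBy-++ : ∀ xs ys → countBy (xs ++ ys) ≡ countBy xs + countBy ys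
  countBy-++ xs ys = trans (cong length (List.filter-++ P? xs ys)) (List.length-++ (filter P? xs))

  countBy-↭ : ∀ {xs ys} → xs ↭ ys → countBy xs ≡ countBy ys
  countBy-↭ p = ↭.↭-length (↭.filter-↭ P? p)

countBy-cong : ∀ {a p q} {A : Set a} {P : Pred A p} {Q : Pred A q} (P? : ∀ x → Dec (P x)) (Q? : ∀ x → Dec (Q x)) →
               ∀ xs → (∀ x → P x → Q x) → (∀ x → Q x → P x) → countBy P? xs ≡ countBy Q? xs
countBy-cong P? Q? [] f g = refl
countBy-cong P? Q? (x ∷ xs) f g with P? x | Q? x
... | yes _ | yes _ = cong suc (countBy-cong P? Q? xs f g)
... | yes p | no ¬q = contradiction (f x p) ¬q
... | no ¬p | yes q = contradiction (g x q) ¬p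
... | no _  | no _  = countBy-cong P? Q? xs f g

countBy-map : ∀ {a b p} {A : Set a} {B : Set b} {P : Pred B p} (P? : ∀ x → Dec (P x)) (f : A → B) xs →
              countBy P? (map f xs) ≡ countBy (P? ∘ f) xs
countBy-map P? f [] = refl
countBy-map P? f (x ∷ xs) with P? (f x)
... | yes _ = cong suc (countBy-map P? f xs)
... | no _  = countBy-map P? f xs

countBy-none : ∀ {a p} {A : Set a} {P : Pred A p} (P? : ∀ x → Dec (P x)) xs → (∀ x → ¬ P x) → countBy P? xs ≡ 0
countBy-none P? xs h = cong length (List.filter-none P? {xs} (All.tabulate λ {x} _ → h x))

sumBy : ∀ {A : Set} → (A → ℕ) → List A → ℕ
sumBy f = foldr (λ x s → f x + s) 0

sumBy-cong : ∀ {A : Set} {f g : A → ℕ} xs → (∀ x → f x ≡ g x) → sumBy f xs ≡ sumBy g xs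
sumBy-cong [] h = refl
sumBy-cong (x ∷ xs) h = cong₂ _+_ (h x) (sumBy-cong xs h)

sumBy-map : ∀ {A B : Set} (f : B → ℕ) (g : A → B) xs → sumBy f (map g xs) ≡ sumBy (f ∘ g) xs
sumBy-map f g [] = refl
sumBy-map f g (x ∷ xs) = cong (f (g x) +_) (sumBy-map f g xs)

countBy-cartesianProduct : ∀ {p} {A B : Set} {P : Pred (A × B) p} (P? : ∀ x → Dec (P x)) xs ys →
  countBy P? (cartesianProduct xs ys) ≡ sumBy (λ x → countBy (λ y → P? (x , y)) ys) xs
countBy-cartesianProduct P? [] ys = refl
countBy-cartesianProduct P? (x ∷ xs) ys = trans (countBy-++ P? (map (x ,_) ys) (cartesianProduct xs ys))
  (cong₂ _+_ (countBy-map P? (x ,_) ys) (countBy-cartesianProduct P? xs ys))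

allFin-suc : ∀ r → allFin (suc r) ≡ zero ∷ map suc (allFin r)
allFin-suc r = cong (zero ∷_) (sym (map-allFin suc))

private
  inversion? : ∀ {r} (σ : Permutation′ r) i j → Dec (i Fin.< j × (σ ⟨$⟩ʳ j) Fin.< (σ ⟨$⟩ʳ i))
  inversion? σ i j = i Fin.<? j ×-dec (σ ⟨$⟩ʳ j) Fin.<? (σ ⟨$⟩ʳ i)

inversions-sum : ∀ {r} (σ : Permutation′ r) → inversions σ ≡ sumBy (λ i → countBy (inversion? σ i) (allFin r)) (allFin r)
inversions-sum {r} σ = countBy-cartesianProduct (λ (i , j) → inversion? σ i j) (allFin r) (allFin r)

count-permuted : ∀ {r p} {P : Pred (Fin r) p} (P? : ∀ x → Dec (P x)) (σ : Permutation′ r) →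
                 countBy (λ a → P? (σ ⟨$⟩ʳ a)) (allFin r) ≡ countBy P? (allFin r)
count-permuted {r} P? σ = trans (sym (countBy-map P? (σ ⟨$⟩ʳ_) (allFin r))) (countBy-↭ P? (map-permutation-↭ σ))

count-punchIn< : ∀ {r} (i : Fin (suc r)) → countBy (λ b → punchIn i b Fin.<? i) (allFin r) ≡ toℕ i
count-punchIn< {zero} zero = refl
count-punchIn< {suc r} zero = countBy-none (λ b → suc b Fin.<? zero {n = suc r}) (allFin (suc r)) λ _ ()
count-punchIn< {suc r} (suc i) = trans (cong (countBy (λ b → punchIn (suc i) b Fin.<? suc i)) (allFin-suc r))
  (cong suc (trans (countBy-map (λ b → punchIn (suc i) b Fin.<? suc i) suc (allFin r))
    (trans (countBy-cong (λ b → suc (punchIn i b) Fin.<? suc i) (λ b → punchIn i b Fin.<? i) (allFin r) (λ _ → ℕ.s≤s⁻¹) (λ _ → s≤s)) (count-punchIn< i))))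

countBy-complement : ∀ {a p q} {A : Set a} {P : Pred A p} {Q : Pred A q} (P? : ∀ x → Dec (P x)) (Q? : ∀ x → Dec (Q x)) →
  (∀ x → P x ⊎ Q x) → (∀ x → P x → ¬ Q x) → ∀ xs → countBy P? xs + countBy Q? xs ≡ length xs
countBy-complement P? Q? f g [] = refl
countBy-complement P? Q? f g (x ∷ xs) with P? x | Q? x
... | yes p | yes q = contradiction q (g x p)
... | yes _ | no _  = cong suc (countBy-complement P? Q? f g xs)
... | no _  | yes _ = trans (ℕ.+-suc _ _) (cong suc (countBy-complement P? Q? f g xs))
... | no ¬p | no ¬q with f x
...   | inj₁ p = contradiction p ¬p
...   | inj₂ q = contradiction q ¬q

countBy-single : ∀ {a b p q} {A : Set a} {B : Set b} {P : Pred A p} {Q : Pred B q}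
  (P? : ∀ x → Dec (P x)) (Q? : ∀ y → Dec (Q y)) x y → (P x → Q y) → (Q y → P x) →
  countBy P? (x ∷ []) ≡ countBy Q? (y ∷ [])
countBy-single P? Q? x y f g with P? x | Q? y
... | yes _ | yes _ = refl
... | yes p | no ¬q = contradiction (f p) ¬q
... | no ¬p | yes q = contradiction (g q) ¬p
... | no _  | no _  = refl

count-complement : ∀ {r} (i : Fin (suc r)) bs →
  countBy (λ b → punchIn i b Fin.<? i) bs + countBy (λ b → i Fin.<? punchIn i b) bs ≡ length bs
count-complement i = countBy-complement (λ b → punchIn i b Fin.<? i) (λ b → i Fin.<? punchIn i b)
  (λ b → either b (Fin.<-cmp i (punchIn i b))) (λ b → ℕ.<-asym)
  where
  either : ∀ b → _ → punchIn i b Fin.< i ⊎ i Fin.< punchIn i b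
  either b (tri< gt _ _) = inj₂ gt
  either b (tri≈ _ eq _) = contradiction (sym eq) (Fin.punchInᵢ≢i i b)
  either b (tri> _ _ lt) = inj₁ lt

punchIn-mono-< : ∀ {r} (i : Fin (suc r)) {a b} → a Fin.< b → punchIn i a Fin.< punchIn i b
punchIn-mono-< i {a} {b} a<b = ℕ.≰⇒> λ le → ℕ.<⇒≱ a<b (Fin.punchIn-cancel-≤ i b a le)

punchIn-cancel-< : ∀ {r} (i : Fin (suc r)) {a b} → punchIn i a Fin.< punchIn i b → a Fin.< b
punchIn-cancel-< i {a} {b} lt = ℕ.≰⇒> λ le → ℕ.<⇒≱ lt (Fin.punchIn-mono-≤ i b a le)

-- The new position zero is inverted with exactly the `toℕ i` values below `i`; all other pairs are
-- as for `σ`, because `punchIn i` is strictly increasing.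
inversions-insert : ∀ {r} (i : Fin (suc r)) (σ : Permutation′ r) →
                    inversions (Perm.insert zero i σ) ≡ toℕ i + inversions σ
inversions-insert {r} i σ = trans (inversions-sum π)
  (trans (cong (sumBy (λ a → countBy (inversion? π a) (allFin (suc r)))) (allFin-suc r))
    (cong₂ _+_ first (trans (sumBy-map _ suc (allFin r)) (trans (sumBy-cong (allFin r) rest) (sym (inversions-sum σ))))))
  where
  π = Perm.insert zero i σ
  first : countBy (inversion? π zero) (allFin (suc r)) ≡ toℕ i
  first = trans (cong (countBy (inversion? π zero)) (allFin-suc r))
    (trans (countBy-map (inversion? π zero) suc (allFin r))
      (trans (countBy-cong _ (λ a → punchIn i (σ ⟨$⟩ʳ a) Fin.<? i) (allFin r) (λ _ → proj₂) (λ _ h → s≤s z≤n , h))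
        (trans (count-permuted (λ b → punchIn i b Fin.<? i) σ) (count-punchIn< i))))
  rest : ∀ a → countBy (inversion? π (suc a)) (allFin (suc r)) ≡ countBy (inversion? σ a) (allFin r)
  rest a = trans (cong (countBy (inversion? π (suc a))) (allFin-suc r))
    (trans (countBy-map (inversion? π (suc a)) suc (allFin r))
      (countBy-cong _ (inversion? σ a) (allFin r)
        (λ b (lt , inv) → ℕ.s≤s⁻¹ lt , punchIn-cancel-< i inv)
        (λ b (lt , inv) → s≤s lt , punchIn-mono-< i inv)))

cross-sym : ∀ {n} {e f : Edge n} → Cross e f → Cross f e
cross-sym (inj₁ h) = inj₂ h
cross-sym (inj₂ h) = inj₁ h

-- `crossings` compares an edge only with later ones; symmetry of `Cross` makes the order
-- irrelevant.
crossings-↭ : ∀ {n} {E F : List (Edge n)} → E ↭ F → crossings E ≡ crossings F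
crossings-↭ ↭.refl = refl
crossings-↭ (prep e p) = cong₂ _+_ (countBy-↭ (cross? e) p) (crossings-↭ p)
crossings-↭ (swap {E} {F} e f p) = begin
  countBy (cross? e) (f ∷ E) + (countBy (cross? f) E + crossings E)
    ≡⟨ cong (_+ (countBy (cross? f) E + crossings E)) (countBy-++ (cross? e) (f ∷ []) E) ⟩
  (countBy (cross? e) (f ∷ []) + countBy (cross? e) E) + (countBy (cross? f) E + crossings E)
    ≡⟨ cong (λ x → (x + countBy (cross? e) E) + (countBy (cross? f) E + crossings E))
         (countBy-single (cross? e) (cross? f) f e (cross-sym {e = e} {f}) (cross-sym {e = f} {e})) ⟩
  (countBy (cross? f) (e ∷ []) + countBy (cross? e) E) + (countBy (cross? f) E + crossings E)
    ≡⟨ interchange (countBy (cross? f) (e ∷ [])) _ _ _ ⟩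
  (countBy (cross? f) (e ∷ []) + countBy (cross? f) E) + (countBy (cross? e) E + crossings E)
    ≡⟨ cong₂ _+_ (trans (cong (countBy (cross? f) (e ∷ []) +_) (countBy-↭ (cross? f) p)) (sym (countBy-++ (cross? f) (e ∷ []) F)))
         (cong₂ _+_ (countBy-↭ (cross? e) p) (crossings-↭ p)) ⟩
  countBy (cross? f) (e ∷ F) + (countBy (cross? e) F + crossings F) ∎
  where
  open ≡-Reasoning
  open import Algebra.Properties.CommutativeSemigroup ℕ.+-commutativeSemigroup using (interchange)
crossings-↭ (↭.trans p q) = trans (crossings-↭ p) (crossings-↭ q)

-- The binomial coefficient `r` over 2, the number of pairs of entries.
triangle : ℕ → ℕ
triangle zero    = 0
triangle (suc r) = r + triangle r

module _ {n₁ n₂ : ℕ} where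

  crossEdge : Fin n₁ × Fin n₂ → Edge (n₁ + n₂)
  crossEdge (r , c) = edge (r ↑ˡ n₂) (n₁ ↑ʳ c) (↑ˡ<↑ʳ r c)

  -- A pair of entries of a minor is either an inversion or a crossing.
  crossings+inversions : ∀ {r} (f : Fin r → Fin n₁) (g : Fin r → Fin n₂) →
    (∀ {i j} → i Fin.< j → f i Fin.< f j) → (∀ {i j} → i Fin.< j → g i Fin.< g j) →
    ∀ {σ} → σ ∈ permutations r → crossings (map crossEdge (entries f g σ)) + inversions σ ≡ triangle r
  crossings+inversions {zero} f g f< g< (here refl) = refl
  crossings+inversions {suc r} f g f< g< σ∈
    with ∈.∈-cartesianProductWith⁻ (Perm.insert zero) (allFin (suc r)) (permutations r) σ∈
  ... | i , σ , _ , σ∈′ , refl = begin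
    countBy (cross? e₀) (map crossEdge (map entry (tabulate suc))) + crossings (map crossEdge (map entry (tabulate suc))) + inversions π
      ≡⟨ cong (λ es → countBy (cross? e₀) (map crossEdge es) + crossings (map crossEdge es) + inversions π) rest ⟩
    countBy (cross? e₀) (map crossEdge (entries f′ g′ σ)) + crossings (map crossEdge (entries f′ g′ σ)) + inversions π
      ≡⟨ cong₂ (λ a b → a + crossings (map crossEdge (entries f′ g′ σ)) + b) first (inversions-insert i σ) ⟩
    above + C + (toℕ i + inversions σ)
      ≡⟨ cong (λ t → above + C + (t + inversions σ)) (count-punchIn< i) ⟨
    above + C + (below + inversions σ)
      ≡⟨ interchange above C below (inversions σ) ⟩
    (above + below) + (C + inversions σ)
      ≡⟨ cong₂ _+_ (trans (ℕ.+-comm above below) (trans (count-complement i (allFin r)) (List.length-tabulate (λ (x : Fin r) → x))))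
           (crossings+inversions f′ g′ (f< ∘ s≤s) (g< ∘ punchIn-mono-< i) σ∈′) ⟩
    r + triangle r ∎
    where
    open ≡-Reasoning
    open import Algebra.Properties.CommutativeSemigroup ℕ.+-commutativeSemigroup using (interchange)
    π = Perm.insert zero i σ
    entry : Fin (suc r) → Fin n₁ × Fin n₂
    entry a = f a , g (π ⟨$⟩ʳ a)
    e₀ = crossEdge (f zero , g i)
    f′ = f ∘ suc
    g′ = g ∘ punchIn i
    C = crossings (map crossEdge (entries f′ g′ σ))
    above = countBy (λ b → i Fin.<? punchIn i b) (allFin r)
    below = countBy (λ b → punchIn i b Fin.<? i) (allFin r)
    rest : map entry (tabulate suc) ≡ entries f′ g′ σ
    rest = trans (List.map-tabulate suc entry) (sym (map-allFin (entry ∘ suc)))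
    g-cancel : ∀ {a b} → g a Fin.< g b → a Fin.< b
    g-cancel {a} {b} lt with Fin.<-cmp a b
    ... | tri< a<b _ _ = a<b
    ... | tri≈ _ refl _ = contradiction lt (Fin.<-irrefl refl)
    ... | tri> _ _ b<a = contradiction lt (ℕ.<-asym (g< b<a))
    first : countBy (cross? e₀) (map crossEdge (entries f′ g′ σ)) ≡ above
    first = trans (countBy-map (cross? e₀) crossEdge (entries f′ g′ σ))
      (trans (countBy-map (cross? e₀ ∘ crossEdge) (λ a → f′ a , g′ (σ ⟨$⟩ʳ a)) (allFin r))
        (trans (countBy-cong _ (λ a → i Fin.<? punchIn i (σ ⟨$⟩ʳ a)) (allFin r) to from)
          (count-permuted (λ b → i Fin.<? punchIn i b) σ)))
      where
      raise-< : ∀ {x y : Fin n₂} → x Fin.< y → n₁ ↑ʳ x Fin.< n₁ ↑ʳ y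
      raise-< {x} {y} lt = subst₂ _<_ (sym (Fin.toℕ-↑ʳ n₁ x)) (sym (Fin.toℕ-↑ʳ n₁ y)) (ℕ.+-monoʳ-< n₁ lt)
      raise-cancel : ∀ {x y : Fin n₂} → n₁ ↑ʳ x Fin.< n₁ ↑ʳ y → x Fin.< y
      raise-cancel {x} {y} lt = ℕ.+-cancelˡ-< n₁ _ _ (subst₂ _<_ (Fin.toℕ-↑ʳ n₁ x) (Fin.toℕ-↑ʳ n₁ y) lt)
      inject-< : ∀ {x y : Fin n₁} → x Fin.< y → x ↑ˡ n₂ Fin.< y ↑ˡ n₂
      inject-< {x} {y} lt = subst₂ _<_ (sym (Fin.toℕ-↑ˡ x n₂)) (sym (Fin.toℕ-↑ˡ y n₂)) lt
      to : ∀ a → Cross e₀ (crossEdge (f′ a , g′ (σ ⟨$⟩ʳ a))) → i Fin.< punchIn i (σ ⟨$⟩ʳ a)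
      to a (inj₁ (_ , _ , lt)) = g-cancel (raise-cancel lt)
      to a (inj₂ (lt , _ , _)) = contradiction (inject-< (f< (s≤s z≤n))) (ℕ.<-asym lt)
      from : ∀ a → i Fin.< punchIn i (σ ⟨$⟩ʳ a) → Cross e₀ (crossEdge (f′ a , g′ (σ ⟨$⟩ʳ a)))
      from a lt = inj₁ (inject-< (f< (s≤s z≤n)) , ↑ˡ<↑ʳ _ _ , raise-< (g< lt))

permutations-complete : ∀ {r} (σ : Permutation′ r) → ∃[ π ] π ∈ permutations r × π Perm.≈ σ
permutations-complete {zero} σ = Perm.id , here refl , λ ()
permutations-complete {suc r} σ =
  let π , π∈ , π≈ = permutations-complete (Perm.remove zero σ)
  in Perm.insert zero (σ ⟨$⟩ʳ zero) π
     , ∈.∈-cartesianProductWith⁺ (Perm.insert zero) (∈.∈-allFin (σ ⟨$⟩ʳ zero)) π∈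
     , λ { zero → refl
         ; (suc a) → trans (cong (punchIn (σ ⟨$⟩ʳ zero)) (π≈ a)) (sym (Perm.punchIn-permute σ zero a)) }

cartesianProductWith-distinct : ∀ {A B C : Set} {R : C → C → Set} (f : A → B → C) {S : B → B → Set} →
  (∀ {a a′} b b′ → a ≢ a′ → R (f a b) (f a′ b′)) → (∀ a {b b′} → S b b′ → R (f a b) (f a b′)) →
  ∀ {xs ys} → Unique xs → AllPairs S ys → AllPairs R (cartesianProductWith f xs ys)
cartesianProductWith-distinct f h k {[]} [] s = []
cartesianProductWith-distinct f h k {x ∷ xs} {ys} (x# ∷ u) s = AllPairs.++⁺
  (AllPairs.map⁺ (AllPairs.map (k x) s)) (cartesianProductWith-distinct f h k u s)
  (All.map⁺ (All.tabulate λ {b} _ → All.tabulate λ z∈ → case ∈.∈-cartesianProductWith⁻ f xs ys z∈ of λ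
    { (a′ , b′ , a′∈ , _ , refl) → h b b′ (All.lookup x# a′∈) }))

permutations-distinct : ∀ r → AllPairs (λ σ τ → ¬ (σ Perm.≈ τ)) (permutations r)
permutations-distinct zero = [] ∷ []
permutations-distinct (suc r) = cartesianProductWith-distinct (Perm.insert zero)
  (λ _ _ ne eq → ne (eq zero))
  (λ i ¬eq eq → ¬eq λ a → Fin.punchIn-injective i _ _ (eq (suc a)))
  (Unique.allFin⁺ (suc r)) (permutations-distinct r)

-- Minors as parts of Pfaffians

module _ {n₁ n₂ : ℕ} where

  private
    rowPart : Fin (n₁ + n₂) → Maybe (Fin n₁)
    rowPart i = [ just , (λ _ → nothing) ]′ (Fin.splitAt n₁ i)

    columnPart : Fin (n₁ + n₂) → Maybe (Fin n₂)
    columnPart i = [ (λ _ → nothing) , just ]′ (Fin.splitAt n₁ i)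

    rowParts : ∀ rs cs → mapMaybe rowPart (map (_↑ˡ n₂) rs ++ map (n₁ ↑ʳ_) cs) ≡ rs
    rowParts [] [] = refl
    rowParts [] (c ∷ cs) rewrite Fin.splitAt-↑ʳ n₁ n₂ c = rowParts [] cs
    rowParts (r ∷ rs) cs rewrite Fin.splitAt-↑ˡ n₁ r n₂ = cong (r ∷_) (rowParts rs cs)

    columnParts : ∀ rs cs → mapMaybe columnPart (map (_↑ˡ n₂) rs ++ map (n₁ ↑ʳ_) cs) ≡ cs
    columnParts [] [] = refl
    columnParts [] (c ∷ cs) rewrite Fin.splitAt-↑ʳ n₁ n₂ c = cong (c ∷_) (columnParts [] cs)
    columnParts (r ∷ rs) cs rewrite Fin.splitAt-↑ˡ n₁ r n₂ = columnParts rs cs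

  -- Discarding the vertices of the other side with `mapMaybe` respects `_↭_` and undoes the
  -- concatenation.
  split-rows : ∀ rs rs′ {cs cs′} → map (_↑ˡ n₂) rs ++ map (n₁ ↑ʳ_) cs ↭ map (_↑ˡ n₂) rs′ ++ map (n₁ ↑ʳ_) cs′ → rs ↭ rs′
  split-rows rs rs′ {cs} {cs′} p = subst₂ _↭_ (rowParts rs cs) (rowParts rs′ cs′) (↭.mapMaybe-↭ rowPart p)

  split-columns : ∀ rs rs′ {cs cs′} → map (_↑ˡ n₂) rs ++ map (n₁ ↑ʳ_) cs ↭ map (_↑ˡ n₂) rs′ ++ map (n₁ ↑ʳ_) cs′ → cs ↭ cs′
  split-columns rs rs′ {cs} {cs′} p = subst₂ _↭_ (columnParts rs cs) (columnParts rs′ cs′) (↭.mapMaybe-↭ columnPart p)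

  ends-crossEdge : ∀ P → ends (map crossEdge P) ↭ map (_↑ˡ n₂) (map proj₁ P) ++ map (n₁ ↑ʳ_) (map proj₂ P)
  ends-crossEdge [] = ↭-refl
  ends-crossEdge ((r , c) ∷ P) = prep _ (↭-trans (prep _ (ends-crossEdge P))
    (↭-sym (↭.shift (n₁ ↑ʳ c) (map (_↑ˡ n₂) (map proj₁ P)) _)))

  crossEdge-injective : ∀ {x y : Fin n₁ × Fin n₂} → crossEdge x ≡ crossEdge y → x ≡ y
  crossEdge-injective eq = cong₂ _,_ (Fin.↑ˡ-injective n₂ _ _ (cong lo eq)) (Fin.↑ʳ-injective n₁ _ _ (cong hi eq))

  crossEdge-image? : ∀ (e : Edge (n₁ + n₂)) → Dec (∃ λ (x : Fin n₁ × Fin n₂) → e ≡ crossEdge x)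
  crossEdge-image? e@(edge i j _) = by (Fin.splitAt n₁ i) (Fin.splitAt n₁ j) refl refl
    where
    by : ∀ a b → Fin.splitAt n₁ i ≡ a → Fin.splitAt n₁ j ≡ b → Dec (∃ λ (x : Fin n₁ × Fin n₂) → e ≡ crossEdge x)
    by (inj₁ r) (inj₂ c) p q with refl ← Fin.splitAt⁻¹-↑ˡ p | refl ← Fin.splitAt⁻¹-↑ʳ {m = n₁} q = yes ((r , c) , refl)
    by (inj₂ c) b p q = no λ { ((r′ , c′) , refl) →
      contradiction (trans (sym p) (Fin.splitAt-↑ˡ n₁ r′ n₂)) λ () }
    by (inj₁ _) (inj₁ r) p q = no λ { ((r′ , c′) , refl) →
      contradiction (trans (sym q) (Fin.splitAt-↑ʳ n₁ n₂ c′)) λ () }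

module PfaffianLift {c ℓ} (R : CommutativeRing c ℓ) (k n₁ n₂ : ℕ) where
  private module R = CommutativeRing R
  open R using () renaming (_≈_ to _≈ᴿ_)
  open Renaming R (≡-dec (Fin._≟_ {n₁}) (Fin._≟_ {n₂})) (_≟ᴱ_ {n₁ + n₂})
    (crossEdge {n₁} {n₂}) (crossEdge-injective {n₁} {n₂}) (crossEdge-image? {n₁} {n₂})
  module Det = DeterminantalIdeal R n₁ n₂
  module Pfa = PfaffianIdeal R k (n₁ + n₂)

  NonCrossing : Monomial (Edge (n₁ + n₂)) → Set
  NonCrossing = Any λ e → ¬ (∃ λ (x : Fin n₁ × Fin n₂) → e ≡ crossEdge x)

  module _ (ρ : Selection (suc k) n₁) (γ : Selection (suc k) n₂) where

    private
      r = suc k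
      rs = map (pick ρ) (allFin r)
      cs = map (pick γ) (allFin r)
      xs = map (_↑ˡ n₂) rs ++ map (n₁ ↑ʳ_) cs
      pos = positions ρ γ
      -- Crossings and inversions add up to `triangle r`, so this factor turns the signs of the
      -- Pfaffian into those of the minor.
      sT = PY.sign (triangle r)

      xs-unique : Unique xs
      xs-unique = Unique.++⁺
        (Unique.map⁺ (Fin.↑ˡ-injective n₂ _ _) (Unique.map⁺ (pick-injective ρ) (Unique.allFin⁺ r)))
        (Unique.map⁺ (Fin.↑ʳ-injective n₁ _ _) (Unique.map⁺ (pick-injective γ) (Unique.allFin⁺ r)))
        λ (p , q) → disjoint (∈.∈-map⁻ (_↑ˡ n₂) p) (∈.∈-map⁻ (n₁ ↑ʳ_) q)
        where
        disjoint : ∀ {i} → (∃[ x ] x ∈ rs × i ≡ x ↑ˡ n₂) → (∃[ y ] y ∈ cs × i ≡ n₁ ↑ʳ y) → ⊥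
        disjoint (x , _ , p) (y , _ , q) =
          Fin.<⇒≢ (↑ˡ<↑ʳ x y) (trans (sym p) q)

    vertices : Subset (n₁ + n₂)
    vertices = range xs

    vertices-enumerated : Enumerates vertices xs
    vertices-enumerated = range-enumerates xs-unique

    vertices-size : ∣ vertices ∣ ≡ 2 * k + 2
    vertices-size = trans (sym (enumeration-length vertices-enumerated))
      (trans (List.length-++ (map (_↑ˡ n₂) rs))
        (trans (cong₂ _+_ (len (_↑ˡ n₂) (pick ρ)) (len (n₁ ↑ʳ_) (pick γ)))
          (trans (ℕ.+-suc (suc k) k) (trans (cong (λ t → suc (suc (k + t))) (sym (ℕ.+-identityʳ k))) (ℕ.+-comm 2 (2 * k))))))
      where
      len : ∀ {A B : Set} (g : A → B) (f : Fin r → A) → length (map g (map f (allFin r))) ≡ r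
      len g f = trans (List.length-map g (map f (allFin r)))
        (trans (List.length-map f (allFin r)) (List.length-tabulate {n = r} (λ i → i)))

    private
      U = vertices

      term : List (Edge (n₁ + n₂)) → Y.Term
      term E = sT R.* PY.sign (crossings E) , E

      F = map term (perfectMatchings U)

      nonCrossing? : ∀ (t : Y.Term) → Dec (NonCrossing (proj₂ t))
      nonCrossing? t = Any.any? (λ e → ¬? (crossEdge-image? e)) (proj₂ t)

      tail = filter nonCrossing? F
      rest = filter (¬? ∘ nonCrossing?) F

      F-split : ∀ m → PY.coeff F m ≈ᴿ PY.coeff tail m R.+ PY.coeff rest m
      F-split m = R.trans (Y._≋_.un≋ (Y.↭⇒≋ (filter-split nonCrossing? F)) m) (Y.coeff-++ tail rest m)

      F-distinct : AllPairs (λ s t → ¬ (proj₂ s ↭ proj₂ t)) F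
      F-distinct = AllPairs.map⁺ (perfectMatchings-distinct U)

      ends-pos : ∀ σ → ends (map crossEdge (pos σ)) ↭ xs
      ends-pos σ = ↭-trans (ends-crossEdge (pos σ)) (↭.++⁺
        (↭-reflexive (cong (map (_↑ˡ n₂)) (entries-rows (pick ρ) (pick γ) σ)))
        (↭.map⁺ (n₁ ↑ʳ_) (entries-columns (pick ρ) (pick γ) σ)))

      minor-distinct : AllPairs (λ s t → ¬ (proj₂ s ↭ proj₂ t)) (Det.minor ρ γ)
      minor-distinct = AllPairs.map⁺ (AllPairs.map
        (λ {σ} {τ} ≉ p → ≉ (entries-distinct (pick ρ) (pick γ) (pick-injective ρ) (pick-injective γ) σ τ p))
        (permutations-distinct r))

      coeff-matching : ∀ σ m → σ ∈ permutations r → pos σ ↭ m → PY.coeff F (map crossEdge m) ≈ᴿ PX.coeff (Det.minor ρ γ) m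
      coeff-matching σ m σ∈ p =
        let E , E∈ , q = ∈-perfectMatchings⁺ (map crossEdge (pos σ)) (enumerates-↭ (↭-sym (ends-pos σ)) vertices-enumerated)
        in R.trans (Y.coeff-unique F-distinct (∈.∈-map⁺ term E∈) (↭-trans q (↭.map⁺ crossEdge p)))
             (R.trans (Y.sign-complement {crossings E} {inversions σ} (trans (cong (_+ inversions σ) (crossings-↭ q))
                 (crossings+inversions (pick ρ) (pick γ) (increasing ρ) (increasing γ) σ∈)))
               (R.trans (R.reflexive (sym (sign-agree (inversions σ))))
                 (R.sym (X.coeff-unique minor-distinct (∈.∈-map⁺ (λ σ → PX.sign (inversions σ) , pos σ) σ∈) p))))

      -- A perfect matching all of whose edges join rows to columns is a bijection, hence the entry
      -- list of a permutation. If no permutation gives `m`, both coefficients vanish.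
      coeff-no-matching : ∀ m → ¬ Any (λ σ → pos σ ↭ m) (permutations r) →
                          PY.coeff F (map crossEdge m) ≈ᴿ PX.coeff (Det.minor ρ γ) m
      coeff-no-matching m none = R.reflexive (trans
        (Y.coeff-absent F (All.map⁺ (All.tabulate λ {E} E∈ p → absurd E E∈ p)))
        (sym (X.coeff-absent (Det.minor ρ γ) (All.map⁺ (All.¬Any⇒All¬ (permutations r) none)))))
        where
        absurd : ∀ E → E ∈ perfectMatchings U → E ↭ map crossEdge m → ⊥
        absurd E E∈ p = none (lose π∈ (↭-trans same (↭-sym (proj₂ found))))
          where
          q : map (_↑ˡ n₂) (map proj₁ m) ++ map (n₁ ↑ʳ_) (map proj₂ m) ↭ xs
          q = ↭-trans (↭-sym (ends-crossEdge m)) (↭-trans (ends-↭ (↭-sym p))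
                (enumerations-↭ (∈-perfectMatchings⁻ {U = U} E∈) vertices-enumerated))
          found : Σ (Permutation′ r) λ σ → m ↭ entries (pick ρ) (pick γ) σ
          found = entries-complete (pick ρ) (pick γ) m
            (split-rows (map proj₁ m) rs {map proj₂ m} {cs} q) (split-columns (map proj₁ m) rs {map proj₂ m} {cs} q)
          σ = proj₁ found
          π = proj₁ (permutations-complete σ)
          π∈ : π ∈ permutations r
          π∈ = proj₁ (proj₂ (permutations-complete σ))
          same : pos π ↭ entries (pick ρ) (pick γ) σ
          same = ↭-reflexive (List.map-cong
            (λ i → cong (λ j → pick ρ i , pick γ j) (proj₂ (proj₂ (permutations-complete σ)) i)) (allFin r))

      agree : F Y.≋ rename (Det.minor ρ γ) ++ tail
      agree = Y.mk≋ λ m → by m (image? m)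
        where
        by : ∀ m → NonCrossing m ⊎ (∃[ m′ ] m ≡ map crossEdge m′) →
             PY.coeff F m ≈ᴿ PY.coeff (rename (Det.minor ρ γ) ++ tail) m
        by m (inj₁ ni) = R.trans (F-split m) (R.trans
          (R.+-congˡ (R.reflexive (Y.coeff-absent rest (All.map (λ ¬ni p → ¬ni (↭.Any-resp-↭ (↭-sym p) ni)) (All.all-filter (¬? ∘ nonCrossing?) F)))))
          (R.trans (R.+-comm _ _) (R.sym (R.trans (Y.coeff-++ (rename (Det.minor ρ γ)) tail m)
            (R.+-congʳ (R.reflexive (coeff-rename-outside (Det.minor ρ γ) ni)))))))
        by .(map crossEdge m) (inj₂ (m , refl)) =
          R.trans (main (Any.any? (λ σ → _↭?_ (≡-dec Fin._≟_ Fin._≟_) (pos σ) m) (permutations r)))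
            (R.sym (R.trans (Y.coeff-++ (rename (Det.minor ρ γ)) tail (map crossEdge m))
              (R.trans (R.+-cong (R.reflexive (coeff-rename (Det.minor ρ γ) m))
                (R.reflexive (Y.coeff-absent tail (All.map (λ ni p → image-avoids ni (↭-sym p)) (All.all-filter nonCrossing? F)))))
                (R.+-identityʳ _))))
          where
          main : Dec (Any (λ σ → pos σ ↭ m) (permutations r)) → PY.coeff F (map crossEdge m) ≈ᴿ PX.coeff (Det.minor ρ γ) m
          main (yes any) = let σ , σ∈ , p = find any in coeff-matching σ m σ∈ p
          main (no none) = coeff-no-matching m none

    F-scaled : ((sT , []) ∷ []) PY.*ₚ Pfa.pfaffian U ≡ F
    F-scaled = trans (Y.scale sT [] (Pfa.pfaffian U)) (sym (List.map-∘ (perfectMatchings U)))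

    pfaffian-lift : ∃₂ λ F tail → Pfa.I F × F Y.≋ rename (Det.minor ρ γ) ++ tail × All (NonCrossing ∘ proj₂) tail
    pfaffian-lift = F , tail
      , subst Pfa.I F-scaled (PY.mul ((sT , []) ∷ []) (PY.gen (U , vertices-size , refl)))
      , agree , All.all-filter nonCrossing? F

  minors-lift : ∀ {f} → Det.Minors (suc k) f →
    ∃₂ λ F tail → Pfa.I F × F Y.≋ rename f ++ tail × All (NonCrossing ∘ proj₂) tail
  minors-lift f∈ = strip (L.lift base f∈)
    where
    unit : PY.Poly
    unit = (R.1# , []) ∷ []
    IsMinor : Pred PX.Poly c
    IsMinor f = ∃₂ λ (ρ : Selection (suc k) n₁) (γ : Selection (suc k) n₂) → f ≡ Det.minor ρ γ
    IsPfaffian : Pred PY.Poly c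
    IsPfaffian f = ∃[ U ] (∣ U ∣ ≡ 2 * k + 2 × f ≡ Pfa.pfaffian U)
    appendˡ : ∀ x {y} → NonCrossing y → NonCrossing (x ++ y)
    appendˡ x = Any.++⁺ʳ x
    module L = Lift {G = IsMinor} {H = IsPfaffian} unit NonCrossing appendˡ
    base : ∀ {f} → IsMinor f → L.HasLift f
    base (ρ , γ , refl) = let F , tail , F∈ , ag , small = pfaffian-lift ρ γ in
      L.hasLift F tail F∈ (Y.≋-trans ag (Y.++-cong (Y.≋-sym (Y.one-* (rename (Det.minor ρ γ)))) Y.≋-refl)) small
    strip : ∀ {f} → L.HasLift f → ∃₂ λ F tail → Pfa.I F × F Y.≋ rename f ++ tail × All (NonCrossing ∘ proj₂) tail
    strip {f} (L.hasLift F tail F∈ ag small) =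
      F , tail , F∈ , Y.≋-trans ag (Y.++-cong (Y.one-* (rename f)) Y.≋-refl) , small

-- Separation by a large constant, and the first half of the theorem

private
  -ι+ι : ∀ a b → -ℝ ι (a + b) +ℝ ι a ≤ℝ -ℝ ι b
  -ι+ι a b = ≗⇒≤ℝ { -ℝ ι (a + b) +ℝ ι a} { -ℝ ι b} λ _ →
    trans (cong (λ t → ℚ.- t ℚ.+ ιℚ a) (ιℚ-+ a b))
      (solve 2 (λ a b → ((⊝ (a ⊕ b)) ⊕ a) ⊜ (⊝ b)) refl (ιℚ a) (ιℚ b))
    where open ℚS

  ι-sum : ∀ a b → ι a +ℝ ι b ≤ℝ ι (a + b)
  ι-sum a b = ≗⇒≤ℝ {ι a +ℝ ι b} {ι (a + b)} λ _ → sym (ιℚ-+ a b)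

  -ι-sum : ∀ a b → -ℝ ι (a + b) ≤ℝ -ℝ ι a +ℝ -ℝ ι b
  -ι-sum a b = ≗⇒≤ℝ { -ℝ ι (a + b)} { -ℝ ι a +ℝ -ℝ ι b} λ _ →
    trans (cong ℚ.-_ (ιℚ-+ a b)) (solve 2 (λ a b → (⊝ (a ⊕ b)) ⊜ ((⊝ a) ⊕ (⊝ b))) refl (ιℚ a) (ιℚ b))
    where open ℚS

  low-head : ∀ C a b → (-ℝ ι C +ℝ ι a) +ℝ ι b ≤ℝ -ℝ ι C +ℝ ι (a + b)
  low-head C a b = ≗⇒≤ℝ {(-ℝ ι C +ℝ ι a) +ℝ ι b} { -ℝ ι C +ℝ ι (a + b)} λ _ →
    trans (ℚ.+-assoc (ℚ.- ιℚ C) (ιℚ a) (ιℚ b)) (cong (ℚ.- ιℚ C ℚ.+_) (sym (ιℚ-+ a b)))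

  low-tail : ∀ C a b → ι a +ℝ (-ℝ ι C +ℝ ι b) ≤ℝ -ℝ ι C +ℝ ι (a + b)
  low-tail C a b = ≗⇒≤ℝ {ι a +ℝ (-ℝ ι C +ℝ ι b)} { -ℝ ι C +ℝ ι (a + b)} λ _ →
    trans (solve 3 (λ c a b → (a ⊕ ((⊝ c) ⊕ b)) ⊜ ((⊝ c) ⊕ (a ⊕ b))) refl (ιℚ C) (ιℚ a) (ιℚ b))
      (cong (ℚ.- ιℚ C ℚ.+_) (sym (ιℚ-+ a b)))
    where open ℚS

module WeightBounds {X : Set} (v : X → ℝ) (N : ℕ) where

  weight-≤ : (∀ x → v x ≤ℝ ι N) → ∀ xs → weight v xs ≤ℝ ι (length xs * N)
  weight-≤ h []       = ≤ℝ-refl {0ℝ}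
  weight-≤ h (x ∷ xs) = ≤ℝ-trans {v x +ℝ weight v xs} {ι N +ℝ ι (length xs * N)} {ι (N + length xs * N)}
    (+ℝ-mono-≤ {v x} {ι N} {weight v xs} {ι (length xs * N)} (h x) (weight-≤ h xs)) (ι-sum N (length xs * N))

  weight-≥ : (∀ x → -ℝ ι N ≤ℝ v x) → ∀ xs → -ℝ ι (length xs * N) ≤ℝ weight v xs
  weight-≥ h []       = ≗⇒≤ℝ { -ℝ ι 0} {0ℝ} λ _ → refl
  weight-≥ h (x ∷ xs) = ≤ℝ-trans { -ℝ ι (N + length xs * N)} { -ℝ ι N +ℝ -ℝ ι (length xs * N)} {v x +ℝ weight v xs}
    (-ι-sum N (length xs * N))
    (+ℝ-mono-≤ { -ℝ ι N} {v x} { -ℝ ι (length xs * N)} {weight v xs} (h x) (weight-≥ h xs))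

  weight-low : ∀ C → (∀ x → v x ≤ℝ ι N) → ∀ xs → Any (λ x → v x ≤ℝ -ℝ ι C +ℝ ι N) xs →
               weight v xs ≤ℝ -ℝ ι C +ℝ ι (length xs * N)
  weight-low C h (x ∷ xs) (here low) =
    ≤ℝ-trans {v x +ℝ weight v xs} {(-ℝ ι C +ℝ ι N) +ℝ ι (length xs * N)} { -ℝ ι C +ℝ ι (N + length xs * N)}
      (+ℝ-mono-≤ {v x} { -ℝ ι C +ℝ ι N} {weight v xs} {ι (length xs * N)} low (weight-≤ h xs))
      (low-head C N (length xs * N))
  weight-low C h (x ∷ xs) (there any) =
    ≤ℝ-trans {v x +ℝ weight v xs} {ι N +ℝ (-ℝ ι C +ℝ ι (length xs * N))} { -ℝ ι C +ℝ ι (N + length xs * N)}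
      (+ℝ-mono-≤ {v x} {ι N} {weight v xs} { -ℝ ι C +ℝ ι (length xs * N)} (h x) (weight-low C h xs any))
      (low-tail C N (length xs * N))

bound-all : ∀ {X : Set} (M : X → ℝ) xs → ∃[ N ] (∀ {x} → x ∈ xs → M x ≤ℝ ι N × -ℝ ι N ≤ℝ M x)
bound-all M [] = 0 , λ ()
bound-all M (x ∷ xs) =
  let N₁ , le₁ , ge₁ = bound (M x)
      N₂ , h = bound-all M xs
  in N₁ ℕ.⊔ N₂ , λ where
    (here refl) → ≤ℝ-trans {M x} {ι N₁} {ι (N₁ ℕ.⊔ N₂)} le₁ (ι-mono (ℕ.m≤m⊔n N₁ N₂))
                , ≤ℝ-trans { -ℝ ι (N₁ ℕ.⊔ N₂)} { -ℝ ι N₁} {M x} (-ℝ-antimono {ι N₁} {ι (N₁ ℕ.⊔ N₂)} (ι-mono (ℕ.m≤m⊔n N₁ N₂))) ge₁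
    (there {y} y∈) → ≤ℝ-trans {M _} {ι N₂} {ι (N₁ ℕ.⊔ N₂)} (proj₁ (h y∈)) (ι-mono (ℕ.m≤n⊔m N₁ N₂))
                   , ≤ℝ-trans { -ℝ ι (N₁ ℕ.⊔ N₂)} { -ℝ ι N₂} {M _} (-ℝ-antimono {ι N₂} {ι (N₁ ℕ.⊔ N₂)} (ι-mono (ℕ.m≤n⊔m N₁ N₂))) (proj₂ (h y∈))

module _ {a b : ℕ} (M : Matrix (suc a) (suc b)) (N : ℕ)
  (M≤ : ∀ x → M x ≤ℝ ι N) (≤M : ∀ x → -ℝ ι N ≤ℝ M x) where

  private
    off-bound : ∀ C i x → offset N C i ⊹ M x ≤ℝ -ℝ ι C +ℝ ι N
    off-bound C i x = ≤ℝ-trans {offset N C i ⊹ M x} { -ℝ ι C +ℝ M x} { -ℝ ι C +ℝ ι N}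
      (≤ℝ-subst (offset N C i +ℝ M x) (offset N C i ⊹ M x) (-ℝ ι C +ℝ M x) (-ℝ ι C +ℝ M x)
        (sym (⊹≡+ℝ (offset N C i) (M x))) refl (offset-low M N M≤ ≤M C i x x))
      (+ℝ-mono-≤ { -ℝ ι C} { -ℝ ι C} {M x} {ι N} (≤ℝ-refl { -ℝ ι C}) (M≤ x))

    low-bound : ∀ C → -ℝ ι C +ℝ ι N ≤ℝ ι N
    low-bound C = ≤ℝ-trans { -ℝ ι C +ℝ ι N} { -ℝ ι 0 +ℝ ι N} {ι N}
      (+ℝ-mono-≤ { -ℝ ι C} { -ℝ ι 0} {ι N} {ι N} (-ℝ-antimono {ι 0} {ι C} (ι-mono {0} {C} z≤n)) (≤ℝ-refl {ι N}))
      (≗⇒≤ℝ { -ℝ ι 0 +ℝ ι N} {ι N} λ _ → ℚ.+-identityˡ (ιℚ N))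

    v-upper : ∀ C e → liftedWeight M (offset N C) e ≤ℝ ι N
    v-upper C e = by (LiftedWeight.v-cases ℝ-orderedMonoid M (offset N C) e)
      where
      by : LiftedWeight.Cases ℝ-orderedMonoid M (offset N C) e → liftedWeight M (offset N C) e ≤ℝ ι N
      by (inj₁ (x , _ , eq)) = ≤ℝ-subst (M x) (liftedWeight M (offset N C) e) (ι N) (ι N) (sym eq) refl (M≤ x)
      by (inj₂ (i , x , eq)) = ≤ℝ-subst (offset N C i ⊹ M x) (liftedWeight M (offset N C) e) (ι N) (ι N) (sym eq) refl
            (≤ℝ-trans {offset N C i ⊹ M x} { -ℝ ι C +ℝ ι N} {ι N} (off-bound C i x) (low-bound C))

    v-low : ∀ C e → ¬ (∃ λ (x : Fin (suc a) × Fin (suc b)) → e ≡ crossEdge x) → liftedWeight M (offset N C) e ≤ℝ -ℝ ι C +ℝ ι N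
    v-low C e ¬cross = by (LiftedWeight.v-cases ℝ-orderedMonoid M (offset N C) e)
      where
      by : LiftedWeight.Cases ℝ-orderedMonoid M (offset N C) e → liftedWeight M (offset N C) e ≤ℝ -ℝ ι C +ℝ ι N
      by (inj₁ (x , eq , _)) = contradiction (x , eq) ¬cross
      by (inj₂ (i , x , eq)) = ≤ℝ-subst (offset N C i ⊹ M x) (liftedWeight M (offset N C) e) (-ℝ ι C +ℝ ι N) (-ℝ ι C +ℝ ι N) (sym eq) refl (off-bound C i x)

    v-cross : ∀ C x → liftedWeight M (offset N C) (crossEdge x) ≡ M x
    v-cross C (r , c) = LiftedWeight.v-entry ℝ-orderedMonoid M (offset N C) r c

  module _ {c ℓ} (R : CommutativeRing c ℓ) (k : ℕ) where
    private module R = CommutativeRing R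
    open PfaffianLift R k (suc a) (suc b) using (minors-lift; module Det; module Pfa)
    open InitialForms R (≡-dec Fin._≟_ Fin._≟_) _≟ᴱ_
      (crossEdge {suc a} {suc b}) (crossEdge-injective {suc a} {suc b}) (crossEdge-image? {suc a} {suc b})
      M (λ C → liftedWeight M (offset N C)) v-cross

    private
      -- One factor of `t` weighs at most `-C + N` and the others at most `N` each, while `m` weighs
      -- at least `-lm`. From the threshold on, `t` weighs at most `-(lm + 1)`; the extra one makes
      -- the comparison strict.
      separate : ∀ t m → NonImage t → ∃[ C₀ ] (∀ C → C₀ ≤ C → Below C t m)
      separate t m ni = lt + suc lm , λ C C₀≤C → le C C₀≤C , λ ge →
        fromℚ-<⇒≰ {ℚ.- ιℚ (suc lm)} {ℚ.- ιℚ lm} (ℚ.neg-antimono-< (ιℚ-mono-< (ℕ.n<1+n lm)))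
          (≤ℝ-trans {fromℚ (ℚ.- ιℚ lm)} { -ℝ ι lm} {fromℚ (ℚ.- ιℚ (suc lm))}
            (≗⇒≤ℝ {fromℚ (ℚ.- ιℚ lm)} { -ℝ ι lm} λ _ → refl)
            (≤ℝ-trans { -ℝ ι lm} {weight M m} {fromℚ (ℚ.- ιℚ (suc lm))} m≥
              (≤ℝ-trans {weight M m} {weight (liftedWeight M (offset N C)) t} {fromℚ (ℚ.- ιℚ (suc lm))} ge
                (≤ℝ-trans {weight (liftedWeight M (offset N C)) t} { -ℝ ι (suc lm)} {fromℚ (ℚ.- ιℚ (suc lm))} (low C C₀≤C)
                  (≗⇒≤ℝ { -ℝ ι (suc lm)} {fromℚ (ℚ.- ιℚ (suc lm))} λ _ → refl)))))
        where
        lt = length t * N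
        lm = length m * N
        m≥ : -ℝ ι lm ≤ℝ weight M m
        m≥ = WeightBounds.weight-≥ M N ≤M m
        low : ∀ C → lt + suc lm ≤ C → weight (liftedWeight M (offset N C)) t ≤ℝ -ℝ ι (suc lm)
        low C C₀≤C = ≤ℝ-trans {weight (liftedWeight M (offset N C)) t} { -ℝ ι C +ℝ ι lt} { -ℝ ι (suc lm)}
          (WeightBounds.weight-low (liftedWeight M (offset N C)) N C (v-upper C) t (Any.map (v-low C _) ni))
          (≤ℝ-trans { -ℝ ι C +ℝ ι lt} { -ℝ ι (lt + suc lm) +ℝ ι lt} { -ℝ ι (suc lm)}
            (+ℝ-mono-≤ { -ℝ ι C} { -ℝ ι (lt + suc lm)} {ι lt} {ι lt}
              (-ℝ-antimono {ι (lt + suc lm)} {ι C} (ι-mono C₀≤C)) (≤ℝ-refl {ι lt}))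
            (-ι+ι lt (suc lm)))
        le : ∀ C → lt + suc lm ≤ C → weight (liftedWeight M (offset N C)) t ≤ℝ weight M m
        le C C₀≤C = ≤ℝ-trans {weight (liftedWeight M (offset N C)) t} { -ℝ ι (suc lm)} {weight M m} (low C C₀≤C)
          (≤ℝ-trans { -ℝ ι (suc lm)} { -ℝ ι lm} {weight M m} (-ℝ-antimono {ι lm} {ι (suc lm)} (ι-mono (ℕ.n≤1+n lm))) m≥)

    -- The weight at which the inclusion is tested depends on the alleged monomial: its constant
    -- `C₀` is read off the derivation `d`. As the goal is `⊥`, the double negations on both
    -- memberships disappear.
    trop-minors : TropicalRank≤ M k → (∀ {w} → Pf k (suc a + suc b) w → trop-𝓟f R k (suc a + suc b) w) →
                  Det.trop (Det.Minors (suc k)) M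
    trop-minors rank Pf⊆trop m d = proj₂ lifted C₀ ℕ.≤-refl λ d′ →
      offsetWeight∈Pf M N M≤ ≤M C₀ rank λ pf →
      Pf⊆trop {w = liftedWeight M (offset N C₀)} pf (map crossEdge m) d′
      where
      lifted : ∃[ C₀ ] (∀ C → C₀ ≤ C → ¬ ¬ PY.initialIdeal (liftedWeight M (offset N C)) Pfa.I (rename (PX.monomial m)))
      lifted = initialIdeal-rename separate (Det.Minors (suc k)) Pfa.I minors-lift {PX.monomial m} d
      C₀ = proj₁ lifted

module _ {c ℓ} (R : CommutativeRing c ℓ) where
  private module R = CommutativeRing R
  open R using () renaming (_≈_ to _≈ᴿ_)

  -- The ideal is zero, hence so are all initial forms, and a monomial in the initial ideal would
  -- give `1# ≈ 0#`. This serves matrices without rows or without columns.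
  trop-no-generators : ¬ (R.1# ≈ᴿ R.0#) → ∀ {X : Set} (_≟_ : DecidableEquality X) →
    let open Polynomials R _≟_ in
    ∀ {p} {G : Pred Poly p} → (∀ {f} → ¬ G f) → ∀ v → trop ⟨ G ⟩ v
  trop-no-generators 1≉0 {X} _≟_ {G = G} none v m d =
    1≉0 (R.trans (R.sym (coeff-unique {m = m} ([] ∷ []) (here refl) (↭-refl {x = m}))) (un≋ (zero-ideal initial-zero d) m))
    where
    open Polynomials R _≟_
    open PolynomialProperties R _≟_
    zero-ideal : ∀ {p} {G : Pred Poly p} → (∀ {f} → G f → f ≋ []) → ∀ {f} → ⟨ G ⟩ f → f ≋ []
    zero-ideal z (gen g) = z g
    zero-ideal z nil = ≋-refl
    zero-ideal z (add d e) = ++-cong (zero-ideal z d) (zero-ideal z e)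
    zero-ideal z (mul h d) = ≋-trans (*-congˡ h (zero-ideal z d)) (*-zeroʳ h)
    zero-ideal z (≈-resp p d) = ≋-trans (≋-sym (mk≋ p)) (zero-ideal z d)
    initial-zero : ∀ {g} → (∃[ f ] ⟨ G ⟩ f × IsInitialForm v f g) → g ≋ []
    initial-zero (f , f∈ , initial) =
      mk≋ λ m → proj₂ (initial m) λ (supp , _) → supp (un≋ (zero-ideal (λ g → contradiction g none) f∈) m)

  no-minors : ¬ (R.1# ≈ᴿ R.0#) → ∀ k n₁ n₂ → (Selection (suc k) n₁ → Selection (suc k) n₂ → ⊥) → (M : Matrix n₁ n₂) →
              DeterminantalIdeal.trop R n₁ n₂ (DeterminantalIdeal.Minors R n₁ n₂ (suc k)) M
  no-minors 1≉0 k n₁ n₂ none = trop-no-generators 1≉0 (≡-dec (Fin._≟_ {n₁}) (Fin._≟_ {n₂}))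
    {G = λ f → ∃₂ λ (ρ : Selection (suc k) n₁) (γ : Selection (suc k) n₂) → f ≡ DeterminantalIdeal.minor R n₁ n₂ ρ γ}
    (λ (ρ , γ , _) → none ρ γ)

  -- The Kapranov hypothesis at `r = k` turns membership of `M` in the tropical variety of the
  -- minors of size `suc k` into `k < k`. Empty matrices are set apart because the lifted weight
  -- refers to row zero and column zero.
  kapranov⇒Pf≢trop : ¬ (R.1# ≈ᴿ R.0#) → ∀ k n₁ n₂ →
    (∃ λ (M : Matrix n₁ n₂) → TropicalRank≤ M k × KapranovRank> R M k) → ¬ (Pf k (n₁ + n₂) ≐ trop-𝓟f R k (n₁ + n₂))
  kapranov⇒Pf≢trop 1≉0 k zero n₂ (M , rank , kap) _ =
    ℕ.<-irrefl refl (kap k (no-minors 1≉0 k zero n₂ (λ ρ _ → case pick ρ zero of λ ()) M))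
  kapranov⇒Pf≢trop 1≉0 k (suc a) zero (M , rank , kap) _ =
    ℕ.<-irrefl refl (kap k (no-minors 1≉0 k (suc a) zero (λ _ γ → case pick γ zero of λ ()) M))
  kapranov⇒Pf≢trop 1≉0 k (suc a) (suc b) (M , rank , kap) (Pf⊆trop , _) =
    ℕ.<-irrefl refl (kap k (trop-minors M N (λ x → proj₁ (bounds x)) (λ x → proj₂ (bounds x)) R k rank (λ {w} → Pf⊆trop {w})))
    where
    everything = cartesianProduct (allFin (suc a)) (allFin (suc b))
    N = proj₁ (bound-all M everything)
    bounds : ∀ x → M x ≤ℝ ι N × -ℝ ι N ≤ℝ M x
    bounds (i , j) = proj₂ (bound-all M everything) (∈.∈-cartesianProduct⁺ (∈.∈-allFin i) (∈.∈-allFin j))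

field-nontrivial : ∀ {c ℓ₁ ℓ₂} (K : HeytingField c ℓ₁ ℓ₂) →
                   ¬ (CommutativeRing._≈_ (fieldRing K) (CommutativeRing.1# (fieldRing K)) (CommutativeRing.0# (fieldRing K)))
field-nontrivial K eq = #-irrefl eq 1#0
  where
  open HeytingField K using (heytingCommutativeRing; #-irrefl)
  open import Algebra.Apartness.Properties.HeytingCommutativeRing heytingCommutativeRing using (1#0)

-- Tropically singular submatrices

sumBy-+ : ∀ {A : Set} (f : A → ℕ) x y xs → f x + (f y + sumBy f xs) ≡ f y + (f x + sumBy f xs)
sumBy-+ f x y xs = x∙yz≈y∙xz (f x) (f y) (sumBy f xs)
  where open import Algebra.Properties.CommutativeSemigroup ℕ.+-commutativeSemigroup using (x∙yz≈y∙xz)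

sumBy-↭ : ∀ {A : Set} (f : A → ℕ) {xs ys} → xs ↭ ys → sumBy f xs ≡ sumBy f ys
sumBy-↭ f ↭.refl = refl
sumBy-↭ f (prep x p) = cong (f x +_) (sumBy-↭ f p)
sumBy-↭ f (swap {xs} x y p) = trans (sumBy-+ f x y xs) (cong (λ s → f y + (f x + s)) (sumBy-↭ f p))
sumBy-↭ f (↭.trans p q) = trans (sumBy-↭ f p) (sumBy-↭ f q)

sumBy-++ : ∀ {A : Set} (f : A → ℕ) xs ys → sumBy f (xs ++ ys) ≡ sumBy f xs + sumBy f ys
sumBy-++ f [] ys = refl
sumBy-++ f (x ∷ xs) ys = trans (cong (f x +_) (sumBy-++ f xs ys)) (sym (ℕ.+-assoc (f x) _ _))

sumBy-punchIn : ∀ {r} (f : Fin (suc r) → ℕ) i → sumBy f (allFin (suc r)) ≡ f i + sumBy (f ∘ punchIn i) (allFin r)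
sumBy-punchIn {r} f zero = trans (cong (sumBy f) (allFin-suc r)) (cong (f zero +_) (sumBy-map f suc (allFin r)))
sumBy-punchIn {suc r} f (suc i) = trans (sumBy-punchIn f zero) (trans (cong (f zero +_) (sumBy-punchIn (f ∘ suc) i))
  (trans (x∙yz≈y∙xz (f zero) (f (suc i)) _) (cong (f (suc i) +_)
    (sym (sumBy-punchIn (f ∘ punchIn (suc i)) zero)))))
  where open import Algebra.Properties.CommutativeSemigroup ℕ.+-commutativeSemigroup using (x∙yz≈y∙xz)

-- The examples are matrices of negated natural numbers: maximal weights become minimal costs, which
-- can be compared by computation.
Square : ℕ → Set
Square r = Fin r → Fin r → ℕ

cost : ∀ {r} → Square r → Permutation′ r → ℕ
cost {r} A σ = sumBy (λ i → A i (σ ⟨$⟩ʳ i)) (allFin r)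

Minimal : ∀ {r} → Square r → Permutation′ r → Set
Minimal A σ = ∀ π → cost A σ ≤ cost A π

-- Tropical singularity of the matrix - A.
Tied : ∀ {r} → Square r → Set
Tied A = ∃₂ λ σ τ → ¬ (σ Perm.≈ τ) × cost A σ ≡ cost A τ × Minimal A σ

cost-cong : ∀ {r} {A B : Square r} {σ τ} → (∀ i → A i (σ ⟨$⟩ʳ i) ≡ B i (τ ⟨$⟩ʳ i)) → cost A σ ≡ cost B τ
cost-cong {r} h = sumBy-cong (allFin r) h

tied-cong : ∀ {r} {A B : Square r} → (∀ i j → A i j ≡ B i j) → Tied A → Tied B
tied-cong {A = A} {B} h (σ , τ , ≉ , eq , min) =
  σ , τ , ≉ , trans (sym (same σ)) (trans eq (same τ)) , λ π → subst₂ _≤_ (same σ) (same π) (min π)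
  where
  same : ∀ σ → cost A σ ≡ cost B σ
  same σ = cost-cong {A = A} {B} {σ} {σ} λ i → h i (σ ⟨$⟩ʳ i)

minimal-exists : ∀ {r} (A : Square r) → ∃[ σ ] Minimal A σ
minimal-exists {r} A =
  let σ₀ , σ₀∈ , _ = permutations-complete {r} Perm.id
      σ , min = least (permutations r) σ₀∈
  in σ , λ π → let π′ , π′∈ , π′≈π = permutations-complete π in
       ℕ.≤-trans (min π′∈) (ℕ.≤-reflexive (cost-cong {A = A} {A} {π′} {π} λ i → cong (A i) (π′≈π i)))
  where
  least : ∀ σs {σ} → σ ∈ σs → ∃[ σ ] (∀ {π} → π ∈ σs → cost A σ ≤ cost A π)
  least (σ ∷ []) _ = σ , λ { (here refl) → ℕ.≤-refl }
  least (σ ∷ τ ∷ σs) _ with least (τ ∷ σs) (here refl)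
  ... | μ , min with ℕ.≤-total (cost A σ) (cost A μ)
  ...   | inj₁ σ≤μ = σ , λ { (here refl) → ℕ.≤-refl ; (there π∈) → ℕ.≤-trans σ≤μ (min π∈) }
  ...   | inj₂ μ≤σ = μ , λ { (here refl) → μ≤σ ; (there π∈) → min π∈ }

delete : ∀ {r} → Square (suc r) → Fin (suc r) → Fin (suc r) → Square r
delete A i j a b = A (punchIn i a) (punchIn j b)

cost-remove : ∀ {r} (A : Square (suc r)) σ i →
              cost A σ ≡ A i (σ ⟨$⟩ʳ i) + cost (delete A i (σ ⟨$⟩ʳ i)) (Perm.remove i σ)
cost-remove {r} A σ i = trans (sumBy-punchIn (λ a → A a (σ ⟨$⟩ʳ a)) i)
  (cong (A i (σ ⟨$⟩ʳ i) +_) (sumBy-cong (allFin r) λ a → cong (A (punchIn i a)) (Perm.punchIn-permute σ i a)))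

insert-at : ∀ {r} (i j : Fin (suc r)) (τ : Permutation′ r) → Perm.insert i j τ ⟨$⟩ʳ i ≡ j
insert-at i j τ with i Fin.≟ i
... | yes _  = refl
... | no i≢i = contradiction refl i≢i

cost-insert : ∀ {r} (A : Square (suc r)) i j τ → cost A (Perm.insert i j τ) ≡ A i j + cost (delete A i j) τ
cost-insert {r} A i j τ = trans (sumBy-punchIn (λ a → A a (Perm.insert i j τ ⟨$⟩ʳ a)) i)
  (cong₂ _+_ (cong (A i) (insert-at i j τ)) (sumBy-cong (allFin r) λ a → cong (A (punchIn i a)) (Perm.insert-punchIn i j τ a)))

-- Removing the entry leaves `σ` with cost `cost A σ` less that entry, so an optimum of the minor
-- costs no more; putting the entry back turns it into an optimum of `A`, and a tie into a tie.
tied-delete : ∀ {r} (A : Square (suc r)) σ i → Minimal A σ → Tied (delete A i (σ ⟨$⟩ʳ i)) → Tied A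
tied-delete A σ i σ-min (τ₁ , τ₂ , ≉ , eq , min) =
  ins τ₁ , ins τ₂
  , (λ ≈ → ≉ λ a → Fin.punchIn-injective j _ _
      (trans (sym (Perm.insert-punchIn i j τ₁ a)) (trans (≈ (punchIn i a)) (Perm.insert-punchIn i j τ₂ a))))
  , trans (cost-insert A i j τ₁) (trans (cong (A i j +_) eq) (sym (cost-insert A i j τ₂)))
  , λ π → ℕ.≤-trans (ℕ.≤-reflexive (cost-insert A i j τ₁))
      (ℕ.≤-trans (ℕ.+-monoʳ-≤ (A i j) (min (Perm.remove i σ)))
        (ℕ.≤-trans (ℕ.≤-reflexive (sym (cost-remove A σ i))) (σ-min π)))
  where
  j = σ ⟨$⟩ʳ i
  ins = Perm.insert i j

-- An optimal permutation followed by the transposition of the two columns has the same cost.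
tied-equal-columns : ∀ {r} (A : Square r) a b → a ≢ b → (∀ i → A i a ≡ A i b) → Tied A
tied-equal-columns {r} A a b a≢b eq = by (minimal-exists A)
  where
  swapped : ∀ i x → A i (Perm.transpose a b ⟨$⟩ʳ x) ≡ A i x
  swapped i x with x Fin.≟ a
  ... | yes refl = sym (eq i)
  ... | no _ with x Fin.≟ b
  ...   | yes refl = eq i
  ...   | no _ = refl
  transpose-a : Perm.transpose a b ⟨$⟩ʳ a ≡ b
  transpose-a with a Fin.≟ a
  ... | yes _ = refl
  ... | no a≢a = contradiction refl a≢a
  by : ∃[ σ ] Minimal A σ → Tied A
  by (σ , min) = σ , σ Perm.∘ₚ Perm.transpose a b
    , (λ ≈ → a≢b (trans (sym (Perm.inverseʳ σ)) (trans (≈ (σ ⟨$⟩ˡ a))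
        (trans (cong (Perm.transpose a b ⟨$⟩ʳ_) (Perm.inverseʳ σ)) transpose-a))))
    , sumBy-cong (allFin r) (λ i → sym (swapped i (σ ⟨$⟩ʳ i)))
    , min

Cost : ℕ → ℕ → Set
Cost n₁ n₂ = Fin n₁ × Fin n₂ → ℕ

submatrix : ∀ {r n₁ n₂} → Cost n₁ n₂ → Selection r n₁ → Selection r n₂ → Square r
submatrix c ρ γ i j = c (pick ρ i , pick γ j)

MinorsTied : ∀ {n₁ n₂} → Cost n₁ n₂ → ℕ → Set
MinorsTied {n₁} {n₂} c r = ∀ (ρ : Selection r n₁) (γ : Selection r n₂) → Tied (submatrix c ρ γ)

omit : ∀ {r n} → Selection (suc r) n → Fin (suc r) → Selection r n
omit ρ i = record { pick = pick ρ ∘ punchIn i ; increasing = λ a<b → increasing ρ (punchIn-mono-< i a<b) }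

-- Deleting one entry of an optimal permutation leaves a minor of size `r`, whose tie lifts. A bound
-- on the tropical rank thus needs to be checked in one size only.
minorsTied-suc : ∀ {n₁ n₂} {c : Cost n₁ n₂} {r} → MinorsTied c r → MinorsTied c (suc r)
minorsTied-suc {c = c} h ρ γ = by (minimal-exists (submatrix c ρ γ))
  where
  by : ∃[ σ ] Minimal (submatrix c ρ γ) σ → Tied (submatrix c ρ γ)
  by (σ , min) = tied-delete (submatrix c ρ γ) σ zero min (h (omit ρ zero) (omit γ (σ ⟨$⟩ʳ zero)))

minorsTied-≥ : ∀ {n₁ n₂} {c : Cost n₁ n₂} {k} → MinorsTied c k → ∀ d → MinorsTied c (d + k)
minorsTied-≥ h zero = h
minorsTied-≥ {c = c} h (suc d) = minorsTied-suc {c = c} (minorsTied-≥ {c = c} h d)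

-- `Fin.pinch zero` sends the new columns 0 and 1 to the old column 0.
duplicate : ∀ {n₁ m} → Cost n₁ (suc m) → Cost n₁ (suc (suc m))
duplicate c (i , j) = c (i , Fin.pinch zero j)

-- Either both copies are selected, and equal columns tie, or collapsing the copies leaves the
-- selection strictly increasing.
minorsTied-duplicate : ∀ {n₁ m} (c : Cost n₁ (suc m)) {r} → MinorsTied c r → MinorsTied (duplicate c) r
minorsTied-duplicate {m = m} c {r} h ρ γ = by (Fin.any? λ a → Fin.any? λ b → a Fin.<? b ×-dec π a Fin.≟ π b)
  where
  π : Fin r → Fin (suc m)
  π = Fin.pinch zero ∘ pick γ
  by : Dec (∃[ a ] ∃[ b ] a Fin.< b × π a ≡ π b) → Tied (submatrix (duplicate c) ρ γ)
  by (yes (a , b , a<b , eq)) = tied-equal-columns (submatrix (duplicate c) ρ γ) a b (Fin.<⇒≢ a<b)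
    λ i → cong (λ j → c (pick ρ i , j)) eq
  by (no ¬eq) = h ρ (record
    { pick = π
    ; increasing = λ {a} {b} a<b → ℕ.≤∧≢⇒< (Fin.pinch-mono-≤ zero (ℕ.<⇒≤ (increasing γ a<b)))
        λ eq → ¬eq (a , b , a<b , Fin.toℕ-injective eq) })

-- The value 2 meets two demands: two of them are no cheaper than the corner together with an entry
-- of at most 4, so the corner may be assumed in an optimal permutation that could use it; and a
-- single one exceeds the cost of the lead of a certificate, which is at most 1.
extend : ∀ {n₁ n₂} → Cost n₁ n₂ → Cost (suc n₁) (suc n₂)
extend c (zero  , zero)  = 0
extend c (zero  , suc j) = 2
extend c (suc i , zero)  = 2
extend c (suc i , suc j) = c (i , j)

data View {r n} (ρ : Selection (suc r) (suc n)) : Set where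
  first : (ρ′ : Selection r n) → pick ρ zero ≡ zero → (∀ a → pick ρ (suc a) ≡ suc (pick ρ′ a)) → View ρ
  later : (ρ′ : Selection (suc r) n) → (∀ a → pick ρ a ≡ suc (pick ρ′ a)) → View ρ

view : ∀ {r n} (ρ : Selection (suc r) (suc n)) → View ρ
view {r} {n} ρ = by (pick ρ zero) refl
  where
  predecessor : ∀ {m} (f : Fin m → Fin (suc n)) → (∀ a → f a ≢ zero) → ∀ a → ∃[ j ] f a ≡ suc j
  predecessor f f≢ a with f a | f≢ a
  ... | zero  | ≢0 = contradiction refl ≢0
  ... | suc j | _  = j , refl
  above-zero : ∀ {i j : Fin (suc n)} → i Fin.< j → j ≢ zero
  above-zero {j = zero} () refl
  lowered : ∀ {m} (f : Fin m → Fin (suc n)) → (∀ {a b} → a Fin.< b → f a Fin.< f b) → (f≢ : ∀ a → f a ≢ zero) → Selection m n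
  lowered f f< f≢ = record
    { pick = λ a → proj₁ (predecessor f f≢ a)
    ; increasing = λ {a} {b} a<b → ℕ.s≤s⁻¹ (subst₂ Fin._<_ (proj₂ (predecessor f f≢ a)) (proj₂ (predecessor f f≢ b)) (f< a<b)) }
  by : ∀ j → pick ρ zero ≡ j → View ρ
  by zero eq = first (lowered (pick ρ ∘ suc) (increasing ρ ∘ s≤s) suc≢) eq (λ a → proj₂ (predecessor (pick ρ ∘ suc) suc≢ a))
    where
    suc≢ : ∀ a → pick ρ (suc a) ≢ zero
    suc≢ a = above-zero {pick ρ zero} (increasing ρ (s≤s z≤n))
  by (suc j) eq = later (lowered (pick ρ) (increasing ρ) all≢) (λ a → proj₂ (predecessor (pick ρ) all≢ a))
    where
    all≢ : ∀ a → pick ρ a ≢ zero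
    all≢ zero h = contradiction (trans (sym eq) h) λ ()
    all≢ (suc a) = above-zero {pick ρ zero} (increasing ρ (s≤s z≤n))

-- From an optimal permutation an entry is deleted that takes away the new row and the new column
-- where they are selected, so that a minor of `c` remains. If both are selected, that entry has to
-- be the corner.
minorsTied-extend : ∀ {n₁ n₂} (c : Cost n₁ n₂) {k} → (∀ x → c x ≤ 4) → MinorsTied c (suc k) → MinorsTied (extend c) (suc (suc k))
minorsTied-extend c {k} c≤4 h ρ γ = by (view ρ) (view γ)
  where
  A = submatrix (extend c) ρ γ
  entry : ∀ {i j i′ j′} → pick ρ i ≡ suc i′ → pick γ j ≡ suc j′ → c (i′ , j′) ≡ A i j
  entry p q = cong₂ (λ x y → extend c (x , y)) (sym p) (sym q)

  row-zero : ∀ {γ′ : Selection (suc (suc k)) _} → (∀ b → pick γ b ≡ suc (pick γ′ b)) →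
             (ρ′ : Selection (suc k) _) → (∀ a → pick ρ (suc a) ≡ suc (pick ρ′ a)) → Tied A
  row-zero {γ′} γ≡ ρ′ ρ≡ =
    let σ , min = minimal-exists A
    in tied-delete A σ zero min (tied-cong (λ a b → entry (ρ≡ a) (γ≡ (punchIn (σ ⟨$⟩ʳ zero) b))) (h ρ′ (omit γ′ (σ ⟨$⟩ʳ zero))))

  by : View ρ → View γ → Tied A
  by (first ρ′ _ ρ≡) (later γ′ γ≡) = row-zero {γ′} γ≡ ρ′ ρ≡
  by (later ρ′ ρ≡) (later γ′ γ≡) = row-zero {γ′} γ≡ (omit ρ′ zero) (ρ≡ ∘ suc)
  by (later ρ′ ρ≡) (first γ′ _ γ≡) =
    let σ , min = minimal-exists A
        i = σ ⟨$⟩ˡ zero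
    in tied-delete A σ i min (subst (λ j → Tied (delete A i j)) (sym (Perm.inverseʳ σ))
         (tied-cong (λ a b → entry (ρ≡ (punchIn i a)) (γ≡ b)) (h (omit ρ′ i) γ′)))
  by (first ρ′ ρ0 ρ≡) (first γ′ γ0 γ≡) =
    let σ , min = minimal-exists A
        τ , τ0 , τ-min = corner σ min
    in tied-delete A τ zero τ-min (subst (λ j → Tied (delete A zero j)) (sym τ0)
         (tied-cong (λ a b → entry (ρ≡ a) (γ≡ b)) (h ρ′ γ′)))
    where
    -- Exchanging the images of 0 and of the preimage of 0 costs at most 0 + 4 instead of 2 + 2.
    corner : ∀ σ → Minimal A σ → ∃[ τ ] τ ⟨$⟩ʳ zero ≡ zero × Minimal A τ
    corner σ min = cases (σ ⟨$⟩ʳ zero) refl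
      where
      cases : ∀ j → σ ⟨$⟩ʳ zero ≡ j → ∃[ τ ] τ ⟨$⟩ʳ zero ≡ zero × Minimal A τ
      cases zero eq = σ , eq , min
      cases (suc b) eq = τ , refl , λ π → ℕ.≤-trans cheaper (min π)
        where
        σ′ : Permutation′ (suc k)
        σ′ = Perm.remove zero σ
        i : Fin (suc k)
        i = σ′ ⟨$⟩ˡ zero
        τ = Perm.insert zero zero (Perm.insert i b (Perm.remove i σ′))
        X = cost (delete (delete A zero (suc b)) i zero) (Perm.remove i σ′)
        σ-cost : cost A σ ≡ A zero (suc b) + (A (suc i) zero + X)
        σ-cost = trans (cost-remove A σ zero) (cong₂ _+_ (cong (A zero) eq)
          (trans (cong (λ j → cost (delete A zero j) σ′) eq) (trans (cost-remove (delete A zero (suc b)) σ′ i)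
            (cong (λ j → delete A zero (suc b) i j + cost (delete (delete A zero (suc b)) i j) (Perm.remove i σ′)) (Perm.inverseʳ σ′)))))
        τ-cost : cost A τ ≡ A zero zero + (A (suc i) (suc b) + X)
        τ-cost = trans (cost-insert A zero zero _) (cong (A zero zero +_) (cost-insert (delete A zero zero) i b (Perm.remove i σ′)))
        A00 : A zero zero ≡ 0
        A00 = cong₂ (λ x y → extend c (x , y)) ρ0 γ0
        A0b : A zero (suc b) ≡ 2
        A0b = cong₂ (λ x y → extend c (x , y)) ρ0 (γ≡ b)
        Ai0 : A (suc i) zero ≡ 2
        Ai0 = cong₂ (λ x y → extend c (x , y)) (ρ≡ i) γ0
        cheaper : cost A τ ≤ cost A σ
        cheaper = subst₂ _≤_ (sym τ-cost) (sym (trans σ-cost (cong₂ _+_ A0b (cong (_+ X) Ai0))))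
          (ℕ.≤-trans (ℕ.≤-reflexive (cong (_+ (A (suc i) (suc b) + X)) A00))
            (ℕ.+-monoˡ-≤ X (subst (_≤ 4) (entry (ρ≡ i) (γ≡ b)) (c≤4 _))))

toMatrix : ∀ {n₁ n₂} → Cost n₁ n₂ → Matrix n₁ n₂
toMatrix c x = fromℚ (ℚ.- ιℚ (c x))

module _ {n₁ n₂ : ℕ} (c : Cost n₁ n₂) where

  private
    value : List (Fin n₁ × Fin n₂) → ℝ
    value xs = fromℚ (ℚ.- ιℚ (sumBy c xs))

  seq-weight : ∀ xs n → seq (weight (toMatrix c) xs) n ≡ ℚ.- ιℚ (sumBy c xs)
  seq-weight [] n = refl
  seq-weight (x ∷ xs) n = trans (cong (ℚ.- ιℚ (c x) ℚ.+_) (seq-weight xs n))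
    (sym (trans (cong ℚ.-_ (ιℚ-+ (c x) (sumBy c xs))) (ℚ.neg-distrib-+ (ιℚ (c x)) (ιℚ (sumBy c xs)))))

  weight≤value : ∀ xs → weight (toMatrix c) xs ≤ℝ value xs
  weight≤value xs = ≗⇒≤ℝ {weight (toMatrix c) xs} {value xs} (seq-weight xs)

  value≤weight : ∀ xs → value xs ≤ℝ weight (toMatrix c) xs
  value≤weight xs = ≗⇒≤ℝ {value xs} {weight (toMatrix c) xs} (λ n → sym (seq-weight xs n))

  weight-antimono : ∀ xs ys → sumBy c ys ≤ sumBy c xs → weight (toMatrix c) xs ≤ℝ weight (toMatrix c) ys
  weight-antimono xs ys le = ≤ℝ-trans {weight (toMatrix c) xs} {value xs} {weight (toMatrix c) ys} (weight≤value xs)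
    (≤ℝ-trans {value xs} {value ys} {weight (toMatrix c) ys} (fromℚ-mono (ℚ.neg-antimono-≤ (ιℚ-mono-≤ le))) (value≤weight ys))

  weight-strict : ∀ xs ys → sumBy c ys < sumBy c xs → ¬ (weight (toMatrix c) ys ≤ℝ weight (toMatrix c) xs)
  weight-strict xs ys lt le = fromℚ-<⇒≰ (ℚ.neg-antimono-< (ιℚ-mono-< lt))
    (≤ℝ-trans {value ys} {weight (toMatrix c) ys} {value xs} (value≤weight ys)
      (≤ℝ-trans {weight (toMatrix c) ys} {weight (toMatrix c) xs} {value xs} le (weight≤value xs)))

  cost-positions : ∀ {r} (ρ : Selection r n₁) (γ : Selection r n₂) σ →
                   cost (submatrix c ρ γ) σ ≡ sumBy c (positions ρ γ σ)
  cost-positions {r} ρ γ σ = sym (sumBy-map c (λ i → pick ρ i , pick γ (σ ⟨$⟩ʳ i)) (allFin r))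

  tied⇒singular : ∀ {r} (ρ : Selection r n₁) (γ : Selection r n₂) → Tied (submatrix c ρ γ) → Singular ρ γ (toMatrix c)
  tied⇒singular ρ γ (σ , τ , ≉ , eq , min) = σ , τ , ≉
    , ≤ℝ-antisym {weight (toMatrix c) (positions ρ γ σ)} {weight (toMatrix c) (positions ρ γ τ)}
        (weight-antimono (positions ρ γ σ) (positions ρ γ τ) (ℕ.≤-reflexive (sym eq′)))
        (weight-antimono (positions ρ γ τ) (positions ρ γ σ) (ℕ.≤-reflexive eq′))
    , λ π → weight-antimono (positions ρ γ π) (positions ρ γ σ)
        (subst₂ _≤_ (cost-positions ρ γ σ) (cost-positions ρ γ π) (min π))
    where
    eq′ : sumBy c (positions ρ γ σ) ≡ sumBy c (positions ρ γ τ)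
    eq′ = trans (sym (cost-positions ρ γ σ)) (trans eq (cost-positions ρ γ τ))

  minorsTied⇒rank≤ : ∀ {k} → MinorsTied c (suc k) → TropicalRank≤ (toMatrix c) k
  minorsTied⇒rank≤ {k} h r ρ γ ¬sing = ℕ.≮⇒≥ λ k<r →
    larger (r ∸ suc k) (sym (ℕ.m∸n+n≡m k<r)) ρ γ ¬sing
    where
    larger : ∀ d {r} → r ≡ d + suc k → (ρ : Selection r n₁) (γ : Selection r n₂) → ¬ ¬ Singular ρ γ (toMatrix c)
    larger d refl ρ γ ¬sing = ¬sing (tied⇒singular ρ γ (minorsTied-≥ {c = c} h d ρ γ))

-- Checking the ties by enumeration, and the two basic matrices

increasings : ∀ r n → List (Vec (Fin n) r)
increasings zero    n       = [] ∷ []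
increasings (suc r) zero    = []
increasings (suc r) (suc n) =
  map (λ v → zero ∷ Vec.map suc v) (increasings r n) ++ map (Vec.map suc) (increasings (suc r) n)

-- Agreement is pointwise because selections are functions; being tied depends only on the values of
-- the entries (`tied-cong`).
increasings-complete : ∀ {r n} (ρ : Selection r n) → ∃[ v ] v ∈ increasings r n × (∀ i → Vec.lookup v i ≡ pick ρ i)
increasings-complete {zero} ρ = [] , here refl , λ ()
increasings-complete {suc r} {zero} ρ = case pick ρ zero of λ ()
increasings-complete {suc r} {suc n} ρ with view ρ
... | first ρ′ ρ0 ρ≡ =
  let v , v∈ , v≡ = increasings-complete ρ′
  in zero ∷ Vec.map suc v , ∈.∈-++⁺ˡ (∈.∈-map⁺ (λ v → zero ∷ Vec.map suc v) v∈)
     , λ { zero → sym ρ0 ; (suc i) → trans (Vec.lookup-map i suc v) (trans (cong suc (v≡ i)) (sym (ρ≡ i))) }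
... | later ρ′ ρ≡ =
  let v , v∈ , v≡ = increasings-complete ρ′
  in Vec.map suc v , ∈.∈-++⁺ʳ (map (λ v → zero ∷ Vec.map suc v) (increasings r n)) (∈.∈-map⁺ (Vec.map suc) v∈)
     , λ i → trans (Vec.lookup-map i suc v) (trans (cong suc (v≡ i)) (sym (ρ≡ i)))

TiedWithin : ∀ {r} → Square r → List (Permutation′ r) → Set
TiedWithin A σs = Any (λ σ → All (λ π → cost A σ ≤ cost A π) σs × Any (λ τ → cost A σ ≡ cost A τ × ¬ (σ Perm.≈ τ)) σs) σs

tiedWithin? : ∀ {r} (A : Square r) σs → Dec (TiedWithin A σs)
tiedWithin? A σs = Any.any? (λ σ → All.all? (λ π → cost A σ ℕ.≤? cost A π) σs ×-dec
  Any.any? (λ τ → cost A σ ℕ.≟ cost A τ ×-dec ¬? (Fin.all? λ i → (σ ⟨$⟩ʳ i) Fin.≟ (τ ⟨$⟩ʳ i))) σs) σs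

tiedWithin⇒tied : ∀ {r} (A : Square r) → TiedWithin A (permutations r) → Tied A
tiedWithin⇒tied A t =
  let σ , _ , min , ties = find t
      τ , _ , eq , ≉ = find ties
  in σ , τ , ≉ , eq , λ π →
    let π′ , π′∈ , π′≈π = permutations-complete π
    in ℕ.≤-trans (All.lookup min π′∈) (ℕ.≤-reflexive (cost-cong {A = A} {A} {π′} {π} λ i → cong (A i) (π′≈π i)))

module _ {n₁ n₂ : ℕ} (c : Cost n₁ n₂) (r : ℕ) where

  vecSubmatrix : Vec (Fin n₁) r → Vec (Fin n₂) r → Square r
  vecSubmatrix v w i j = c (Vec.lookup v i , Vec.lookup w j)

  MinorsTiedWithin : Set
  MinorsTiedWithin = All (λ v → All (λ w → TiedWithin (vecSubmatrix v w) (permutations r)) (increasings r n₂)) (increasings r n₁)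

  minorsTiedWithin? : Dec MinorsTiedWithin
  minorsTiedWithin? = All.all? (λ v → All.all? (λ w → tiedWithin? (vecSubmatrix v w) (permutations r)) (increasings r n₂)) (increasings r n₁)

  minorsTiedWithin⇒minorsTied : MinorsTiedWithin → MinorsTied c r
  minorsTiedWithin⇒minorsTied h ρ γ =
    let v , v∈ , v≡ = increasings-complete ρ
        w , w∈ , w≡ = increasings-complete γ
    in tied-cong (λ i j → cong₂ (λ x y → c (x , y)) (v≡ i) (w≡ j))
         (tiedWithin⇒tied (vecSubmatrix v w) (All.lookup (All.lookup h v∈) w∈))

table : ∀ {n₁ n₂} → Vec (Vec ℕ n₂) n₁ → Cost n₁ n₂
table t (i , j) = Vec.lookup (Vec.lookup t i) j

-- The incidence matrix of the Fano plane: line j consists of the points j, j + 1, j + 3 modulo 7.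
fano : Cost 7 7
fano = table
  ( (1 ∷ 0 ∷ 0 ∷ 0 ∷ 1 ∷ 0 ∷ 1 ∷ [])
  ∷ (1 ∷ 1 ∷ 0 ∷ 0 ∷ 0 ∷ 1 ∷ 0 ∷ [])
  ∷ (0 ∷ 1 ∷ 1 ∷ 0 ∷ 0 ∷ 0 ∷ 1 ∷ [])
  ∷ (1 ∷ 0 ∷ 1 ∷ 1 ∷ 0 ∷ 0 ∷ 0 ∷ [])
  ∷ (0 ∷ 1 ∷ 0 ∷ 1 ∷ 1 ∷ 0 ∷ 0 ∷ [])
  ∷ (0 ∷ 0 ∷ 1 ∷ 0 ∷ 1 ∷ 1 ∷ 0 ∷ [])
  ∷ (0 ∷ 0 ∷ 0 ∷ 1 ∷ 0 ∷ 1 ∷ 1 ∷ [])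
  ∷ [])

-- A lift of rank four would, after elimination with the pivots (0,0), (2,2), (4,4), leave a
-- 3 × 3 matrix z of rank one; but z₀₁z₁₂z₂₀ costs 2 and z₀₂z₁₀z₂₁ costs 1.
shitov : Cost 6 6
shitov = table
  ( (0 ∷ 0 ∷ 2 ∷ 2 ∷ 2 ∷ 2 ∷ [])
  ∷ (0 ∷ 0 ∷ 0 ∷ 2 ∷ 0 ∷ 2 ∷ [])
  ∷ (2 ∷ 2 ∷ 0 ∷ 0 ∷ 2 ∷ 2 ∷ [])
  ∷ (1 ∷ 2 ∷ 0 ∷ 0 ∷ 1 ∷ 2 ∷ [])
  ∷ (2 ∷ 2 ∷ 2 ∷ 2 ∷ 0 ∷ 0 ∷ [])
  ∷ (1 ∷ 2 ∷ 0 ∷ 2 ∷ 0 ∷ 0 ∷ [])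
  ∷ [])

-- All 36 minors of size 5, and below all 1225 minors of size 4, are settled by evaluating the
-- decision procedure.
shitov-tied : MinorsTied shitov 5
shitov-tied = minorsTiedWithin⇒minorsTied shitov 5 (toWitness {a? = minorsTiedWithin? shitov 5} _)

fano-tied : MinorsTied fano 4
fano-tied = minorsTiedWithin⇒minorsTied fano 4 (toWitness {a? = minorsTiedWithin? fano 4} _)

-- Kapranov rank from a monomial initial form

module _ {c ℓ} (R : CommutativeRing c ℓ) {X : Set} (_≟_ : DecidableEquality X) where
  private module R = CommutativeRing R
  open R using () renaming (_≈_ to _≈ᴿ_)
  open Polynomials R _≟_
  open PolynomialProperties R _≟_

  coeff-head : ∀ a x f m → x ↭ m → All (λ t → ¬ (proj₂ t ↭ m)) f → coeff ((a , x) ∷ f) m ≈ᴿ a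
  coeff-head a x f m p absent rewrite dec-true (_↭?_ _≟_ x m) p =
    R.trans (R.+-congˡ (R.reflexive (coeff-absent f absent))) (R.+-identityʳ a)

  occurs-tail : ∀ a x f m → ¬ (x ↭ m) → Support ((a , x) ∷ f) m → Any (λ t → proj₂ t ↭ m) f
  occurs-tail a x f m ¬p supp rewrite dec-false (_↭?_ _≟_ x m) ¬p =
    let t , t∈ , p = occurs f m supp in lose t∈ p

-- Laplace expansion along the first row

module LaplaceExpansion {c ℓ} (R : CommutativeRing c ℓ) (n₁ n₂ : ℕ) where
  private module R = CommutativeRing R
  open DeterminantalIdeal R n₁ n₂
  open PolynomialProperties R (≡-dec (Fin._≟_ {n₁}) (Fin._≟_ {n₂}))

  module _ {r} (ρ : Selection (suc r) n₁) (γ : Selection (suc r) n₂) where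

    term : Permutation′ (suc r) → Term
    term σ = sign (inversions σ) , positions ρ γ σ

    -- For `allFin (suc r)` this is the minor itself by computation, as `permutations` runs through
    -- the images of zero. Shorter lists permit induction and, later, isolate the terms that avoid
    -- the corner.
    partial : List (Fin (suc r)) → Poly
    partial is = map term (cartesianProductWith (Perm.insert zero) is (permutations r))

    partial-∷ : ∀ i is → partial (i ∷ is) ≡ map term (map (Perm.insert zero i) (permutations r)) ++ partial is
    partial-∷ i is = List.map-++ term (map (Perm.insert zero i) (permutations r)) _

    -- The cofactor sign arises because sending zero to `i` contributes `toℕ i` inversions.
    cofactor : ∀ i → map term (map (Perm.insert zero i) (permutations r)) ≋
               ((sign (toℕ i) , (pick ρ zero , pick γ i) ∷ []) ∷ []) *ₚ minor (omit ρ zero) (omit γ i)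
    cofactor i = ≋-trans (≋-reflexive (sym (List.map-∘ (permutations r))))
      (≋-trans (map-≋ (term ∘ Perm.insert zero i) (λ σ → (sign (toℕ i) , (pick ρ zero , pick γ i) ∷ []) · minorTerm σ)
          (permutations r)
          (λ σ → R.trans (R.reflexive (cong sign (inversions-insert i σ))) (sign-+ (toℕ i) (inversions σ)))
          (λ σ → ↭-reflexive (cong ((pick ρ zero , pick γ i) ∷_) (rest σ))))
        (≋-reflexive (trans (List.map-∘ (permutations r))
          (sym (scale (sign (toℕ i)) ((pick ρ zero , pick γ i) ∷ []) (minor (omit ρ zero) (omit γ i)))))))
      where
      minorTerm : Permutation′ r → Term
      minorTerm σ = sign (inversions σ) , positions (omit ρ zero) (omit γ i) σ
      rest : ∀ σ → map (λ a → pick ρ a , pick γ (Perm.insert zero i σ ⟨$⟩ʳ a)) (tabulate suc) ≡ positions (omit ρ zero) (omit γ i) σ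
      rest σ = trans (List.map-tabulate suc (λ a → pick ρ a , pick γ (Perm.insert zero i σ ⟨$⟩ʳ a)))
        (sym (map-allFin (λ a → pick ρ (suc a) , pick γ (punchIn i (σ ⟨$⟩ʳ a)))))

    partial∈Minors : ∀ is → Minors r (partial is)
    partial∈Minors [] = nil
    partial∈Minors (i ∷ is) = subst (Minors r) (sym (partial-∷ i is))
      (add (⟨⟩-resp (≋-sym (cofactor i)) (mul ((sign (toℕ i) , (pick ρ zero , pick γ i) ∷ []) ∷ []) (gen (omit ρ zero , omit γ i , refl)))) (partial∈Minors is))

  -- Because of this, a single member of the ideal of the minors of size `suc k` rules out every
  -- `r ≤ k` as Kapranov rank.
  minors-antitone : ∀ d {r f} → Minors (d + r) f → Minors r f
  minors-antitone zero f∈ = f∈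
  minors-antitone (suc d) {r} f∈ =
    minors-antitone d (⟨⟩-mono (λ { (ρ , γ , refl) → partial∈Minors ρ γ (allFin (suc (d + r))) }) f∈)

module _ {c ℓ} (R : CommutativeRing c ℓ) where
  private module R = CommutativeRing R
  open R using () renaming (_≈_ to _≈ᴿ_; Carrier to A)

  -- The lead is the only cheapest term, so that the initial form is a monomial.
  record Certificate {n₁ n₂} (cst : Cost n₁ n₂) (k : ℕ) : Set (c ⊔ ℓ) where
    open DeterminantalIdeal R n₁ n₂
    field
      coefficient inverse : A
      inverse-* : inverse R.* coefficient ≈ᴿ R.1#
      lead      : Monomial (Fin n₁ × Fin n₂)
      rest      : Poly
      member    : Minors (suc k) ((coefficient , lead) ∷ rest)
      lead-cost : sumBy cst lead ≤ 1
      rest-cost : All (λ t → sumBy cst lead < sumBy cst (proj₂ t)) rest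

  open Certificate

  module _ {n₁ n₂} {cst : Cost n₁ n₂} {k : ℕ} (C : Certificate cst k) (1≉0 : ¬ (R.1# ≈ᴿ R.0#)) where
    open DeterminantalIdeal R n₁ n₂
    open PolynomialProperties R (≡-dec (Fin._≟_ {n₁}) (Fin._≟_ {n₂}))

    private
      a = coefficient C
      m₀ = lead C
      f g : Poly
      f = (a , m₀) ∷ rest C
      g = (a , m₀) ∷ []

      a≉0 : ¬ (a ≈ᴿ R.0#)
      a≉0 a≈0 = 1≉0 (R.trans (R.sym (inverse-* C)) (R.trans (R.*-congˡ a≈0) (R.zeroʳ (inverse C))))

      coeff-lead : ∀ m → m₀ ↭ m → coeff f m ≈ᴿ a
      coeff-lead m p = coeff-head R (≡-dec (Fin._≟_ {n₁}) (Fin._≟_ {n₂})) a m₀ (rest C) m p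
        (All.map (λ {t} lt q → ℕ.<-irrefl (trans (sumBy-↭ cst p) (sym (sumBy-↭ cst q))) lt) (rest-cost C))

      dearer : ∀ m → ¬ (m₀ ↭ m) → Support f m → sumBy cst m₀ < sumBy cst m
      dearer m ¬p supp = All.lookupWith (λ {t} lt q → subst (sumBy cst m₀ <_) (sumBy-↭ cst q) lt)
        (rest-cost C) (occurs-tail R (≡-dec (Fin._≟_ {n₁}) (Fin._≟_ {n₂})) a m₀ (rest C) m ¬p supp)

      lead-cheapest : ∀ m n → m₀ ↭ m → Support f n → Dec (m₀ ↭ n) → sumBy cst m ≤ sumBy cst n
      lead-cheapest m n p supp (yes q) = ℕ.≤-reflexive (trans (sym (sumBy-↭ cst p)) (sumBy-↭ cst q))
      lead-cheapest m n p supp (no ¬q) = subst (_≤ sumBy cst n) (sumBy-↭ cst p) (ℕ.<⇒≤ (dearer n ¬q supp))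

      lead-leading : ∀ m → m₀ ↭ m → Leading (toMatrix cst) f m
      lead-leading m p = (λ z → a≉0 (R.trans (R.sym (coeff-lead m p)) z)) , λ n supp →
        weight-antimono cst n m (lead-cheapest m n p supp (_↭?_ (≡-dec (Fin._≟_ {n₁}) (Fin._≟_ {n₂})) m₀ n))

      leading-lead : ∀ m → ¬ (m₀ ↭ m) → ¬ Leading (toMatrix cst) f m
      leading-lead m ¬p (supp , max) = weight-strict cst m m₀ (dearer m ¬p supp)
        (max m₀ (λ z → a≉0 (R.trans (R.sym (coeff-lead m₀ (↭-refl {x = m₀}))) z)))

      initial′ : ∀ m → Dec (m₀ ↭ m) →
        (Leading (toMatrix cst) f m → coeff g m ≈ᴿ coeff f m) × (¬ Leading (toMatrix cst) f m → coeff g m ≈ᴿ R.0#)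
      initial′ m (yes p) =
        (λ _ → R.trans (coeff-head R (≡-dec (Fin._≟_ {n₁}) (Fin._≟_ {n₂})) a m₀ [] m p []) (R.sym (coeff-lead m p)))
        , λ ¬lead → ⊥-elim (¬lead (lead-leading m p))
      initial′ m (no ¬p) = (λ lead → ⊥-elim (leading-lead m ¬p lead)) , λ _ → R.reflexive (coeff-absent g {m} (¬p ∷ []))

      initial : IsInitialForm (toMatrix cst) f g
      initial m = initial′ m (_↭?_ (≡-dec (Fin._≟_ {n₁}) (Fin._≟_ {n₂})) m₀ m)

    -- The initial form of the certified member is a unit times a monomial; multiplying by the
    -- inverse puts that monomial into the initial ideal for each `r ≤ k`.
    certificate⇒kapranov : KapranovRank> R (toMatrix cst) k
    certificate⇒kapranov r trop = ℕ.≰⇒> λ r≤k → trop m₀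
      (⟨⟩-resp monic (mul ((inverse C , []) ∷ []) (gen (f , smaller r≤k , initial))))
      where
      open LaplaceExpansion R n₁ n₂ using (minors-antitone)
      smaller : r ≤ k → Minors (suc r) f
      smaller r≤k = minors-antitone (k ∸ r)
        (subst (λ s → Minors s f) (trans (cong suc (sym (ℕ.m∸n+n≡m r≤k))) (sym (ℕ.+-suc (k ∸ r) r))) (member C))
      monic : ((inverse C , []) ∷ []) *ₚ g ≋ monomial m₀
      monic = ∷-cong (inverse-* C) ↭-refl ≋-refl

  module _ {n₁ m} (cst : Cost n₁ (suc m)) {k} (C : Certificate cst k) where

    private
      φ : Fin n₁ × Fin (suc m) → Fin n₁ × Fin (suc (suc m))
      φ (i , j) = i , suc j

      φ-injective : ∀ {x y} → φ x ≡ φ y → x ≡ y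
      φ-injective {_ , _} {_ , _} refl = refl

      φ-image? : ∀ y → Dec (∃[ x ] y ≡ φ x)
      φ-image? (i , zero)  = no λ { ((_ , _) , ()) }
      φ-image? (i , suc j) = yes ((i , j) , refl)

      module Ren = Renaming R (≡-dec Fin._≟_ Fin._≟_) (≡-dec Fin._≟_ Fin._≟_) φ φ-injective φ-image?
      open Ren
      module D₁ = DeterminantalIdeal R n₁ (suc m)
      module D₂ = DeterminantalIdeal R n₁ (suc (suc m))

      unit : PY.Poly
      unit = (R.1# , []) ∷ []

      IsMinor₁ : Pred PX.Poly c
      IsMinor₁ f = ∃₂ λ (ρ : Selection (suc k) n₁) (γ : Selection (suc k) (suc m)) → f ≡ D₁.minor ρ γ

      IsMinor₂ : Pred PY.Poly c
      IsMinor₂ f = ∃₂ λ (ρ : Selection (suc k) n₁) (γ : Selection (suc k) (suc (suc m))) → f ≡ D₂.minor ρ γ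

      Never : Pred (Monomial (Fin n₁ × Fin (suc (suc m)))) 0ℓ
      Never _ = ⊥

      never-++ : ∀ x {y} → Never y → Never (x ++ y)
      never-++ _ ()

      module L = Lift {G = IsMinor₁} {H = IsMinor₂} unit Never never-++

      base : ∀ {f} → IsMinor₁ f → L.HasLift f
      base (ρ , γ , refl) = L.hasLift (D₂.minor ρ γ⁺) [] (PY.gen (ρ , γ⁺ , refl))
        (Y.≋-trans (Y.≋-reflexive (trans
            (List.map-cong (λ σ → cong₂ _,_ (sym (sign-agree (inversions σ))) (List.map-∘ (allFin (suc k)))) (permutations (suc k)))
            (List.map-∘ (permutations (suc k)))))
          (Y.≋-sym (Y.≋-trans (Y.≋-reflexive (List.++-identityʳ _)) (Y.one-* (rename (D₁.minor ρ γ)))))) []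
        where
        γ⁺ : Selection (suc k) (suc (suc m))
        γ⁺ = record { pick = suc ∘ pick γ ; increasing = λ a<b → s≤s (increasing γ a<b) }

      lifted : L.HasLift ((coefficient C , lead C) ∷ rest C)
      lifted = L.lift base (member C)

      cost-φ : ∀ xs → sumBy (duplicate cst) (map φ xs) ≡ sumBy cst xs
      cost-φ = sumBy-map (duplicate cst) φ

    -- The new matrix without its column zero is the old one, so old minors are minors of the new
    -- matrix with all columns shifted by one. The predicate `Never` forces the tail of the lift to
    -- be empty.
    certificate-duplicate : Certificate (duplicate cst) k
    certificate-duplicate = record
      { coefficient = coefficient C
      ; inverse = inverse C
      ; inverse-* = inverse-* C
      ; lead = map φ (lead C)
      ; rest = rename (rest C)
      ; member = by lifted
      ; lead-cost = subst (_≤ 1) (sym (cost-φ (lead C))) (lead-cost C)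
      ; rest-cost = All.map⁺ (All.map (λ {t} → subst₂ _<_ (sym (cost-φ (lead C))) (sym (cost-φ (proj₂ t)))) (rest-cost C))
      }
      where
      by : L.HasLift ((coefficient C , lead C) ∷ rest C) → D₂.Minors (suc k) (rename ((coefficient C , lead C) ∷ rest C))
      by (L.hasLift F [] F∈ F≋ _) =
        Y.⟨⟩-resp (Y.≋-trans F≋ (Y.≋-trans (Y.≋-reflexive (List.++-identityʳ _)) (Y.one-* _))) F∈
      by (L.hasLift F (_ ∷ _) F∈ F≋ (() ∷ _))

  module _ {n₁ n₂} (cst : Cost n₁ n₂) {k} (C : Certificate cst k) where

    private
      φ : Fin n₁ × Fin n₂ → Fin (suc n₁) × Fin (suc n₂)
      φ (i , j) = suc i , suc j

      φ-injective : ∀ {x y} → φ x ≡ φ y → x ≡ y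
      φ-injective {_ , _} {_ , _} refl = refl

      φ-image? : ∀ y → Dec (∃[ x ] y ≡ φ x)
      φ-image? (zero  , j)     = no λ { ((_ , _) , ()) }
      φ-image? (suc i , zero)  = no λ { ((_ , _) , ()) }
      φ-image? (suc i , suc j) = yes ((i , j) , refl)

      module Ren = Renaming R (≡-dec Fin._≟_ Fin._≟_) (≡-dec Fin._≟_ Fin._≟_) φ φ-injective φ-image?
      open Ren
      module D₁ = DeterminantalIdeal R n₁ n₂
      module D₂ = DeterminantalIdeal R (suc n₁) (suc n₂)
      open LaplaceExpansion R (suc n₁) (suc n₂)

      corner : PY.Poly
      corner = (R.1# , (zero , zero) ∷ []) ∷ []

      Dear : Monomial (Fin (suc n₁) × Fin (suc n₂)) → Set
      Dear m = 2 ≤ sumBy (extend cst) m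

      dear-++ : ∀ x {y} → Dear y → Dear (x ++ y)
      dear-++ x {y} 2≤ = ℕ.≤-trans 2≤ (ℕ.≤-trans (ℕ.m≤n+m _ (sumBy (extend cst) x)) (ℕ.≤-reflexive (sym (sumBy-++ (extend cst) x y))))

      IsMinor₁ : Pred PX.Poly c
      IsMinor₁ f = ∃₂ λ (ρ : Selection (suc k) n₁) (γ : Selection (suc k) n₂) → f ≡ D₁.minor ρ γ

      IsMinor₂ : Pred PY.Poly c
      IsMinor₂ f = ∃₂ λ (ρ : Selection (suc (suc k)) (suc n₁)) (γ : Selection (suc (suc k)) (suc n₂)) → f ≡ D₂.minor ρ γ

      module L = Lift {G = IsMinor₁} {H = IsMinor₂} corner Dear dear-++

      widen : ∀ {r n} → Selection r n → Selection (suc r) (suc n)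
      widen {r} {n} ρ = record { pick = wide ; increasing = λ {a} {b} → wide-< a b }
        where
        wide : Fin (suc r) → Fin (suc n)
        wide zero    = zero
        wide (suc a) = suc (pick ρ a)
        wide-< : ∀ a b → a Fin.< b → wide a Fin.< wide b
        wide-< zero    (suc b) _         = s≤s z≤n
        wide-< (suc a) (suc b) (s≤s a<b) = s≤s (increasing ρ a<b)

      base : ∀ {f} → IsMinor₁ f → L.HasLift f
      base (ρ , γ , refl) = L.hasLift (D₂.minor ρ⁺ γ⁺) tail (PY.gen (ρ⁺ , γ⁺ , refl))
        (Y.≋-trans (Y.≋-reflexive (partial-∷ ρ⁺ γ⁺ zero (tabulate suc)))
          (Y.++-cong (Y.≋-trans (cofactor ρ⁺ γ⁺ zero) (Y.≋-reflexive (cong (corner PY.*ₚ_) shrunk))) Y.≋-refl))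
        (All.map⁺ (All.tabulate λ σ∈ → dear (∈.∈-cartesianProductWith⁻ (Perm.insert zero) (tabulate suc) (permutations (suc k)) σ∈)))
        where
        ρ⁺ = widen ρ
        γ⁺ = widen γ
        tail = partial ρ⁺ γ⁺ (tabulate suc)
        shrunk : D₂.minor (omit ρ⁺ zero) (omit γ⁺ zero) ≡ rename (D₁.minor ρ γ)
        shrunk = trans
          (List.map-cong (λ σ → cong₂ _,_ (sym (sign-agree (inversions σ))) (List.map-∘ (allFin (suc k)))) (permutations (suc k)))
          (List.map-∘ (permutations (suc k)))
        dear : ∀ {σ} → (∃₂ λ i τ → i ∈ tabulate suc × τ ∈ permutations (suc k) × σ ≡ Perm.insert zero i τ) →
               Dear (positions ρ⁺ γ⁺ σ)
        dear (i , τ , i∈ , _ , refl) with ∈.∈-tabulate⁻ {f = suc} i∈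
        ... | j , refl = s≤s (s≤s z≤n)

      lifted : L.HasLift ((coefficient C , lead C) ∷ rest C)
      lifted = L.lift base (member C)

      cost-φ : ∀ xs → sumBy (extend cst) (map φ xs) ≡ sumBy cst xs
      cost-φ = sumBy-map (extend cst) φ

    -- Expanding a bordered minor along its first row gives the corner times the old minor plus
    -- terms with another entry of that row, which costs 2. As the corner is free and the lead costs
    -- at most 1, the lead stays the single cheapest term.
    certificate-extend : Certificate (extend cst) (suc k)
    certificate-extend = by lifted
      where
      by : L.HasLift ((coefficient C , lead C) ∷ rest C) → Certificate (extend cst) (suc k)
      by (L.hasLift F tail F∈ F≋ dear) = record
        { coefficient = R.1# R.* coefficient C
        ; inverse = inverse C
        ; inverse-* = R.trans (R.*-congˡ (R.*-identityˡ (coefficient C))) (inverse-* C)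
        ; lead = (zero , zero) ∷ map φ (lead C)
        ; rest = map ((R.1# , (zero , zero) ∷ []) Y.·_) (rename (rest C)) ++ tail
        ; member = Y.⟨⟩-resp (Y.≋-trans F≋ (Y.≋-reflexive (cong (_++ tail) (Y.scale R.1# ((zero , zero) ∷ []) (rename ((coefficient C , lead C) ∷ rest C)))))) F∈
        ; lead-cost = subst (_≤ 1) (sym (cost-φ (lead C))) (lead-cost C)
        ; rest-cost = All.++⁺
            (All.map⁺ (All.map⁺ (All.map (λ {t} → subst₂ _<_ (sym (cost-φ (lead C))) (sym (cost-φ (proj₂ t)))) (rest-cost C))))
            (All.map (λ {t} 2≤ → ℕ.≤-trans (s≤s (subst (_≤ 1) (sym (cost-φ (lead C))) (lead-cost C))) 2≤) dear)
        }

-- Certificates by cancellation of signed terms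

module SignedMinors {c ℓ} (R : CommutativeRing c ℓ) (n₁ n₂ : ℕ) where
  private module R = CommutativeRing R
  open R using () renaming (_≈_ to _≈ᴿ_; Carrier to A)
  open DeterminantalIdeal R n₁ n₂
  open PolynomialProperties R (≡-dec (Fin._≟_ {n₁}) (Fin._≟_ {n₂}))
  open RingProperties R.ring using (-‿distribˡ-*; -‿involutive)

  -- Polynomials with coefficients ± 1, the sign being true for -1.
  SignedPoly : Set
  SignedPoly = List (Bool × Monomial (Fin n₁ × Fin n₂))

  signed : Bool → A
  signed false = R.1#
  signed true  = R.- R.1#

  ⟦_⟧ₜ : Bool × Monomial (Fin n₁ × Fin n₂) → Term
  ⟦ b , m ⟧ₜ = signed b , m

  ⟦_⟧ : SignedPoly → Poly
  ⟦_⟧ = map ⟦_⟧ₜ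

  odd : ℕ → Bool
  odd zero    = false
  odd (suc n) = not (odd n)

  signed-not : ∀ b → signed (not b) ≈ᴿ R.- signed b
  signed-not false = R.refl
  signed-not true  = R.sym (-‿involutive R.1#)

  sign-odd : ∀ n → signed (odd n) ≈ᴿ sign n
  sign-odd zero    = R.refl
  sign-odd (suc n) = R.trans (signed-not (odd n)) (R.-‿cong (sign-odd n))

  signed-xor : ∀ b b′ → signed (b xor b′) ≈ᴿ signed b R.* signed b′
  signed-xor false b′ = R.sym (R.*-identityˡ (signed b′))
  signed-xor true b′  = R.trans (signed-not b′)
    (R.trans (R.-‿cong (R.sym (R.*-identityˡ (signed b′)))) (-‿distribˡ-* R.1# (signed b′)))

  record Summand (r : ℕ) : Set where
    constructor summand
    field
      negative   : Bool
      multiplier : Monomial (Fin n₁ × Fin n₂)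
      rows       : Selection r n₁
      columns    : Selection r n₂

  expand : ∀ {r} → Summand r → SignedPoly
  expand {r} (summand b m ρ γ) = map (λ σ → b xor odd (inversions σ) , m ++ positions ρ γ σ) (permutations r)

  expandAll : ∀ {r} → List (Summand r) → SignedPoly
  expandAll []       = []
  expandAll (s ∷ ss) = expand s ++ expandAll ss

  expand∈Minors : ∀ {r} (s : Summand r) → Minors r ⟦ expand s ⟧
  expand∈Minors {r} (summand b m ρ γ) = ⟨⟩-resp
    (≋-trans (≋-reflexive (trans (scale (signed b) m (minor ρ γ)) (sym (List.map-∘ (permutations r)))))
      (≋-trans (map-≋ (λ σ → (signed b , m) · (sign (inversions σ) , positions ρ γ σ))
          (λ σ → ⟦ b xor odd (inversions σ) , m ++ positions ρ γ σ ⟧ₜ) (permutations r)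
          (λ σ → R.sym (R.trans (signed-xor b (odd (inversions σ))) (R.*-congˡ (sign-odd (inversions σ)))))
          (λ _ → ↭-refl))
        (≋-reflexive (List.map-∘ (permutations r)))))
    (mul ((signed b , m) ∷ []) (gen (ρ , γ , refl)))

  expandAll∈Minors : ∀ {r} (ss : List (Summand r)) → Minors r ⟦ expandAll ss ⟧
  expandAll∈Minors [] = nil
  expandAll∈Minors {r} (s ∷ ss) = subst (Minors r) (sym (List.map-++ ⟦_⟧ₜ (expand s) (expandAll ss)))
    (add (expand∈Minors s) (expandAll∈Minors ss))

  -- Cancellation is certified on lists of signs and monomials, so one computation is valid over
  -- every ring.
  data Cancels : SignedPoly → Set where
    none : Cancels []
    pair : ∀ b {x y f} → x ↭ y → Cancels f → Cancels ((b , x) ∷ (not b , y) ∷ f)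

  cancels⇒≋ : ∀ {f} → Cancels f → ⟦ f ⟧ ≋ []
  cancels⇒≋ none         = ≋-refl
  cancels⇒≋ (pair b p h) =
    ≋-trans (cancel (R.trans (R.+-congˡ (signed-not b)) (R.-‿inverseʳ (signed b))) p) (cancels⇒≋ h)

  module _ (cst : Cost n₁ n₂) (w : ℕ) where

    cheap? : ∀ (t : Bool × Monomial (Fin n₁ × Fin n₂)) → Dec (sumBy cst (proj₂ t) ≤ w)
    cheap? t = sumBy cst (proj₂ t) ℕ.≤? w

    -- Terms dearer than `w` go to `rest` whatever they are, and even their mutual cancellations do
    -- not matter; only the cheap ones have to collapse to a single term, whose coefficient `a` is
    -- inverted by `b`.
    signedCertificate : ∀ {k} (ss : List (Summand (suc k))) (L : SignedPoly) (a b : A) lead →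
      filter cheap? (expandAll ss) ↭ L → ⟦ L ⟧ ≋ (a , lead) ∷ [] → b R.* a ≈ᴿ R.1# →
      sumBy cst lead ≤ w → w ≤ 1 → Certificate R cst k
    signedCertificate {k} ss L a b lead L↭ L≋ ba≈1 lead≤ w≤1 = record
      { coefficient = a
      ; inverse = b
      ; inverse-* = ba≈1
      ; lead = lead
      ; rest = ⟦ dear ⟧
      ; member = ⟨⟩-resp
          (≋-trans (↭⇒≋ (↭.map⁺ ⟦_⟧ₜ (↭-trans split (↭.++⁺ʳ dear L↭))))
            (≋-trans (≋-reflexive (List.map-++ ⟦_⟧ₜ L dear)) (++-cong L≋ ≋-refl)))
          (expandAll∈Minors ss)
      ; lead-cost = ℕ.≤-trans lead≤ w≤1
      ; rest-cost = All.map⁺ (All.map (λ w< → ℕ.≤-<-trans lead≤ (ℕ.≰⇒> w<)) (All.all-filter (¬? ∘ cheap?) (expandAll ss)))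
      }
      where
      dear = filter (¬? ∘ cheap?) (expandAll ss)
      split = filter-split cheap? (expandAll ss)

Increasing : ∀ {r n} → Vec (Fin n) r → Set
Increasing v = ∀ i j → i Fin.< j → Vec.lookup v i Fin.< Vec.lookup v j

increasing? : ∀ {r n} (v : Vec (Fin n) r) → Dec (Increasing v)
increasing? v = Fin.all? λ i → Fin.all? λ j → i Fin.<? j →-dec Vec.lookup v i Fin.<? Vec.lookup v j

select : ∀ {r n} (v : Vec (Fin n) r) {_ : True (increasing? v)} → Selection r n
select v {t} = record { pick = Vec.lookup v ; increasing = λ {i} {j} → toWitness t i j }

reorder? : ∀ {n₁ n₂} (L L′ : List (Bool × Monomial (Fin n₁ × Fin n₂))) → Dec (L ↭ L′)
reorder? = _↭?_ (≡-dec Bool._≟_ (List.≡-dec (≡-dec Fin._≟_ Fin._≟_)))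

rearranged? : ∀ {n₁ n₂} (m m′ : Monomial (Fin n₁ × Fin n₂)) → Dec (m ↭ m′)
rearranged? = _↭?_ (≡-dec Fin._≟_ Fin._≟_)

module BaseCertificates {c ℓ} (R : CommutativeRing c ℓ) where
  private module R = CommutativeRing R

  module _ where
    open SignedMinors R 6 6

    -- With z the matrix of the elimination, the two summands are, up to factors,
    -- z₂₀ (z₀₁ z₁₂ - z₀₂ z₁₁) and z₀₂ (z₁₁ z₂₀ - z₁₀ z₂₁).
    shitovSummands : List (Summand 5)
    shitovSummands =
        summand true ((5F , 0F) ∷ (0F , 1F) ∷ (4F , 4F) ∷ [])
          (select (0F ∷ 1F ∷ 2F ∷ 3F ∷ 4F ∷ [])) (select (0F ∷ 2F ∷ 3F ∷ 4F ∷ 5F ∷ []))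
      ∷ summand false ((1F , 4F) ∷ (4F , 5F) ∷ (0F , 0F) ∷ [])
          (select (0F ∷ 2F ∷ 3F ∷ 4F ∷ 5F ∷ [])) (select (0F ∷ 1F ∷ 2F ∷ 3F ∷ 4F ∷ []))
      ∷ []

    shitovLead : Monomial (Fin 6 × Fin 6)
    shitovLead = (1F , 4F) ∷ (4F , 5F) ∷ (0F , 0F) ∷ (0F , 1F) ∷ (2F , 3F) ∷ (3F , 0F) ∷ (4F , 4F) ∷ (5F , 2F) ∷ []

    shitovPairs : SignedPoly
    shitovPairs =
        (false , (1F , 4F) ∷ (4F , 5F) ∷ (0F , 0F) ∷ (0F , 1F) ∷ (2F , 2F) ∷ (3F , 3F) ∷ (4F , 4F) ∷ (5F , 0F) ∷ [])
      ∷ (true , (5F , 0F) ∷ (0F , 1F) ∷ (4F , 4F) ∷ (0F , 0F) ∷ (1F , 4F) ∷ (2F , 2F) ∷ (3F , 3F) ∷ (4F , 5F) ∷ [])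
      ∷ (false , (5F , 0F) ∷ (0F , 1F) ∷ (4F , 4F) ∷ (0F , 0F) ∷ (1F , 4F) ∷ (2F , 3F) ∷ (3F , 2F) ∷ (4F , 5F) ∷ [])
      ∷ (true , (1F , 4F) ∷ (4F , 5F) ∷ (0F , 0F) ∷ (0F , 1F) ∷ (2F , 3F) ∷ (3F , 2F) ∷ (4F , 4F) ∷ (5F , 0F) ∷ [])
      ∷ []

    shitovCheap : SignedPoly
    shitovCheap =
        (false , shitovLead)
      ∷ shitovPairs

    -- Five terms cost at most 1: two cancelling pairs and the lead. Its coefficient is 1, so the
    -- certificate exists over every commutative ring.
    shitovCertificate : Certificate R shitov 4
    shitovCertificate = signedCertificate shitov 1 shitovSummands shitovCheap R.1# R.1# shitovLead
      (toWitness {a? = reorder? (filter (cheap? shitov 1) (expandAll shitovSummands)) shitovCheap} _)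
      (∷-cong R.refl ↭-refl
        (cancels⇒≋ {shitovPairs} (pair false (toWitness {a? = rearranged? _ _} _)
          (pair false (toWitness {a? = rearranged? _ _} _) none))))
      (R.*-identityˡ R.1#) (s≤s z≤n) (s≤s z≤n)
      where open PolynomialProperties R (≡-dec (Fin._≟_ {6}) (Fin._≟_ {6}))

  module _ (half : R.Carrier) (half-* : half R.* (R.1# R.+ R.1#) R.≈ R.1#) where
    open SignedMinors R 7 7

    -- Modulo the points on the lines, four minors are binomials; multiplied together the
    -- binomial relations say that a monomial is its own negative.
    fanoSummands : List (Summand 4)
    fanoSummands =
        summand false ((4F , 2F) ∷ (2F , 0F) ∷ (3F , 1F) ∷ (0F , 1F) ∷ (1F , 4F) ∷ (5F , 0F) ∷ [])
          (select (0F ∷ 1F ∷ 4F ∷ 6F ∷ [])) (select (0F ∷ 3F ∷ 5F ∷ 6F ∷ []))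
      ∷ summand false ((4F , 6F) ∷ (4F , 5F) ∷ (0F , 1F) ∷ (1F , 4F) ∷ (5F , 0F) ∷ (6F , 0F) ∷ [])
          (select (0F ∷ 1F ∷ 2F ∷ 3F ∷ [])) (select (0F ∷ 1F ∷ 2F ∷ 3F ∷ []))
      ∷ summand false ((0F , 3F) ∷ (4F , 5F) ∷ (3F , 1F) ∷ (1F , 4F) ∷ (5F , 0F) ∷ (6F , 0F) ∷ [])
          (select (0F ∷ 1F ∷ 2F ∷ 4F ∷ [])) (select (0F ∷ 1F ∷ 2F ∷ 6F ∷ []))
      ∷ summand false ((1F , 3F) ∷ (4F , 6F) ∷ (2F , 0F) ∷ (3F , 1F) ∷ (0F , 1F) ∷ (6F , 0F) ∷ [])
          (select (0F ∷ 1F ∷ 4F ∷ 5F ∷ [])) (select (0F ∷ 2F ∷ 4F ∷ 5F ∷ []))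
      ∷ []

    fanoLead : Monomial (Fin 7 × Fin 7)
    fanoLead = (1F , 3F) ∷ (4F , 6F) ∷ (2F , 0F) ∷ (3F , 1F) ∷ (0F , 1F) ∷ (6F , 0F) ∷ (0F , 5F) ∷ (1F , 4F) ∷ (4F , 2F) ∷ (5F , 0F) ∷ []

    fanoPairs : SignedPoly
    fanoPairs =
        (false , (4F , 6F) ∷ (4F , 5F) ∷ (0F , 1F) ∷ (1F , 4F) ∷ (5F , 0F) ∷ (6F , 0F) ∷ (0F , 2F) ∷ (1F , 3F) ∷ (2F , 0F) ∷ (3F , 1F) ∷ [])
      ∷ (true , (1F , 3F) ∷ (4F , 6F) ∷ (2F , 0F) ∷ (3F , 1F) ∷ (0F , 1F) ∷ (6F , 0F) ∷ (0F , 2F) ∷ (1F , 4F) ∷ (4F , 5F) ∷ (5F , 0F) ∷ [])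
      ∷ (false , (0F , 3F) ∷ (4F , 5F) ∷ (3F , 1F) ∷ (1F , 4F) ∷ (5F , 0F) ∷ (6F , 0F) ∷ (0F , 1F) ∷ (1F , 2F) ∷ (2F , 0F) ∷ (4F , 6F) ∷ [])
      ∷ (true , (4F , 6F) ∷ (4F , 5F) ∷ (0F , 1F) ∷ (1F , 4F) ∷ (5F , 0F) ∷ (6F , 0F) ∷ (0F , 3F) ∷ (1F , 2F) ∷ (2F , 0F) ∷ (3F , 1F) ∷ [])
      ∷ (false , (4F , 2F) ∷ (2F , 0F) ∷ (3F , 1F) ∷ (0F , 1F) ∷ (1F , 4F) ∷ (5F , 0F) ∷ (0F , 3F) ∷ (1F , 6F) ∷ (4F , 5F) ∷ (6F , 0F) ∷ [])
      ∷ (true , (0F , 3F) ∷ (4F , 5F) ∷ (3F , 1F) ∷ (1F , 4F) ∷ (5F , 0F) ∷ (6F , 0F) ∷ (0F , 1F) ∷ (1F , 6F) ∷ (2F , 0F) ∷ (4F , 2F) ∷ [])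
      ∷ []

    fanoCheap : SignedPoly
    fanoCheap =
        (false , (4F , 2F) ∷ (2F , 0F) ∷ (3F , 1F) ∷ (0F , 1F) ∷ (1F , 4F) ∷ (5F , 0F) ∷ (0F , 5F) ∷ (1F , 3F) ∷ (4F , 6F) ∷ (6F , 0F) ∷ [])
      ∷ (false , fanoLead)
      ∷ fanoPairs

    -- Of the eight terms of cost 0 six cancel and two coincide, leaving coefficient 2. This is
    -- where 2 must be invertible, in keeping with the Fano plane being realizable in characteristic
    -- 2.
    fanoCertificate : Certificate R fano 3
    fanoCertificate = signedCertificate fano 0 fanoSummands fanoCheap (R.1# R.+ R.1#) half fanoLead
      (toWitness {a? = reorder? (filter (cheap? fano 0) (expandAll fanoSummands)) fanoCheap} _)
      (≋-trans (merge (toWitness {a? = rearranged? _ _} _))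
        (∷-cong R.refl ↭-refl
          (cancels⇒≋ {fanoPairs} (pair false (toWitness {a? = rearranged? _ _} _)
            (pair false (toWitness {a? = rearranged? _ _} _)
              (pair false (toWitness {a? = rearranged? _ _} _) none))))))
      half-* z≤n z≤n
      where open PolynomialProperties R (≡-dec (Fin._≟_ {7}) (Fin._≟_ {7}))

-- The examples in all sizes

duplicates : ∀ {n₁ m} e → Cost n₁ (suc m) → Cost n₁ (suc (e + m))
duplicates zero    c = c
duplicates (suc e) c = duplicate (duplicates e c)

extends : ∀ {n₁ n₂} t → Cost n₁ n₂ → Cost (t + n₁) (t + n₂)
extends zero    c = c
extends (suc t) c = extend (extends t c)

duplicates-≤ : ∀ {n₁ m} e (c : Cost n₁ (suc m)) → (∀ x → c x ≤ 4) → ∀ x → duplicates e c x ≤ 4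
duplicates-≤ zero    c c≤4 x       = c≤4 x
duplicates-≤ (suc e) c c≤4 (i , j) = duplicates-≤ e c c≤4 (i , Fin.pinch zero j)

extends-≤ : ∀ {n₁ n₂} t (c : Cost n₁ n₂) → (∀ x → c x ≤ 4) → ∀ x → extends t c x ≤ 4
extends-≤ zero    c c≤4 x               = c≤4 x
extends-≤ (suc t) c c≤4 (zero  , zero)  = z≤n
extends-≤ (suc t) c c≤4 (zero  , suc j) = s≤s (s≤s z≤n)
extends-≤ (suc t) c c≤4 (suc i , zero)  = s≤s (s≤s z≤n)
extends-≤ (suc t) c c≤4 (suc i , suc j) = extends-≤ t c c≤4 (i , j)

minorsTied-duplicates : ∀ {n₁ m} e (c : Cost n₁ (suc m)) {r} → MinorsTied c r → MinorsTied (duplicates e c) r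
minorsTied-duplicates zero    c h = h
minorsTied-duplicates (suc e) c h = minorsTied-duplicate (duplicates e c) (minorsTied-duplicates e c h)

minorsTied-extends : ∀ {n₁ n₂} t (c : Cost n₁ n₂) {k} → (∀ x → c x ≤ 4) → MinorsTied c (suc k) →
                     MinorsTied (extends t c) (suc (t + k))
minorsTied-extends zero    c c≤4 h = h
minorsTied-extends (suc t) c c≤4 h = minorsTied-extend (extends t c) (extends-≤ t c c≤4) (minorsTied-extends t c c≤4 h)

shitov-≤ : ∀ x → shitov x ≤ 4
shitov-≤ (i , j) = toWitness {a? = Fin.all? λ i → Fin.all? λ j → shitov (i , j) ℕ.≤? 4} _ i j

module Examples {c ℓ} (R : CommutativeRing c ℓ) where
  open CommutativeRing R using (_≈_; 0#; 1#) renaming (Carrier to A; _+_ to _+ᴿ_; _*_ to _*ᴿ_)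

  certificate-duplicates : ∀ {n₁ m} e (cst : Cost n₁ (suc m)) {k} → Certificate R cst k → Certificate R (duplicates e cst) k
  certificate-duplicates zero    cst C = C
  certificate-duplicates (suc e) cst C = certificate-duplicate R (duplicates e cst) (certificate-duplicates e cst C)

  certificate-extends : ∀ {n₁ n₂} t (cst : Cost n₁ n₂) {k} → Certificate R cst k → Certificate R (extends t cst) (t + k)
  certificate-extends zero    cst C = C
  certificate-extends (suc t) cst C = certificate-extend R (extends t cst) (certificate-extends t cst C)

  Separates : ℕ → ℕ → Set (c ⊔ ℓ)
  Separates k n = ∃₂ λ n₁ n₂ → n₁ + n₂ ≡ n × (∃ λ (M : Matrix n₁ n₂) → TropicalRank≤ M k × KapranovRank> R M k)

  module _ (1≉0 : ¬ (1# ≈ 0#)) (half : A) (half-* : (half *ᴿ (1# +ᴿ 1#)) ≈ 1#) where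

    separates-by : ∀ {n₁ n₂} k (cst : Cost n₁ n₂) → MinorsTied cst (suc k) → Certificate R cst k → Separates k (n₁ + n₂)
    separates-by {n₁} {n₂} k cst tied C =
      n₁ , n₂ , refl , toMatrix cst , minorsTied⇒rank≤ cst {k} tied , certificate⇒kapranov R C 1≉0

    fano-separates : ∀ e → Separates 3 (7 + suc (e + 6))
    fano-separates e = separates-by 3 (duplicates e fano) (minorsTied-duplicates e fano fano-tied)
      (certificate-duplicates e fano (BaseCertificates.fanoCertificate R half half-*))

    shitov-separates : ∀ t e → Separates (t + 4) (t + 6 + (t + suc (e + 5)))
    shitov-separates t e = separates-by (t + 4) (extends t (duplicates e shitov))
      (minorsTied-extends t (duplicates e shitov) (duplicates-≤ e shitov shitov-≤) (minorsTied-duplicates e shitov shitov-tied))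
      (certificate-extends t (duplicates e shitov) (certificate-duplicates e shitov (BaseCertificates.shitovCertificate R)))

    -- The bound 14 is 7 + 7. For `4 ≤ k`, extending the 6 × 6 matrix `k ∸ 4` times gives size
    -- `k + 2`, whence the bound `2 * k + 4`. The excess of `n` is made up by columns duplicated
    -- before the extensions.
    separates : ∀ k n → (k ≡ 3 × 14 ≤ n) ⊎ (4 ≤ k × 2 * k + 4 ≤ n) → Separates k n
    separates .3 n (inj₁ (refl , 14≤n)) = subst (Separates 3)
      (trans (cong (λ x → 7 + suc x) (ℕ.+-comm (n ∸ 14) 6)) (ℕ.m+[n∸m]≡n 14≤n)) (fano-separates (n ∸ 14))
    separates k n (inj₂ (4≤k , le)) =
      subst₂ Separates (ℕ.m∸n+n≡m 4≤k) (trans (size (k ∸ 4) e) (trans (cong (λ k → 2 * k + 4 + e) (ℕ.m∸n+n≡m 4≤k)) (ℕ.m+[n∸m]≡n le)))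
        (shitov-separates (k ∸ 4) e)
      where
      e = n ∸ (2 * k + 4)
      size : ∀ t e → t + 6 + (t + suc (e + 5)) ≡ 2 * (t + 4) + 4 + e
      size = solve 2 (λ t e → t :+ con 6 :+ (t :+ (con 1 :+ (e :+ con 5))) := con 2 :* (t :+ con 4) :+ con 4 :+ e) refl
        where open import Data.Nat.Solver using (module +-*-Solver)
              open +-*-Solver

    separated : ∀ k n → (k ≡ 3 × 14 ≤ n) ⊎ (4 ≤ k × 2 * k + 4 ≤ n) →
                Separates k n × ¬ (Pf k n ≐ trop-𝓟f R k n)
    separated k n h = separates k n h , distinct (separates k n h)
      where
      distinct : ∀ {n} → Separates k n → ¬ (Pf k n ≐ trop-𝓟f R k n)
      distinct (n₁ , n₂ , refl , sep) = kapranov⇒Pf≢trop R 1≉0 k n₁ n₂ sep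

1ℝ≉0ℝ : ¬ (1ℝ ≈ℝ 0ℝ)
1ℝ≉0ℝ eq = fromℚ-<⇒≰ {0ℚ} {1ℚ} (ℚ.positive⁻¹ 1ℚ) (≈⇒≤ℝ {1ℝ} {0ℝ} eq)

Distinguishes : CommutativeRing 0ℓ 0ℓ → Set
Distinguishes K = (k n : ℕ) → (k ≡ 3 × 14 ≤ n) ⊎ (4 ≤ k × 2 * k + 4 ≤ n) →
  Examples.Separates K k n × ¬ (Pf k n ≐ trop-𝓟f K k n)

rational : Distinguishes ℚ-ring
rational = Examples.separated ℚ-ring (λ ()) ½ refl

real : Distinguishes ℝ-ring
real = Examples.separated ℝ-ring 1ℝ≉0ℝ (fromℚ ½) (≗⇒≈ℝ {fromℚ ½ *ℝ (1ℝ +ℝ 1ℝ)} {1ℝ} λ _ → refl)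

complex : Distinguishes ℂ-ring
complex = Examples.separated ℂ-ring (λ p → 1ℝ≉0ℝ (proj₁ p)) (fromℚ ½ , 0ℝ)
  ( ≗⇒≈ℝ {fromℚ ½ *ℝ (1ℝ +ℝ 1ℝ) +ℝ -ℝ (0ℝ *ℝ (0ℝ +ℝ 0ℝ))} {1ℝ} (λ _ → refl)
  , ≗⇒≈ℝ {fromℚ ½ *ℝ (0ℝ +ℝ 0ℝ) +ℝ 0ℝ *ℝ (1ℝ +ℝ 1ℝ)} {0ℝ} (λ _ → refl))

theorem3p7 : ∀ {c ℓ₁ ℓ₂} →
    ((k : ℕ) → 1 ≤ k → (K : HeytingField c ℓ₁ ℓ₂) → (n₁ n₂ : ℕ) →
    (∃ λ (M : Matrix n₁ n₂) → TropicalRank≤ M k × KapranovRank> (fieldRing K) M k) →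
    ¬ (Pf k (n₁ + n₂) ≐ trop-𝓟f (fieldRing K) k (n₁ + n₂)))
    ×
    All (λ K → (k n : ℕ) → (k ≡ 3 × 14 ≤ n) ⊎ (4 ≤ k × 2 * k + 4 ≤ n) →
    (∃₂ λ n₁ n₂ → n₁ + n₂ ≡ n ×
    (∃ λ (M : Matrix n₁ n₂) → TropicalRank≤ M k × KapranovRank> K M k))
    × ¬ (Pf k n ≐ trop-𝓟f K k n))
    (ℚ-ring ∷ ℝ-ring ∷ ℂ-ring ∷ [])
theorem3p7 =
  (λ k _ K n₁ n₂ → kapranov⇒Pf≢trop (fieldRing K) (field-nontrivial K) k n₁ n₂)
  , rational ∷ real ∷ complex ∷ []
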